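{- Let $1<M<2$ and suppose that $c<\mathrm{rad}(abc)^M$ for all coprime positive integers $a,b,c$ with $a+b=c$. Then for each real $\eta>1-\frac{2-M}{4M}$ the following holds: for all but finitely many triples of coprime positive integers $(a,b,c)$ satisfying $a+b=c$ and not of the form $(1,N,q)$ with $q$ prime (up to order), there is $\psi\in\mathscr{T}(a,b)$ such that $a,b$ are $\psi$-independent and $\|\psi\|<c^{\eta}$.
   Context: For a prime $p$, $v_p$ is the $p$-adic valuation. For a non-zero integer $n$, $\mathrm{supp}(n)$ is the set of primes dividing $n$; for a positive integer $n$, $\mathrm{rad}(n)$ is the product of the distinct primes dividing $n$. Let $\Omega$ be the free $\mathbb{Z}$-module on symbols $\xi_p$, one for each prime $p$. Define $\mathrm{d}:\mathbb{Z}\to\Omega$ by $\mathrm{d}0=0$ and $\mathrm{d}n=\sum_{p\mid n}\frac{n\,v_p(n)}{p}\,\xi_p$ for $n\ne 0$ (the coefficients are integers). For a $\mathbb{Z}$-linear map $\psi:\Omega\to\mathbb{Z}$ put $\|\psi\|=\sup_p|\psi(\xi_p)|$. Let $\mathscr{T}$ be the $\mathbb{Z}$-module of all $\mathbb{Z}$-linear $\psi:\Omega\to\mathbb{Z}$ with $\|\psi\|<\infty$. For $\psi\in\mathscr{T}$ let $\mathrm{d}^\psi=\psi\circ\mathrm{d}:\mathbb{Z}\to\mathbb{Z}$ and $\mathrm{supp}(\psi)=\{p:\psi(\xi_p)\neq0\}$. For positive integers $a,b$, $$\mathscr{T}(a,b)=\{\psi\in\mathscr{T}:\ \mathrm{supp}(\psi)\subseteq\mathrm{supp}(ab(a+b))\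 \text{and}\ \mathrm{d}^\psi(a+b)=\mathrm{d}^\psi a+\mathrm{d}^\psi b\}.$$ Integers $a,b$ are $\psi$-independent if $W^\psi(a,b):=a\,\mathrm{d}^\psi b-b\,\mathrm{d}^\psi a\neq 0$. A triple is "of the form $(1,N,q)$ up to order" if some permutation of it equals $(1,N,q)$ with $N$ a positive integer and $q$ prime. -}

module Defs where

open import Algebra.Module.Bundles using (LeftModule)
import Algebra.Module.Construct.TensorUnit as TensorUnit
open import Algebra.Module.Morphism.Structures using (module LeftModuleMorphisms)
open import Data.Integer.Base as ℤ using (ℤ; 0ℤ; 1ℤ; -1ℤ)
open import Data.Integer.DivMod using (_/ℕ_)
import Data.Integer.Properties as ℤ
open import Data.List.Base using (List; []; _∷_; _++_; map; mapMaybe; filter; upTo)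
open import Data.List.Extrema.Nat using (max)
open import Data.List.Relation.Binary.Permutation.Propositional using (_↭_)
open import Data.Maybe.Base using (Maybe; just; nothing)
open import Data.Nat.Base as ℕ using (ℕ; suc)
open import Data.Nat.Divisibility using (_∣_; _∣?_)
open import Data.Nat.ListAction using (product)
open import Data.Nat.GCD using (gcd)
open import Data.Nat.Primality using (Prime; prime?; prime⇒nonZero)
import Data.Nat.Properties as ℕ
open import Data.Product.Base using (Σ-syntax; ∃; ∃-syntax; _×_; _,_; proj₁; proj₂)
open import Data.Rational.Base as ℚ using (ℚ; 0ℚ; 1ℚ; ½)
import Data.Rational.Properties as ℚ
open import Data.Rational.Solver using (module +-*-Solver)
open import Level using (0ℓ)
open import Relation.Binary.PropositionalEquality
open import Relation.Nullary using (yes; no; contradiction)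

-- Cauchy sequences of rationals.  Two sequences may represent the same
-- real number; everything below depends on them only through _<ᴿ_, which
-- respects this identification.

record ℝ : Set where
  constructor mkℝ
  field
    seq    : ℕ → ℚ
    cauchy : ∀ ε → 0ℚ ℚ.< ε →
             ∃[ N ] ∀ m n → N ℕ.≤ m → N ℕ.≤ n → ℚ.∣ seq m ℚ.- seq n ∣ ℚ.< ε

open ℝ public

infix  4 _<ᴿ_
infixl 6 _+ᴿ_ _-ᴿ_
infixl 7 _*ᴿ_ _÷ᴿ_[_]
infix  8 -ᴿ_

_<ᴿ_ : ℝ → ℝ → Set
x <ᴿ y = ∃[ ε ] 0ℚ ℚ.< ε × ∃[ N ] ∀ n → N ℕ.≤ n → seq x n ℚ.+ ε ℚ.≤ seq y n

fromℚ : ℚ → ℝ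
fromℚ q = mkℝ (λ _ → q) λ ε 0<ε → 0 , λ _ _ _ _ →
  subst (ℚ._< ε) (sym (cong ℚ.∣_∣ (ℚ.+-inverseʳ q))) 0<ε

fromℕ : ℕ → ℝ
fromℕ n = fromℚ (ℤ.+ n ℚ./ 1)

0<*0< : ∀ {p q} → 0ℚ ℚ.< p → 0ℚ ℚ.< q → 0ℚ ℚ.< p ℚ.* q
0<*0< {p} {q} 0<p 0<q = ℚ.positive⁻¹ (p ℚ.* q)
  {{ℚ.pos*pos⇒pos p {{ℚ.positive 0<p}} q {{ℚ.positive 0<q}}}}

0<½ : 0ℚ ℚ.< ½
0<½ = ℚ.positive⁻¹ ½

halves : ∀ ε → ½ ℚ.* ε ℚ.+ ½ ℚ.* ε ≡ ε
halves = solve 1 (λ ε → con ½ :* ε :+ con ½ :* ε := ε) refl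
  where open +-*-Solver

≤-*-mono : ∀ {p q r s} → 0ℚ ℚ.≤ q → 0ℚ ℚ.≤ r → p ℚ.≤ q → r ℚ.≤ s →
           p ℚ.* r ℚ.≤ q ℚ.* s
≤-*-mono {p} {q} {r} {s} 0≤q 0≤r p≤q r≤s = ℚ.≤-trans
  (ℚ.*-monoʳ-≤-nonNeg r {{ℚ.nonNegative 0≤r}} p≤q)
  (ℚ.*-monoˡ-≤-nonNeg q {{ℚ.nonNegative 0≤q}} r≤s)

recip : ℚ → ℚ
recip q with q ℚ.≟ 0ℚ
... | yes _  = 0ℚ
... | no q≢0 = ℚ.1/_ q {{ℚ.≢-nonZero q≢0}}

recip-inverse : ∀ q → 0ℚ ℚ.< q → recip q ℚ.* q ≡ 1ℚ
recip-inverse q 0<q with q ℚ.≟ 0ℚ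
... | yes q≡0 = contradiction (sym q≡0) (ℚ.<⇒≢ 0<q)
... | no q≢0  = ℚ.*-inverseˡ q {{ℚ.≢-nonZero q≢0}}

0<recip : ∀ q → 0ℚ ℚ.< q → 0ℚ ℚ.< recip q
0<recip q 0<q with q ℚ.≟ 0ℚ
... | yes q≡0 = contradiction (sym q≡0) (ℚ.<⇒≢ 0<q)
... | no q≢0  = ℚ.positive⁻¹ _ {{ℚ.1/pos⇒pos q {{ℚ.positive 0<q}}}}

eventuallyBounded : (x : ℝ) →
  ∃[ B ] 0ℚ ℚ.< B × ∃[ N ] ∀ n → N ℕ.≤ n → ℚ.∣ seq x n ∣ ℚ.≤ B
eventuallyBounded x with cauchy x 1ℚ (ℚ.positive⁻¹ 1ℚ)
... | N , close = 1ℚ ℚ.+ ℚ.∣ xN ∣ , 0<B , N , bound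
  where
  open ℚ.≤-Reasoning
  xN = seq x N
  0<B : 0ℚ ℚ.< 1ℚ ℚ.+ ℚ.∣ xN ∣
  0<B = ℚ.+-mono-<-≤ (ℚ.positive⁻¹ 1ℚ) (ℚ.0≤∣p∣ xN)
  bound : ∀ n → N ℕ.≤ n → ℚ.∣ seq x n ∣ ℚ.≤ 1ℚ ℚ.+ ℚ.∣ xN ∣
  bound n N≤n = begin
    ℚ.∣ seq x n ∣                      ≡⟨ cong ℚ.∣_∣ (split (seq x n) xN) ⟩
    ℚ.∣ (seq x n ℚ.- xN) ℚ.+ xN ∣      ≤⟨ ℚ.∣p+q∣≤∣p∣+∣q∣ (seq x n ℚ.- xN) xN ⟩
    ℚ.∣ seq x n ℚ.- xN ∣ ℚ.+ ℚ.∣ xN ∣  ≤⟨ ℚ.+-monoˡ-≤ ℚ.∣ xN ∣ (ℚ.<⇒≤ (close n N N≤n ℕ.≤-refl)) ⟩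
    1ℚ ℚ.+ ℚ.∣ xN ∣                    ∎
    where
    split : ∀ p q → p ≡ (p ℚ.- q) ℚ.+ q
    split = solve 2 (λ p q → p := (p :- q) :+ q) refl
      where open +-*-Solver

_+ᴿ_ : ℝ → ℝ → ℝ
x +ᴿ y = mkℝ (λ n → seq x n ℚ.+ seq y n) sum-cauchy
  where
  rearrange : ∀ a b c d → (a ℚ.+ b) ℚ.- (c ℚ.+ d) ≡ (a ℚ.- c) ℚ.+ (b ℚ.- d)
  rearrange = solve 4 (λ a b c d → (a :+ b) :- (c :+ d) := (a :- c) :+ (b :- d)) refl
    where open +-*-Solver
  sum-cauchy : ∀ ε → 0ℚ ℚ.< ε → ∃[ N ] ∀ m n → N ℕ.≤ m → N ℕ.≤ n →
    ℚ.∣ (seq x m ℚ.+ seq y m) ℚ.- (seq x n ℚ.+ seq y n) ∣ ℚ.< ε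
  sum-cauchy ε 0<ε
    with cauchy x (½ ℚ.* ε) (0<*0< 0<½ 0<ε) | cauchy y (½ ℚ.* ε) (0<*0< 0<½ 0<ε)
  ... | N₁ , f | N₂ , g = N₁ ℕ.⊔ N₂ , λ m n N≤m N≤n → begin-strict
      ℚ.∣ (seq x m ℚ.+ seq y m) ℚ.- (seq x n ℚ.+ seq y n) ∣
        ≡⟨ cong ℚ.∣_∣ (rearrange (seq x m) (seq y m) (seq x n) (seq y n)) ⟩
      ℚ.∣ (seq x m ℚ.- seq x n) ℚ.+ (seq y m ℚ.- seq y n) ∣
        ≤⟨ ℚ.∣p+q∣≤∣p∣+∣q∣ (seq x m ℚ.- seq x n) (seq y m ℚ.- seq y n) ⟩
      ℚ.∣ seq x m ℚ.- seq x n ∣ ℚ.+ ℚ.∣ seq y m ℚ.- seq y n ∣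
        <⟨ ℚ.+-mono-< (f m n (ℕ.m⊔n≤o⇒m≤o N₁ N₂ N≤m) (ℕ.m⊔n≤o⇒m≤o N₁ N₂ N≤n))
                      (g m n (ℕ.m⊔n≤o⇒n≤o N₁ N₂ N≤m) (ℕ.m⊔n≤o⇒n≤o N₁ N₂ N≤n)) ⟩
      ½ ℚ.* ε ℚ.+ ½ ℚ.* ε  ≡⟨ halves ε ⟩
      ε  ∎
    where open ℚ.≤-Reasoning

-ᴿ_ : ℝ → ℝ
-ᴿ x = mkℝ (λ n → ℚ.- seq x n) λ ε 0<ε →
  let N , f = cauchy x ε 0<ε in
  N , λ m n N≤m N≤n → subst (ℚ._< ε)
    (trans (sym (ℚ.∣-p∣≡∣p∣ (seq x m ℚ.- seq x n)))
           (cong ℚ.∣_∣ (ℚ.neg-distrib-+ (seq x m) (ℚ.- seq x n))))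
    (f m n N≤m N≤n)

_-ᴿ_ : ℝ → ℝ → ℝ
x -ᴿ y = x +ᴿ (-ᴿ y)

_*ᴿ_ : ℝ → ℝ → ℝ
x *ᴿ y = mkℝ (λ n → seq x n ℚ.* seq y n) product-cauchy
  where
  rearrange : ∀ a b c d →
    a ℚ.* b ℚ.- c ℚ.* d ≡ a ℚ.* (b ℚ.- d) ℚ.+ d ℚ.* (a ℚ.- c)
  rearrange = solve 4 (λ a b c d → a :* b :- c :* d := a :* (b :- d) :+ d :* (a :- c)) refl
    where open +-*-Solver
  cancel : ∀ B ε → 0ℚ ℚ.< B → B ℚ.* (recip B ℚ.* ε) ≡ ε
  cancel B ε 0<B = begin
    B ℚ.* (recip B ℚ.* ε)  ≡⟨ ℚ.*-assoc B (recip B) ε ⟨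
    (B ℚ.* recip B) ℚ.* ε  ≡⟨ cong (ℚ._* ε) (trans (ℚ.*-comm B (recip B)) (recip-inverse B 0<B)) ⟩
    1ℚ ℚ.* ε               ≡⟨ ℚ.*-identityˡ ε ⟩
    ε                      ∎
    where open ≡-Reasoning
  part : ∀ B δ p q → 0ℚ ℚ.< B → ℚ.∣ p ∣ ℚ.≤ B → ℚ.∣ q ∣ ℚ.< recip B ℚ.* δ →
         ℚ.∣ p ℚ.* q ∣ ℚ.≤ δ
  part B δ p q 0<B p≤B q<δ = begin
    ℚ.∣ p ℚ.* q ∣          ≡⟨ ℚ.∣p*q∣≡∣p∣*∣q∣ p q ⟩
    ℚ.∣ p ∣ ℚ.* ℚ.∣ q ∣    ≤⟨ ≤-*-mono (ℚ.<⇒≤ 0<B) (ℚ.0≤∣p∣ q) p≤B (ℚ.<⇒≤ q<δ) ⟩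
    B ℚ.* (recip B ℚ.* δ)  ≡⟨ cancel B δ 0<B ⟩
    δ                      ∎
    where open ℚ.≤-Reasoning
  estimate : ∀ B C δ xm ym xn yn → 0ℚ ℚ.< B → 0ℚ ℚ.< C →
    ℚ.∣ xm ∣ ℚ.≤ B → ℚ.∣ yn ∣ ℚ.≤ C →
    ℚ.∣ ym ℚ.- yn ∣ ℚ.< recip B ℚ.* δ → ℚ.∣ xm ℚ.- xn ∣ ℚ.< recip C ℚ.* δ →
    ℚ.∣ xm ℚ.* ym ℚ.- xn ℚ.* yn ∣ ℚ.≤ δ ℚ.+ δ
  estimate B C δ xm ym xn yn 0<B 0<C xm≤B yn≤C y-close x-close = begin
    ℚ.∣ xm ℚ.* ym ℚ.- xn ℚ.* yn ∣
      ≡⟨ cong ℚ.∣_∣ (rearrange xm ym xn yn) ⟩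
    ℚ.∣ xm ℚ.* (ym ℚ.- yn) ℚ.+ yn ℚ.* (xm ℚ.- xn) ∣
      ≤⟨ ℚ.∣p+q∣≤∣p∣+∣q∣ (xm ℚ.* (ym ℚ.- yn)) (yn ℚ.* (xm ℚ.- xn)) ⟩
    ℚ.∣ xm ℚ.* (ym ℚ.- yn) ∣ ℚ.+ ℚ.∣ yn ℚ.* (xm ℚ.- xn) ∣
      ≤⟨ ℚ.+-mono-≤ (part B δ xm (ym ℚ.- yn) 0<B xm≤B y-close)
                    (part C δ yn (xm ℚ.- xn) 0<C yn≤C x-close) ⟩
    δ ℚ.+ δ ∎
    where open ℚ.≤-Reasoning
  quarters : ∀ ε → 0ℚ ℚ.< ε → ½ ℚ.* (½ ℚ.* ε) ℚ.+ ½ ℚ.* (½ ℚ.* ε) ℚ.< ε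
  quarters ε 0<ε = begin-strict
    ½ ℚ.* (½ ℚ.* ε) ℚ.+ ½ ℚ.* (½ ℚ.* ε)  ≡⟨ halves (½ ℚ.* ε) ⟩
    ½ ℚ.* ε          <⟨ ℚ.*-monoˡ-<-pos ε {{ℚ.positive 0<ε}} {½} {1ℚ} ½<1 ⟩
    1ℚ ℚ.* ε         ≡⟨ ℚ.*-identityˡ ε ⟩
    ε                ∎
    where
    open ℚ.≤-Reasoning
    ½<1 : ½ ℚ.< 1ℚ
    ½<1 = ℚ.*<* (ℤ.+<+ (ℕ.s≤s (ℕ.s≤s ℕ.z≤n)))
  product-cauchy : ∀ ε → 0ℚ ℚ.< ε → ∃[ N ] ∀ m n → N ℕ.≤ m → N ℕ.≤ n →
    ℚ.∣ seq x m ℚ.* seq y m ℚ.- seq x n ℚ.* seq y n ∣ ℚ.< ε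
  product-cauchy ε 0<ε =
    let
      δ   = ½ ℚ.* (½ ℚ.* ε)
      0<δ = 0<*0< 0<½ (0<*0< 0<½ 0<ε)
      B , 0<B , N₁ , xb = eventuallyBounded x
      C , 0<C , N₂ , yb = eventuallyBounded y
      N₃ , f = cauchy y (recip B ℚ.* δ) (0<*0< (0<recip B 0<B) 0<δ)
      N₄ , g = cauchy x (recip C ℚ.* δ) (0<*0< (0<recip C 0<C) 0<δ)
      left : ∀ {k} → (N₁ ℕ.⊔ N₂) ℕ.⊔ (N₃ ℕ.⊔ N₄) ℕ.≤ k → N₁ ℕ.⊔ N₂ ℕ.≤ k
      left = ℕ.m⊔n≤o⇒m≤o (N₁ ℕ.⊔ N₂) (N₃ ℕ.⊔ N₄)
      right : ∀ {k} → (N₁ ℕ.⊔ N₂) ℕ.⊔ (N₃ ℕ.⊔ N₄) ℕ.≤ k → N₃ ℕ.⊔ N₄ ℕ.≤ k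
      right = ℕ.m⊔n≤o⇒n≤o (N₁ ℕ.⊔ N₂) (N₃ ℕ.⊔ N₄)
    in (N₁ ℕ.⊔ N₂) ℕ.⊔ (N₃ ℕ.⊔ N₄) , λ m n N≤m N≤n → ℚ.≤-<-trans
      (estimate B C δ (seq x m) (seq y m) (seq x n) (seq y n) 0<B 0<C
        (xb m (ℕ.m⊔n≤o⇒m≤o N₁ N₂ (left N≤m)))
        (yb n (ℕ.m⊔n≤o⇒n≤o N₁ N₂ (left N≤n)))
        (f m n (ℕ.m⊔n≤o⇒m≤o N₃ N₄ (right N≤m)) (ℕ.m⊔n≤o⇒m≤o N₃ N₄ (right N≤n)))
        (g m n (ℕ.m⊔n≤o⇒n≤o N₃ N₄ (right N≤m)) (ℕ.m⊔n≤o⇒n≤o N₃ N₄ (right N≤n))))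
      (quarters ε 0<ε)

-- Finitely many terms of y may vanish; recip sends 0 to 0.
reciprocal : (y : ℝ) → fromℕ 0 <ᴿ y → ℝ
reciprocal y (e , 0<e , N₀ , e≤y) = mkℝ (λ n → recip (seq y n)) reciprocal-cauchy
  where
  rearrange : ∀ a b c d →
    (a ℚ.- c) ℚ.* (b ℚ.* d) ≡ (a ℚ.* b) ℚ.* d ℚ.- (c ℚ.* d) ℚ.* b
  rearrange = solve 4 (λ a b c d → (a :- c) :* (b :* d) := (a :* b) :* d :- (c :* d) :* b) refl
    where open +-*-Solver
  e≤ : ∀ n → N₀ ℕ.≤ n → e ℚ.≤ seq y n
  e≤ n N≤n = subst (ℚ._≤ seq y n) (ℚ.+-identityˡ e) (e≤y n N≤n)
  difference : ∀ p q → 0ℚ ℚ.< p → 0ℚ ℚ.< q →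
    (recip p ℚ.- recip q) ℚ.* (p ℚ.* q) ≡ q ℚ.- p
  difference p q 0<p 0<q = begin
    (recip p ℚ.- recip q) ℚ.* (p ℚ.* q)
      ≡⟨ rearrange (recip p) p (recip q) q ⟩
    (recip p ℚ.* p) ℚ.* q ℚ.- (recip q ℚ.* q) ℚ.* p
      ≡⟨ cong₂ (λ s t → s ℚ.* q ℚ.- t ℚ.* p) (recip-inverse p 0<p) (recip-inverse q 0<q) ⟩
    1ℚ ℚ.* q ℚ.- 1ℚ ℚ.* p
      ≡⟨ cong₂ ℚ._-_ (ℚ.*-identityˡ q) (ℚ.*-identityˡ p) ⟩
    q ℚ.- p ∎
    where open ≡-Reasoning
  close : ∀ ε p q → 0ℚ ℚ.< ε → e ℚ.≤ p → e ℚ.≤ q →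
          ℚ.∣ q ℚ.- p ∣ ℚ.< ε ℚ.* (e ℚ.* e) → ℚ.∣ recip p ℚ.- recip q ∣ ℚ.< ε
  close ε p q 0<ε e≤p e≤q q-p<εee =
    ℚ.*-cancelʳ-<-nonNeg (p ℚ.* q) {{ℚ.nonNegative (ℚ.<⇒≤ 0<pq)}} (begin-strict
      ℚ.∣ recip p ℚ.- recip q ∣ ℚ.* (p ℚ.* q)
        ≡⟨ cong (ℚ.∣ recip p ℚ.- recip q ∣ ℚ.*_) (sym (ℚ.0≤p⇒∣p∣≡p (ℚ.<⇒≤ 0<pq))) ⟩
      ℚ.∣ recip p ℚ.- recip q ∣ ℚ.* ℚ.∣ p ℚ.* q ∣
        ≡⟨ ℚ.∣p*q∣≡∣p∣*∣q∣ (recip p ℚ.- recip q) (p ℚ.* q) ⟨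
      ℚ.∣ (recip p ℚ.- recip q) ℚ.* (p ℚ.* q) ∣
        ≡⟨ cong ℚ.∣_∣ (difference p q 0<p 0<q) ⟩
      ℚ.∣ q ℚ.- p ∣
        <⟨ q-p<εee ⟩
      ε ℚ.* (e ℚ.* e)
        ≤⟨ ≤-*-mono (ℚ.<⇒≤ 0<ε) (ℚ.<⇒≤ (0<*0< 0<e 0<e)) ℚ.≤-refl
             (≤-*-mono (ℚ.<⇒≤ 0<p) (ℚ.<⇒≤ 0<e) e≤p e≤q) ⟩
      ε ℚ.* (p ℚ.* q) ∎)
    where
    open ℚ.≤-Reasoning
    0<p = ℚ.<-≤-trans 0<e e≤p
    0<q = ℚ.<-≤-trans 0<e e≤q
    0<pq = 0<*0< 0<p 0<q
  reciprocal-cauchy : ∀ ε → 0ℚ ℚ.< ε → ∃[ N ] ∀ m n → N ℕ.≤ m → N ℕ.≤ n →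
    ℚ.∣ recip (seq y m) ℚ.- recip (seq y n) ∣ ℚ.< ε
  reciprocal-cauchy ε 0<ε with cauchy y (ε ℚ.* (e ℚ.* e)) (0<*0< 0<ε (0<*0< 0<e 0<e))
  ... | N₁ , f = N₀ ℕ.⊔ N₁ , λ m n N≤m N≤n →
    close ε (seq y m) (seq y n) 0<ε
      (e≤ m (ℕ.m⊔n≤o⇒m≤o N₀ N₁ N≤m)) (e≤ n (ℕ.m⊔n≤o⇒m≤o N₀ N₁ N≤n))
      (f n m (ℕ.m⊔n≤o⇒n≤o N₀ N₁ N≤n) (ℕ.m⊔n≤o⇒n≤o N₀ N₁ N≤m))

_÷ᴿ_[_] : ℝ → (y : ℝ) → fromℕ 0 <ᴿ y → ℝ
x ÷ᴿ y [ 0<y ] = x *ᴿ reciprocal y 0<y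

0<4* : ∀ {x} → fromℕ 1 <ᴿ x → fromℕ 0 <ᴿ fromℕ 4 *ᴿ x
0<4* {x} (ε , 0<ε , N , 1+ε≤x) = ε , 0<ε , N , λ n N≤n → begin
    0ℚ ℚ.+ ε               ≤⟨ ℚ.+-monoˡ-≤ ε 0≤1 ⟩
    1ℚ ℚ.+ ε               ≤⟨ 1+ε≤x n N≤n ⟩
    seq x n                ≡⟨ ℚ.*-identityˡ (seq x n) ⟨
    1ℚ ℚ.* seq x n         ≤⟨ ℚ.*-monoʳ-≤-nonNeg (seq x n) {{ℚ.nonNegative (0≤x n N≤n)}} 1≤4 ⟩
    (ℤ.+ 4 ℚ./ 1) ℚ.* seq x n  ∎
  where
  open ℚ.≤-Reasoning
  0≤1 : 0ℚ ℚ.≤ 1ℚ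
  0≤1 = ℚ.<⇒≤ (ℚ.positive⁻¹ 1ℚ)
  1≤4 : 1ℚ ℚ.≤ ℤ.+ 4 ℚ./ 1
  1≤4 = ℚ.*≤* (ℤ.+≤+ (ℕ.s≤s ℕ.z≤n))
  0≤x : ∀ n → N ℕ.≤ n → 0ℚ ℚ.≤ seq x n
  0≤x n N≤n = ℚ.≤-trans (ℚ.<⇒≤ (ℚ.+-mono-≤-< 0≤1 0<ε)) (1+ε≤x n N≤n)

-- n < r ^ x for natural r ≥ 1 and real x > 0.  Here r ^ x is the supremum
-- of the r ^ q over rational q with 0 ≤ q < x; for q = u / (1 + k) the
-- inequality n < r ^ q says n ^ (1 + k) < r ^ u.
_<[_^_] : ℕ → ℕ → ℝ → Set
n <[ r ^ x ] =
  ∃[ u ] ∃[ k ] fromℚ (ℤ.+ u ℚ./ suc k) <ᴿ x × n ℕ.^ suc k ℕ.< r ℕ.^ u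

ℙ : Set
ℙ = ∃ Prime

primeDivisor? : ℕ → ℕ → Maybe ℙ
primeDivisor? n p with prime? p | p ∣? n
... | yes isPrime | yes _ = just (p , isPrime)
... | _           | _     = nothing

-- For n ≠ 0; the list of primeDivisors 0 is empty.
primeDivisors : ℕ → List ℙ
primeDivisors n = mapMaybe (primeDivisor? n) (upTo (suc n))

rad : ℕ → ℕ
rad n = product (map proj₁ (primeDivisors n))

-- For n ≠ 0, the largest k with p ^ k ∣ n; such k satisfy k < p ^ k ≤ n.
v : ℙ → ℕ → ℕ
v (p , _) n = max 0 (filter (λ k → p ℕ.^ k ∣? n) (upTo n))

-- A list of pairs (p , z) stands for the formal sum of the z · ξ p.
Ω : Set
Ω = List (ℙ × ℤ)

coeff : ℕ → Ω → ℤ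
coeff q []                  = 0ℤ
coeff q (((p , _) , z) ∷ ω) with q ℕ.≟ p
... | yes _ = z ℤ.+ coeff q ω
... | no  _ = coeff q ω

infix  4 _≈Ω_
infixr 7 _·_

-- The coefficients at numbers that are not prime are all 0.
record _≈Ω_ (ω ω′ : Ω) : Set where
  constructor mk≈
  field same : ∀ q → coeff q ω ≡ coeff q ω′

_·_ : ℤ → Ω → Ω
k · ω = map (λ (p , z) → p , k ℤ.* z) ω

-Ω_ : Ω → Ω
-Ω ω = -1ℤ · ω

ξ : ℙ → Ω
ξ p = (p , 1ℤ) ∷ []

open _≈Ω_

coeff-++ : ∀ q ω ω′ → coeff q (ω ++ ω′) ≡ coeff q ω ℤ.+ coeff q ω′
coeff-++ q []                  ω′ = sym (ℤ.+-identityˡ _)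
coeff-++ q (((p , _) , z) ∷ ω) ω′ with q ℕ.≟ p
... | yes _ = trans (cong (ℤ._+_ z) (coeff-++ q ω ω′)) (sym (ℤ.+-assoc z _ _))
... | no  _ = coeff-++ q ω ω′

coeff-· : ∀ q k ω → coeff q (k · ω) ≡ k ℤ.* coeff q ω
coeff-· q k []                  = sym (ℤ.*-zeroʳ k)
coeff-· q k (((p , _) , z) ∷ ω) with q ℕ.≟ p
... | yes _ = trans (cong (ℤ._+_ (k ℤ.* z)) (coeff-· q k ω)) (sym (ℤ.*-distribˡ-+ k z _))
... | no  _ = coeff-· q k ω

coeff-- : ∀ q ω → coeff q (-Ω ω) ≡ ℤ.- coeff q ω
coeff-- q ω = trans (coeff-· q -1ℤ ω) (ℤ.-1*i≡-i (coeff q ω))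

via-++ : ∀ {ω₁ ω₂ ω₃ ω₄} →
  (∀ q → coeff q ω₁ ℤ.+ coeff q ω₂ ≡ coeff q ω₃ ℤ.+ coeff q ω₄) →
  ω₁ ++ ω₂ ≈Ω ω₃ ++ ω₄
via-++ {ω₁} {ω₂} {ω₃} {ω₄} h .same q =
  trans (coeff-++ q ω₁ ω₂) (trans (h q) (sym (coeff-++ q ω₃ ω₄)))

Ω-leftModule : LeftModule ℤ.+-*-ring 0ℓ 0ℓ
Ω-leftModule = record
  { Carrierᴹ     = Ω
  ; _≈ᴹ_         = _≈Ω_
  ; _+ᴹ_         = _++_
  ; _*ₗ_         = _·_
  ; 0ᴹ           = []
  ; -ᴹ_          = -Ω_
  ; isLeftModule = record
    { isLeftSemimodule = record
      { +ᴹ-isCommutativeMonoid = record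
        { isMonoid = record
          { isSemigroup = record
            { isMagma = record
              { isEquivalence = record
                { refl  = mk≈ λ _ → refl
                ; sym   = λ e → mk≈ λ q → sym (same e q)
                ; trans = λ e f → mk≈ λ q → trans (same e q) (same f q)
                }
              ; ∙-cong = λ {ω₁} {ω₂} {ω₃} {ω₄} e f → via-++ {ω₁} {ω₃} {ω₂} {ω₄}
                  λ q → cong₂ ℤ._+_ (same e q) (same f q)
              }
            ; assoc = λ ω₁ ω₂ ω₃ → mk≈ λ q → begin
                coeff q ((ω₁ ++ ω₂) ++ ω₃)
                  ≡⟨ coeff-++ q (ω₁ ++ ω₂) ω₃ ⟩
                coeff q (ω₁ ++ ω₂) ℤ.+ coeff q ω₃
                  ≡⟨ cong (ℤ._+ coeff q ω₃) (coeff-++ q ω₁ ω₂) ⟩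
                coeff q ω₁ ℤ.+ coeff q ω₂ ℤ.+ coeff q ω₃
                  ≡⟨ ℤ.+-assoc (coeff q ω₁) (coeff q ω₂) (coeff q ω₃) ⟩
                coeff q ω₁ ℤ.+ (coeff q ω₂ ℤ.+ coeff q ω₃)
                  ≡⟨ cong (ℤ._+_ (coeff q ω₁)) (coeff-++ q ω₂ ω₃) ⟨
                coeff q ω₁ ℤ.+ coeff q (ω₂ ++ ω₃)
                  ≡⟨ coeff-++ q ω₁ (ω₂ ++ ω₃) ⟨
                coeff q (ω₁ ++ (ω₂ ++ ω₃)) ∎
            }
          ; identity = (λ _ → mk≈ λ _ → refl)
                     , (λ ω → mk≈ λ q → trans (coeff-++ q ω []) (ℤ.+-identityʳ _))
          }
        ; comm = λ ω₁ ω₂ → via-++ {ω₁} {ω₂} {ω₂} {ω₁} λ q → ℤ.+-comm (coeff q ω₁) _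
        }
      ; isPreleftSemimodule = record
        { *ₗ-cong = λ {k} {l} {ω₁} {ω₂} k≡l e → mk≈ λ q → begin
            coeff q (k · ω₁)    ≡⟨ coeff-· q k ω₁ ⟩
            k ℤ.* coeff q ω₁    ≡⟨ cong₂ ℤ._*_ k≡l (same e q) ⟩
            l ℤ.* coeff q ω₂    ≡⟨ coeff-· q l ω₂ ⟨
            coeff q (l · ω₂)    ∎
        ; *ₗ-zeroˡ = λ ω → mk≈ λ q → coeff-· q 0ℤ ω
        ; *ₗ-distribʳ = λ ω k l → mk≈ λ q → begin
            coeff q ((k ℤ.+ l) · ω)                 ≡⟨ coeff-· q (k ℤ.+ l) ω ⟩
            (k ℤ.+ l) ℤ.* coeff q ω                 ≡⟨ ℤ.*-distribʳ-+ (coeff q ω) k l ⟩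
            k ℤ.* coeff q ω ℤ.+ l ℤ.* coeff q ω     ≡⟨ cong₂ ℤ._+_ (coeff-· q k ω) (coeff-· q l ω) ⟨
            coeff q (k · ω) ℤ.+ coeff q (l · ω)     ≡⟨ coeff-++ q (k · ω) (l · ω) ⟨
            coeff q (k · ω ++ l · ω)                ∎
        ; *ₗ-identityˡ = λ ω → mk≈ λ q → trans (coeff-· q 1ℤ ω) (ℤ.*-identityˡ _)
        ; *ₗ-assoc = λ k l ω → mk≈ λ q → begin
            coeff q ((k ℤ.* l) · ω)      ≡⟨ coeff-· q (k ℤ.* l) ω ⟩
            k ℤ.* l ℤ.* coeff q ω        ≡⟨ ℤ.*-assoc k l (coeff q ω) ⟩
            k ℤ.* (l ℤ.* coeff q ω)      ≡⟨ cong (k ℤ.*_) (coeff-· q l ω) ⟨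
            k ℤ.* coeff q (l · ω)        ≡⟨ coeff-· q k (l · ω) ⟨
            coeff q (k · l · ω)          ∎
        ; *ₗ-zeroʳ = λ _ → mk≈ λ _ → refl
        ; *ₗ-distribˡ = λ k ω₁ ω₂ → mk≈ λ q → begin
            coeff q (k · (ω₁ ++ ω₂))                  ≡⟨ coeff-· q k (ω₁ ++ ω₂) ⟩
            k ℤ.* coeff q (ω₁ ++ ω₂)                  ≡⟨ cong (k ℤ.*_) (coeff-++ q ω₁ ω₂) ⟩
            k ℤ.* (coeff q ω₁ ℤ.+ coeff q ω₂)         ≡⟨ ℤ.*-distribˡ-+ k (coeff q ω₁) _ ⟩
            k ℤ.* coeff q ω₁ ℤ.+ k ℤ.* coeff q ω₂     ≡⟨ cong₂ ℤ._+_ (coeff-· q k ω₁) (coeff-· q k ω₂) ⟨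
            coeff q (k · ω₁) ℤ.+ coeff q (k · ω₂)     ≡⟨ coeff-++ q (k · ω₁) (k · ω₂) ⟨
            coeff q (k · ω₁ ++ k · ω₂)                ∎
        }
      }
    ; -ᴹ‿cong = λ {ω₁} {ω₂} e → mk≈ λ q → begin
        coeff q (-Ω ω₁)    ≡⟨ coeff-- q ω₁ ⟩
        ℤ.- coeff q ω₁     ≡⟨ cong ℤ.-_ (same e q) ⟩
        ℤ.- coeff q ω₂     ≡⟨ coeff-- q ω₂ ⟨
        coeff q (-Ω ω₂)    ∎
    ; -ᴹ‿inverse =
        (λ ω → mk≈ λ q → begin
          coeff q (-Ω ω ++ ω)              ≡⟨ coeff-++ q (-Ω ω) ω ⟩
          coeff q (-Ω ω) ℤ.+ coeff q ω     ≡⟨ cong (ℤ._+ coeff q ω) (coeff-- q ω) ⟩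
          ℤ.- coeff q ω ℤ.+ coeff q ω      ≡⟨ ℤ.+-inverseˡ (coeff q ω) ⟩
          0ℤ                               ∎)
      , (λ ω → mk≈ λ q → begin
          coeff q (ω ++ -Ω ω)              ≡⟨ coeff-++ q ω (-Ω ω) ⟩
          coeff q ω ℤ.+ coeff q (-Ω ω)     ≡⟨ cong (ℤ._+_ (coeff q ω)) (coeff-- q ω) ⟩
          coeff q ω ℤ.+ ℤ.- coeff q ω      ≡⟨ ℤ.+-inverseʳ (coeff q ω) ⟩
          0ℤ                               ∎)
    }
  }
  where open ≡-Reasoning

ℤ-leftModule : LeftModule ℤ.+-*-ring 0ℓ 0ℓ
ℤ-leftModule = TensorUnit.leftModule

-- The division is exact, as p ∣ n for every p in the sum.
d-coeff : ℤ → ℙ → ℤ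
d-coeff n p@(p′ , isPrime) =
  _/ℕ_ (n ℤ.* ℤ.+ v p ℤ.∣ n ∣) p′ {{prime⇒nonZero isPrime}}

d : ℤ → Ω
d n = map (λ p → p , d-coeff n p) (primeDivisors ℤ.∣ n ∣)

d-zero : d 0ℤ ≡ []
d-zero = refl

record 𝒯 : Set where
  open LeftModuleMorphisms
    (LeftModule.rawLeftModule Ω-leftModule) (LeftModule.rawLeftModule ℤ-leftModule)
  field
    ⟦_⟧      : Ω → ℤ
    isLinear : IsLeftModuleHomomorphism ⟦_⟧
    bounded  : ∃[ B ] ∀ p → ℤ.∣ ⟦ ξ p ⟧ ∣ ℕ.≤ B

open 𝒯 public using (⟦_⟧)

record ‖_‖≡_ (ψ : 𝒯) (s : ℕ) : Set where
  field
    upperBound : ∀ p → ℤ.∣ ⟦ ψ ⟧ (ξ p) ∣ ℕ.≤ s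
    least      : ∀ t → (∀ p → ℤ.∣ ⟦ ψ ⟧ (ξ p) ∣ ℕ.≤ t) → s ℕ.≤ t

D : 𝒯 → ℤ → ℤ
D ψ n = ⟦ ψ ⟧ (d n)

record _∈𝒯[_,_] (ψ : 𝒯) (a b : ℕ) : Set where
  field
    support  : ∀ p → ⟦ ψ ⟧ (ξ p) ≢ 0ℤ → proj₁ p ∣ a ℕ.* b ℕ.* (a ℕ.+ b)
    additive : D ψ (ℤ.+ (a ℕ.+ b)) ≡ D ψ (ℤ.+ a) ℤ.+ D ψ (ℤ.+ b)

W : 𝒯 → ℤ → ℤ → ℤ
W ψ a b = a ℤ.* D ψ b ℤ.- b ℤ.* D ψ a

Independent : 𝒯 → ℤ → ℤ → Set
Independent ψ a b = W ψ a b ≢ 0ℤ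

-- As a + b ≡ c, a common factor of two of a, b, c divides the third, so
-- coprime as a triple and pairwise coprime are the same.
record ABCTriple (a b c : ℕ) : Set where
  field
    0<a     : 0 ℕ.< a
    0<b     : 0 ℕ.< b
    0<c     : 0 ℕ.< c
    coprime : gcd (gcd a b) c ≡ 1
    a+b≡c   : a ℕ.+ b ≡ c

OneNPrime : ℕ → ℕ → ℕ → Set
OneNPrime a b c =
  ∃[ N ] ∃[ q ] 0 ℕ.< N × Prime q × (a ∷ b ∷ c ∷ []) ↭ (1 ∷ N ∷ q ∷ [])

{-# OPTIONS --safe #-}

-- Let x_p = ψ(ξ_p).  Additivity is one linear equation in the x_p with
-- p ∣ abc, whose coefficient at p has size at most c v_p / p.  Leave the
-- coordinates at two primes p₀, q₀, dividing different terms of the triple, in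
-- [0 , t), and restrict the coordinate at any other prime p used to
-- [0 , min (p , t)); the pigeonhole principle gives a non-zero solution as soon
-- as t · min (p₀ , q₀) · ∏ min (p , t) exceeds c up to logarithms.  If a and b
-- are ψ-dependent then n ∣ d^ψ n for n = a, b, c, and since v_p < p this forces
-- p ∣ x_p, so x_p = 0 at every restricted prime; then d^ψ vanishes at the third
-- term, hence at all three, and x = 0 altogether.  So the solution is
-- independent.
--
-- It remains to choose the primes.  If all terms are > 1 and one has a
-- prime factor > √c, restrict at that prime only.  Otherwise one can
-- take p₀, q₀ ≤ √c (a term other than 1 is composite when another term is 1) and
-- restrict at all other primes, up to a negligible set; then
-- ∏ p ≥ rad(abc) / (p₀ q₀), up to c^ε, and the abc-hypothesis suffices.

module Submission where

open import Defs
open import Data.Nat.Base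
open import Data.Nat.Properties
open import Data.Nat.Coprimality as Coprimality using (Coprime; coprime-divisor)
open import Data.Nat.Divisibility
open import Data.Nat.DivMod using (_/_; _%_; m≡m%n+[m/n]*n; m%n<n; m/n*n≡m)
open import Data.Nat.GCD using (gcd-greatest)
open import Data.Nat.ListAction using (product; sum)
open import Data.Nat.ListAction.Properties using (∈⇒≤product)
open import Data.Nat.Primality
open import Data.Nat.Primality.Factorisation using (factorise; PrimeFactorisation)
import Data.Nat.Solver as ℕ-Solver
open import Data.Fin.Base as Fin using (Fin; toℕ; fromℕ<; remQuot; combine)
import Data.Fin.Properties as Fin
open import Data.Integer.Base as ℤ using (ℤ; +_; 0ℤ; 1ℤ)
open import Data.Integer.Divisibility.Signed as ℤ using (∣ᵤ⇒∣; ∣⇒∣ᵤ)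
open import Data.Integer.DivMod using (_/ℕ_)
import Data.Integer.Properties as ℤ
import Data.Integer.Solver as ℤ-Solver
open import Data.Rational.Base as ℚ using (ℚ; 0ℚ; 1ℚ; ½)
import Data.Rational.Properties as ℚ
import Data.Rational.Solver as ℚ-Solver
import Data.Rational.Unnormalised.Base as ℚᵘ
import Data.Rational.Unnormalised.Properties as ℚᵘ
open import Data.List.Base using (List; []; _∷_; _++_; map; mapMaybe; foldr; filter; upTo; cartesianProduct)
open import Data.List.Extrema.Nat using (max; argmax-sel; xs≤max)
open import Data.List.Membership.DecPropositional _≟_ using (_∈?_)
open import Data.List.Membership.Propositional using (_∈_; _∉_; find)
open import Data.List.Membership.Propositional.Properties
  using (∈-filter⁺; ∈-filter⁻; ∈-map⁺; ∈-upTo⁺; ∈-cartesianProduct⁺)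
open import Data.List.Properties using (map-cong-local; map-id-local)
open import Data.List.Relation.Binary.Permutation.Propositional using (prep; swap; ↭-refl; ↭-trans)
open import Data.List.Relation.Unary.All as All using (All; []; _∷_)
open import Data.List.Relation.Unary.All.Properties as All using (all-filter; ¬All⇒Any¬; ¬Any⇒All¬)
open import Data.List.Relation.Unary.AllPairs as AllPairs using ([]; _∷_)
open import Data.List.Relation.Unary.Any using (Any; any?; here; there)
open import Data.List.Relation.Unary.Unique.Propositional using (Unique)
open import Data.List.Relation.Unary.Unique.Propositional.Properties
  using (upTo⁺) renaming (filter⁺ to unique-filter⁺)
open import Data.Product.Base using (∃-syntax; Σ-syntax; _×_; _,_; proj₁; proj₂)
open import Data.Sum.Base using (_⊎_; inj₁; inj₂; [_,_]′)
open import Function.Base using (id; _∘_)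
open import Relation.Binary.Definitions using (Tri; tri<; tri≈; tri>)
open import Relation.Binary.PropositionalEquality
open import Relation.Nullary using (Dec; yes; no; contradiction; ¬_; ¬?; _×-dec_)
open import Relation.Nullary.Decidable using (decidable-stable)
open import Relation.Unary using (Decidable)

-- Powers of natural numbers

-- Let μ = α/β be the exponent of the abc-hypothesis. The coefficient at a free prime p is at most
-- c/p up to logarithms, so each free coordinate asks for a volume in which p still counts and only
-- the other free prime is lost. For `p₀`, `q₀` ≤ √c this reads t · rad(abc) / √c > c, that is, t
-- above c^(3/2 - 1/μ). When the restricted boxes alone have volume at least √c, t above c^(3/4) is
-- enough. The exponent 1/2 + μ/4 exceeds both for 1 < μ < 2: it is the tangent of 3/2 - 1/μ at μ =
-- 2, and the gap (2 - μ)²/(4μ) pays for the logarithms and the discarded primes. It stays below 1 -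
-- (2 - μ)/(4μ), by (μ - 1)(2 - μ)/(4μ).
--
-- Dependence gives n ∣ d^ψ n because a · d^ψ b = b · d^ψ a with a, b coprime, and additivity
-- carries this over to c.
--
-- A triple (1, N, q) escapes the method: the term 1 has no prime, so q, which is c or c - 1, would
-- have to be a free prime, far above √c.
--
-- Logarithms enter as ℓ ≤ K · c^(3/K) with K large, so that the estimates compare powers of natural
-- numbers; real exponents occur only in the hypothesis and the conclusion.

*-^-distrib : ∀ m n k → (m * n) ^ k ≡ m ^ k * n ^ k
*-^-distrib m n zero    = refl
*-^-distrib m n (suc k) = begin
  m * n * (m * n) ^ k        ≡⟨ cong (m * n *_) (*-^-distrib m n k) ⟩
  m * n * (m ^ k * n ^ k)    ≡⟨ [m*n]*[o*p]≡[m*o]*[n*p] m n (m ^ k) (n ^ k) ⟩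
  m * m ^ k * (n * n ^ k)    ∎
  where open ≡-Reasoning

^-cancelˡ-≤ : ∀ k .{{_ : NonZero k}} {m n} → m ^ k ≤ n ^ k → m ≤ n
^-cancelˡ-≤ k {m} {n} mᵏ≤nᵏ with m ≤? n
... | yes m≤n = m≤n
... | no m≰n  = contradiction (^-monoˡ-< k (≰⇒> m≰n)) (≤⇒≯ mᵏ≤nᵏ)

^-swap : ∀ m j k → (m ^ j) ^ k ≡ (m ^ k) ^ j
^-swap m j k = trans (^-*-assoc m j k) (trans (cong (m ^_) (*-comm j k)) (sym (^-*-assoc m k j)))

k<m^k : ∀ {m} → 1 < m → ∀ k → k < m ^ k
k<m^k {m} 1<m zero    = z<s
k<m^k {m} 1<m (suc k) = begin
  2 + k          ≤⟨ +-mono-≤ (m^n>0 m k) (k<m^k 1<m k) ⟩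
  m ^ k + m ^ k  ≡⟨ cong (_+_ (m ^ k)) (+-identityʳ (m ^ k)) ⟨
  2 * m ^ k      ≤⟨ *-monoˡ-≤ (m ^ k) 1<m ⟩
  m * m ^ k      ∎
  where
  open ≤-Reasoning
  instance _ = >-nonZero (<-trans z<s 1<m)

-- With q = n / k one has n ≤ k(q + 1) ≤ k · 2^q. This replaces a logarithm: 2^ℓ ≤ c³ will give ℓ ≤
-- K · c^(3/K).
n^k≤k^k*2^n : ∀ k .{{_ : NonZero k}} n → n ^ k ≤ k ^ k * 2 ^ n
n^k≤k^k*2^n k n = begin
  n ^ k                    ≤⟨ ^-monoˡ-≤ k n≤k*2^q ⟩
  (k * 2 ^ (n / k)) ^ k    ≡⟨ *-^-distrib k (2 ^ (n / k)) k ⟩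
  k ^ k * (2 ^ (n / k)) ^ k ≡⟨ cong (k ^ k *_) (^-*-assoc 2 (n / k) k) ⟩
  k ^ k * 2 ^ (n / k * k)  ≤⟨ *-monoʳ-≤ (k ^ k) (^-monoʳ-≤ 2 q*k≤n) ⟩
  k ^ k * 2 ^ n            ∎
  where
  open ≤-Reasoning
  n≡ : n ≡ n % k + n / k * k
  n≡ = m≡m%n+[m/n]*n n k
  q*k≤n : n / k * k ≤ n
  q*k≤n = subst (n / k * k ≤_) (sym n≡) (m≤n+m _ (n % k))
  n≤k*2^q : n ≤ k * 2 ^ (n / k)
  n≤k*2^q = begin
    n                    ≡⟨ n≡ ⟩
    n % k + n / k * k    ≤⟨ +-monoˡ-≤ _ (<⇒≤ (m%n<n n k)) ⟩
    suc (n / k) * k      ≡⟨ *-comm (suc (n / k)) k ⟩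
    k * suc (n / k)      ≤⟨ *-monoʳ-≤ k (k<m^k ≤-refl (n / k)) ⟩
    k * 2 ^ (n / k)      ∎

integerRoot : ∀ k .{{_ : NonZero k}} N → 0 < N → ∃[ t ] t ^ k < N × N ≤ suc t ^ k
integerRoot k N 0<N = search N N≤N^k
  where
  0^k≡0 : ∀ k .{{_ : NonZero k}} → 0 ^ k ≡ 0
  0^k≡0 (suc _) = refl
  N≤N^k : N ≤ N ^ k
  N≤N^k = subst (_≤ N ^ k) (*-identityʳ N)
    (^-monoʳ-≤ N {{>-nonZero 0<N}} (>-nonZero⁻¹ k))
  search : ∀ n → N ≤ n ^ k → ∃[ t ] t ^ k < N × N ≤ suc t ^ k
  search zero    N≤0 = contradiction (subst (N ≤_) (0^k≡0 k) N≤0) (<⇒≱ 0<N)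
  search (suc n) N≤  with N ≤? n ^ k
  ... | yes N≤n^k = search n N≤n^k
  ... | no N≰n^k  = n , ≰⇒> N≰n^k , N≤

-- The power computation behind the counting condition: a bound on every
-- factor of Y and t in powers of c, compared in the exponent 4αβK.
powerComparison : ∀ {α β K C c ℓ r t Y Q} .{{_ : NonZero c}} .{{_ : NonZero C}} →
  β < α → α < 2 * β → 24 * α * β < K → (4 * K * C) ^ (4 * α * β * K) ≤ c →
  ℓ ^ K ≤ K ^ K * c ^ 3 → c ^ β ≤ r ^ α → r ^ 2 ≤ (Y * C * Q) ^ 2 * c → Q ^ K ≤ c ^ 3 →
  c ^ (2 * β + α) ≤ t ^ (4 * β) →
  4 * c * ℓ ≤ t * Y
powerComparison {α} {β} {K} {C} {c} {ℓ} {r} {t} {Y} {Q} β<α α<2β 24αβ<K large ℓ≤ c≤r r≤ Q≤ c≤t =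
  ^-cancelˡ-≤ N {{>-nonZero 0<N}} (*-cancelʳ-≤ _ _ Z {{>-nonZero 0<Z}} (begin
    (4 * c * ℓ) ^ N * Z
      ≡⟨ cong (_* Z) (trans (*-^-distrib (4 * c) ℓ N) (cong (_* ℓ ^ N) (*-^-distrib 4 c N))) ⟩
    4 ^ N * c ^ N * ℓ ^ N * Z
      ≤⟨ *-monoˡ-≤ Z (*-monoʳ-≤ (4 ^ N * c ^ N) ℓ^N≤) ⟩
    4 ^ N * c ^ N * (K ^ N * c ^ (12 * α * β)) * (C ^ N * c ^ (12 * α * β + 2 * α * β * K))
      ≡⟨ solve 6 (λ x y z u w s → x :* y :* (z :* u) :* (w :* s) := (x :* z :* w) :* (y :* (u :* s))) refl
           (4 ^ N) (c ^ N) (K ^ N) (c ^ (12 * α * β)) (C ^ N) (c ^ (12 * α * β + 2 * α * β * K)) ⟩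
    4 ^ N * K ^ N * C ^ N * (c ^ N * (c ^ (12 * α * β) * c ^ (12 * α * β + 2 * α * β * K)))
      ≡⟨ cong₂ _*_
           (sym (trans (*-^-distrib (4 * K) C N) (cong (_* C ^ N) (*-^-distrib 4 K N))))
           (sym (trans (^-distribˡ-+-* c N _) (cong (c ^ N *_) (^-distribˡ-+-* c (12 * α * β) _)))) ⟩
    (4 * K * C) ^ N * c ^ (N + (12 * α * β + (12 * α * β + 2 * α * β * K)))
      ≤⟨ *-monoˡ-≤ _ large ⟩
    c ^ suc (N + (12 * α * β + (12 * α * β + 2 * α * β * K)))
      ≤⟨ ^-monoʳ-≤ c exponents ⟩
    c ^ (β * (4 * β * K) + (2 * β + α) * (α * K))
      ≡⟨ ^-distribˡ-+-* c (β * (4 * β * K)) _ ⟩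
    c ^ (β * (4 * β * K)) * c ^ ((2 * β + α) * (α * K))
      ≤⟨ *-mono-≤ rad-bound root-bound ⟩
    Y ^ N * Z * t ^ N
      ≡⟨ solve 3 (λ y z x → y :* z :* x := x :* y :* z) refl (Y ^ N) Z (t ^ N) ⟩
    t ^ N * Y ^ N * Z
      ≡⟨ cong (_* Z) (*-^-distrib t Y N) ⟨
    (t * Y) ^ N * Z ∎))
  where
  open ≤-Reasoning
  open ℕ-Solver.+-*-Solver
  -- `N` clears the denominators K, α, 4β and 2 of all exponents involved. `Z` collects the N-th
  -- powers of what separates `Y` from `r`: the constant `C`, the factor `Q` ≤ c^(3/K), and √c,
  -- whose N-th power is c^`M`.
  N = 4 * α * β * K
  M = 2 * α * β * K
  Z = C ^ N * c ^ (12 * α * β + M)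
  0<β : 0 < β
  0<β = n≢0⇒n>0 λ { refl → n≮0 α<2β }
  0<α : 0 < α
  0<α = <-trans 0<β β<α
  0<K : 0 < K
  0<K = ≤-<-trans z≤n 24αβ<K
  0<N : 0 < N
  0<N = *-mono-< (*-mono-< (*-mono-< (z<s {3}) 0<α) 0<β) 0<K
  0<Z : 0 < Z
  0<Z = *-mono-< (m^n>0 C N) (m^n>0 c (12 * α * β + M))
  ^-eq : ∀ x {i j} → i ≡ j → x ^ i ≡ x ^ j
  ^-eq x = cong (x ^_)
  K^N : ∀ x → x ^ N ≡ (x ^ K) ^ (4 * α * β)
  K^N x = trans (^-eq x (*-comm (4 * α * β) K)) (sym (^-*-assoc x K (4 * α * β)))
  c³ : (c ^ 3) ^ (4 * α * β) ≡ c ^ (12 * α * β)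
  c³ = trans (^-*-assoc c 3 (4 * α * β)) (^-eq c
    (solve 2 (λ a b → con 3 :* (con 4 :* a :* b) := con 12 :* a :* b) refl α β))
  ℓ^N≤ : ℓ ^ N ≤ K ^ N * c ^ (12 * α * β)
  ℓ^N≤ = begin
    ℓ ^ N                                       ≡⟨ K^N ℓ ⟩
    (ℓ ^ K) ^ (4 * α * β)                       ≤⟨ ^-monoˡ-≤ (4 * α * β) ℓ≤ ⟩
    (K ^ K * c ^ 3) ^ (4 * α * β)               ≡⟨ *-^-distrib (K ^ K) (c ^ 3) (4 * α * β) ⟩
    (K ^ K) ^ (4 * α * β) * (c ^ 3) ^ (4 * α * β) ≡⟨ cong₂ _*_ (sym (K^N K)) c³ ⟩
    K ^ N * c ^ (12 * α * β)                    ∎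
  Q^N≤ : Q ^ N ≤ c ^ (12 * α * β)
  Q^N≤ = begin
    Q ^ N                    ≡⟨ K^N Q ⟩
    (Q ^ K) ^ (4 * α * β)    ≤⟨ ^-monoˡ-≤ (4 * α * β) Q≤ ⟩
    (c ^ 3) ^ (4 * α * β)    ≡⟨ c³ ⟩
    c ^ (12 * α * β)         ∎
  2*M≡N : 2 * M ≡ N
  2*M≡N = solve 3 (λ a b k → con 2 :* (con 2 :* a :* b :* k) := con 4 :* a :* b :* k) refl α β K
  rad-bound : c ^ (β * (4 * β * K)) ≤ Y ^ N * Z
  rad-bound = begin
    c ^ (β * (4 * β * K))      ≡⟨ ^-*-assoc c β (4 * β * K) ⟨
    (c ^ β) ^ (4 * β * K)      ≤⟨ ^-monoˡ-≤ (4 * β * K) c≤r ⟩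
    (r ^ α) ^ (4 * β * K)      ≡⟨ ^-*-assoc r α (4 * β * K) ⟩
    r ^ (α * (4 * β * K))      ≡⟨ ^-eq r (solve 3 (λ a b k →
                                    a :* (con 4 :* b :* k) := con 2 :* (con 2 :* a :* b :* k)) refl α β K) ⟩
    r ^ (2 * M)                ≡⟨ ^-*-assoc r 2 M ⟨
    (r ^ 2) ^ M                ≤⟨ ^-monoˡ-≤ M r≤ ⟩
    ((Y * C * Q) ^ 2 * c) ^ M  ≡⟨ *-^-distrib ((Y * C * Q) ^ 2) c M ⟩
    ((Y * C * Q) ^ 2) ^ M * c ^ M  ≡⟨ cong (_* c ^ M) (trans (^-*-assoc (Y * C * Q) 2 M) (^-eq _ 2*M≡N)) ⟩
    (Y * C * Q) ^ N * c ^ M    ≡⟨ cong (_* c ^ M) (trans (*-^-distrib (Y * C) Q N)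
                                    (cong (_* Q ^ N) (*-^-distrib Y C N))) ⟩
    Y ^ N * C ^ N * Q ^ N * c ^ M  ≤⟨ *-monoˡ-≤ (c ^ M) (*-monoʳ-≤ (Y ^ N * C ^ N) Q^N≤) ⟩
    Y ^ N * C ^ N * c ^ (12 * α * β) * c ^ M
      ≡⟨ solve 4 (λ y w u s → y :* w :* u :* s := y :* (w :* (u :* s))) refl (Y ^ N) (C ^ N) (c ^ (12 * α * β)) (c ^ M) ⟩
    Y ^ N * (C ^ N * (c ^ (12 * α * β) * c ^ M))
      ≡⟨ cong (λ e → Y ^ N * (C ^ N * e)) (^-distribˡ-+-* c (12 * α * β) M) ⟨
    Y ^ N * Z  ∎
  root-bound : c ^ ((2 * β + α) * (α * K)) ≤ t ^ N
  root-bound = begin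
    c ^ ((2 * β + α) * (α * K))  ≡⟨ ^-*-assoc c (2 * β + α) (α * K) ⟨
    (c ^ (2 * β + α)) ^ (α * K)  ≤⟨ ^-monoˡ-≤ (α * K) c≤t ⟩
    (t ^ (4 * β)) ^ (α * K)      ≡⟨ ^-*-assoc t (4 * β) (α * K) ⟩
    t ^ (4 * β * (α * K))        ≡⟨ ^-eq t (solve 3 (λ a b k →
                                      con 4 :* b :* (a :* k) := con 4 :* a :* b :* k) refl α β K) ⟩
    t ^ N                        ∎
  -- (2β − α)² ≥ 1
  square-gap : ∀ a b → a < b → 2 * a * b + 1 ≤ b * b + a * a
  square-gap a b a<b with k , refl ← m≤n⇒∃[o]m+o≡n a<b = begin
    2 * a * suc (a + k) + 1
      ≤⟨ m≤m+n _ (k * k + 2 * k) ⟩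
    2 * a * suc (a + k) + 1 + (k * k + 2 * k)
      ≡⟨ solve 2 (λ a k → con 2 :* a :* (con 1 :+ (a :+ k)) :+ con 1 :+ (k :* k :+ con 2 :* k)
           := (con 1 :+ (a :+ k)) :* (con 1 :+ (a :+ k)) :+ a :* a) refl a k ⟩
    suc (a + k) * suc (a + k) + a * a  ∎
  -- Divided by `N` this is 1/N + 1 + 6/K + 1/2 ≤ β/α + 1/2 + α/(4β). The slack β/α + α/(4β) - 1
  -- equals (2β - α)²/(4αβ) ≥ 1/(4αβ), so 24αβ < K covers 6/K and leaves at least one power of c,
  -- the one spent on (4KC)^N.
  exponents : suc (N + (12 * α * β + (12 * α * β + M))) ≤ β * (4 * β * K) + (2 * β + α) * (α * K)
  exponents = begin
    suc (N + (12 * α * β + (12 * α * β + M)))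
      ≡⟨ solve 3 (λ a b k → con 1 :+ (con 4 :* a :* b :* k :+ (con 12 :* a :* b :+ (con 12 :* a :* b :+ con 2 :* a :* b :* k)))
           := (con 1 :+ con 24 :* a :* b) :+ (con 2 :* a :* (con 2 :* b) :* k :+ con 2 :* a :* b :* k)) refl α β K ⟩
    suc (24 * α * β) + (2 * α * (2 * β) * K + M)
      ≤⟨ +-monoˡ-≤ _ 24αβ<K ⟩
    K + (2 * α * (2 * β) * K + M)
      ≡⟨ solve 3 (λ e k m → k :+ (e :* k :+ m) := (e :+ con 1) :* k :+ m) refl (2 * α * (2 * β)) K M ⟩
    (2 * α * (2 * β) + 1) * K + M
      ≤⟨ +-monoˡ-≤ M (*-monoˡ-≤ K (square-gap α (2 * β) α<2β)) ⟩
    (2 * β * (2 * β) + α * α) * K + M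
      ≡⟨ solve 3 (λ a b k → (con 2 :* b :* (con 2 :* b) :+ a :* a) :* k :+ con 2 :* a :* b :* k
           := b :* (con 4 :* b :* k) :+ (con 2 :* b :+ a) :* (a :* k)) refl α β K ⟩
    β * (4 * β * K) + (2 * β + α) * (α * K) ∎

-- Prime divisors and the coefficients of d

coprime-* : ∀ {m n o} → Coprime m n → Coprime m o → Coprime m (n * o)
coprime-* m⊥n m⊥o (d∣m , d∣no) =
  m⊥o (d∣m , coprime-divisor (λ (e∣d , e∣n) → m⊥n (∣-trans e∣d d∣m , e∣n)) d∣no)

coprime-^ : ∀ {m n} k → Coprime m n → Coprime m (n ^ k)
coprime-^ zero    m⊥n (_ , d∣1) = ∣1⇒≡1 d∣1
coprime-^ (suc k) m⊥n = coprime-* m⊥n (coprime-^ k m⊥n)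

primes-coprime : ∀ {p q} → Prime p → Prime q → p ≢ q → Coprime p q
primes-coprime pp pq p≢q (d∣p , d∣q) with prime⇒irreducible pp d∣p | prime⇒irreducible pq d∣q
... | inj₁ d≡1 | _        = d≡1
... | inj₂ _   | inj₁ d≡1 = d≡1
... | inj₂ d≡p | inj₂ d≡q = contradiction (trans (sym d≡p) d≡q) p≢q

coprime⇒*∣ : ∀ {m n k} → Coprime m n → m ∣ k → n ∣ k → m * n ∣ k
coprime⇒*∣ {m} {n} m⊥n (divides-refl q) n∣qm =
  subst (_∣ q * m) (*-comm n m)
    (*-monoˡ-∣ m (coprime-divisor (Coprimality.sym m⊥n) (subst (n ∣_) (*-comm q m) n∣qm)))

product-primePowers-∣ : ∀ (e : ℕ → ℕ) {ps N} → Unique ps → All Prime ps →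
  All (λ p → p ^ e p ∣ N) ps → product (map (λ p → p ^ e p) ps) ∣ N
product-primePowers-∣ e []        []        []        = 1∣ _
product-primePowers-∣ e (p∉ ∷ u) (pp ∷ pps) (p∣ ∷ ps∣) =
  coprime⇒*∣ (powers-coprime pp p∉ pps) p∣ (product-primePowers-∣ e u pps ps∣)
  where
  powers-coprime : ∀ {p ps} → Prime p → All (p ≢_) ps → All Prime ps →
                   Coprime (p ^ e p) (product (map (λ q → q ^ e q) ps))
  powers-coprime pp []        []         = ∣1⇒≡1 ∘ proj₂
  powers-coprime {p} {q ∷ _} pp (p≢q ∷ p∉) (pq ∷ pps) = coprime-*
    (coprime-^ (e q) (Coprimality.sym (coprime-^ (e p) (primes-coprime pq pp (p≢q ∘ sym)))))
    (powers-coprime pp p∉ pps)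

product-primes-∣ : ∀ {ps N} → Unique ps → All Prime ps → All (_∣ N) ps → product ps ∣ N
product-primes-∣ {ps} {N} u pps ps∣ = subst (λ qs → product qs ∣ N) (map-^1 ps)
  (product-primePowers-∣ (λ _ → 1) u pps (All.map (λ {p} → subst (_∣ N) (sym (^-identityʳ p))) ps∣))
  where
  map-^1 : ∀ ps → map (_^ 1) ps ≡ ps
  map-^1 []       = refl
  map-^1 (p ∷ ps) = cong₂ _∷_ (^-identityʳ p) (map-^1 ps)

-- The exponent v (p , _) n depends only on the number p.
opaque
  val : ℕ → ℕ → ℕ
  val p n = max 0 (filter (λ k → p ^ k ∣? n) (upTo n))

opaque
  unfolding val

  p^val∣ : ∀ p n → p ^ val p n ∣ n
  p^val∣ p n with argmax-sel id 0 (filter (λ k → p ^ k ∣? n) (upTo n))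
  -- The default value 0 of `max` is itself a valid exponent, so an empty filter does no harm.
  ... | inj₁ ≡0 = subst (λ k → p ^ k ∣ n) (sym ≡0) (1∣ n)
  ... | inj₂ ∈  = proj₂ (∈-filter⁻ (λ k → p ^ k ∣? n) {xs = upTo n} ∈)

prime⇒1< : ∀ {p} → Prime p → 1 < p
prime⇒1< pp = nonTrivial⇒n>1 _ {{prime⇒nonTrivial pp}}

opaque
  unfolding val

  ^∣⇒≤val : ∀ {p n} .{{_ : NonZero n}} → Prime p → ∀ k → p ^ k ∣ n → k ≤ val p n
  ^∣⇒≤val {p} {n} pp k pᵏ∣n = All.lookup (xs≤max 0 _)
    (∈-filter⁺ (λ k → p ^ k ∣? n) (∈-upTo⁺ (<-≤-trans (k<m^k (prime⇒1< pp) k) (∣⇒≤ pᵏ∣n))) pᵏ∣n)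

∣⇒0<val : ∀ {p n} .{{_ : NonZero n}} → Prime p → p ∣ n → 0 < val p n
∣⇒0<val {p} {n} pp p∣n = ^∣⇒≤val pp 1 (subst (_∣ n) (sym (^-identityʳ p)) p∣n)

∤⇒val≡0 : ∀ {p n} → p ∤ n → val p n ≡ 0
∤⇒val≡0 {p} {n} p∤n with val p n | p^val∣ p n
... | zero  | _  = refl
... | suc k | p∣ = contradiction (∣-trans (m∣m*n (p ^ k)) p∣) p∤n

p^suc[val]∤ : ∀ {p n} .{{_ : NonZero n}} → Prime p → p ^ suc (val p n) ∤ n
p^suc[val]∤ pp p∣ = <-irrefl refl (^∣⇒≤val pp _ p∣)

primes : ℕ → List ℕ
primes n = map proj₁ (primeDivisors n)

private
  primeDivides? : ∀ n p → Dec (Prime p × p ∣ n)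
  primeDivides? n p = prime? p ×-dec (p ∣? n)

-- Forgetting the primality proofs turns `mapMaybe` into a plain filter, so membership and
-- uniqueness are inherited from `upTo`.
primes-filter : ∀ n → primes n ≡ filter (primeDivides? n) (upTo (suc n))
primes-filter n = go (upTo (suc n))
  where
  go : ∀ ks → map proj₁ (mapMaybe (primeDivisor? n) ks) ≡ filter (primeDivides? n) ks
  go []       = refl
  go (k ∷ ks) with prime? k | k ∣? n
  ... | yes _ | yes _ = cong (k ∷_) (go ks)
  ... | yes _ | no _  = go ks
  ... | no _  | yes _ = go ks
  ... | no _  | no _  = go ks

primes-unique : ∀ n → Unique (primes n)
primes-unique n = subst Unique (sym (primes-filter n))
  (unique-filter⁺ (primeDivides? n) (upTo⁺ (suc n)))

∈-primes⁻ : ∀ {p} n → p ∈ primes n → Prime p × p ∣ n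
∈-primes⁻ {p} n p∈ = proj₂ (∈-filter⁻ (primeDivides? n) {v = p} {xs = upTo (suc n)}
  (subst (_∈_ p) (primes-filter n) p∈))

∈-primes⁺ : ∀ {p n} .{{_ : NonZero n}} → Prime p → p ∣ n → p ∈ primes n
∈-primes⁺ {p} {n} pp p∣n = subst (_∈_ p) (sym (primes-filter n))
  (∈-filter⁺ (primeDivides? n) (∈-upTo⁺ (s≤s (∣⇒≤ p∣n))) (pp , p∣n))

coeff-∉ : ∀ (f : ℙ → ℤ) {q} ps → q ∉ map proj₁ ps → coeff q (map (λ p → p , f p) ps) ≡ 0ℤ
coeff-∉ f     []       q∉ = refl
coeff-∉ f {q} ((p , _) ∷ ps) q∉ with q ≟ p
... | yes q≡p = contradiction (here q≡p) q∉
... | no _    = coeff-∉ f ps (q∉ ∘ there)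

-- The primality proof is existential because it is the one stored in the list. For `d-coeff` the
-- choice is immaterial, as its value depends only on the number.
coeff-∈ : ∀ (f : ℙ → ℤ) {q} ps → Unique (map proj₁ ps) → q ∈ map proj₁ ps →
  ∃[ q-prime ] coeff q (map (λ p → p , f p) ps) ≡ f (q , q-prime)
coeff-∈ f {q} ((p , pp) ∷ ps) (p∉ ∷ u) q∈ with q ≟ p | q∈
... | yes refl | _         = pp , trans
  (cong (ℤ._+_ (f (p , pp))) (coeff-∉ f ps (λ p∈ → All.lookup p∉ p∈ refl))) (ℤ.+-identityʳ _)
... | no q≢p   | here q≡p  = contradiction q≡p q≢p
... | no _     | there q∈′ = coeff-∈ f ps u q∈′

opaque
  unfolding val

  -- The factor p undoes the exact division in `d-coeff`. In this form the identity also covers the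
  -- primes not dividing n, where both sides vanish.
  coeff-d : ∀ {p} n .{{_ : NonZero n}} → Prime p → + p ℤ.* coeff p (d (+ n)) ≡ + (n * val p n)
  coeff-d {p} n pp with p ∣? n
  ... | no p∤n = begin
    + p ℤ.* coeff p (d (+ n))    ≡⟨ cong (+ p ℤ.*_) (coeff-∉ (d-coeff (+ n)) (primeDivisors n) (p∤n ∘ proj₂ ∘ ∈-primes⁻ n)) ⟩
    + p ℤ.* 0ℤ                   ≡⟨ ℤ.*-zeroʳ (+ p) ⟩
    0ℤ                           ≡⟨ cong +_ (trans (cong (n *_) (∤⇒val≡0 p∤n)) (*-zeroʳ n)) ⟨
    + (n * val p n)              ∎
    where open ≡-Reasoning
  ... | yes p∣n with qp , eq ← coeff-∈ (d-coeff (+ n)) (primeDivisors n) (primes-unique n) (∈-primes⁺ pp p∣n) = begin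
    + p ℤ.* coeff p (d (+ n))    ≡⟨ cong (+ p ℤ.*_) eq ⟩
    + p ℤ.* d-coeff (+ n) (p , qp)  ≡⟨ cong (λ z → + p ℤ.* (_/ℕ_ z p {{prime⇒nonZero pp}})) (ℤ.pos-* n (val p n)) ⟨
    + p ℤ.* + (n * val p n / p)  ≡⟨ ℤ.*-comm (+ p) (+ (n * val p n / p)) ⟩
    + (n * val p n / p) ℤ.* + p  ≡⟨ ℤ.pos-* (n * val p n / p) p ⟨
    + (n * val p n / p * p)      ≡⟨ cong +_ (m/n*n≡m (∣-trans p∣n (m∣m*n (val p n)))) ⟩
    + (n * val p n)              ∎
    where
    open ≡-Reasoning
    instance
      p-nonZero : NonZero p
      p-nonZero = prime⇒nonZero pp

-- Functionals with prescribed coordinates, and Siegel's lemma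

∑[_] : List ℕ → (ℕ → ℤ) → ℤ
∑[ []     ] f = 0ℤ
∑[ k ∷ ks ] f = f k ℤ.+ ∑[ ks ] f

Σ-cong : ∀ ks {f g} → (∀ k → k ∈ ks → f k ≡ g k) → ∑[ ks ] f ≡ ∑[ ks ] g
Σ-cong []       f≡g = refl
Σ-cong (k ∷ ks) f≡g = cong₂ ℤ._+_ (f≡g k (here refl)) (Σ-cong ks (λ j → f≡g j ∘ there))

Σ-zero : ∀ ks {f} → (∀ k → k ∈ ks → f k ≡ 0ℤ) → ∑[ ks ] f ≡ 0ℤ
Σ-zero []       f≡0 = refl
Σ-zero (k ∷ ks) f≡0 = cong₂ ℤ._+_ (f≡0 k (here refl)) (Σ-zero ks (λ j → f≡0 j ∘ there))

Σ-distrib-+ : ∀ ks f g → ∑[ ks ] (λ k → f k ℤ.+ g k) ≡ ∑[ ks ] f ℤ.+ ∑[ ks ] g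
Σ-distrib-+ []       f g = refl
Σ-distrib-+ (k ∷ ks) f g = trans (cong (ℤ._+_ (f k ℤ.+ g k)) (Σ-distrib-+ ks f g))
  (solve 4 (λ a b c d → a :+ b :+ (c :+ d) := a :+ c :+ (b :+ d)) refl (f k) (g k) _ _)
  where open ℤ-Solver.+-*-Solver

Σ-distrib-* : ∀ ks i f → ∑[ ks ] (λ k → i ℤ.* f k) ≡ i ℤ.* ∑[ ks ] f
Σ-distrib-* []       i f = sym (ℤ.*-zeroʳ i)
Σ-distrib-* (k ∷ ks) i f =
  trans (cong (ℤ._+_ (i ℤ.* f k)) (Σ-distrib-* ks i f)) (sym (ℤ.*-distribˡ-+ i (f k) _))

Σ-single : ∀ {ks k} f → Unique ks → k ∈ ks → (∀ j → j ∈ ks → j ≢ k → f j ≡ 0ℤ) → ∑[ ks ] f ≡ f k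
Σ-single {k ∷ ks} f (k∉ ∷ u) (here refl) f≡0 =
  trans (cong (ℤ._+_ (f k)) (Σ-zero ks (λ j j∈ → f≡0 j (there j∈) (All.lookup k∉ j∈ ∘ sym))))
        (ℤ.+-identityʳ (f k))
Σ-single {j ∷ ks} f (j∉ ∷ u) (there k∈) f≡0 =
  trans (cong₂ ℤ._+_ (f≡0 j (here refl) (All.lookup j∉ k∈)) (Σ-single f u k∈ (λ i → f≡0 i ∘ there)))
        (ℤ.+-identityˡ (f _))

∣Σ : ∀ {i} ks {f} → (∀ k → k ∈ ks → i ℤ.∣ f k) → i ℤ.∣ ∑[ ks ] f
∣Σ []       i∣ = ℤ.divides 0ℤ refl
∣Σ (k ∷ ks) i∣ = ℤ.∣m∣n⇒∣m+n (i∣ k (here refl)) (∣Σ ks (λ j → i∣ j ∘ there))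

∣Σ⇒∣term : ∀ {i ks k} f → Unique ks → k ∈ ks → (∀ j → j ∈ ks → j ≢ k → i ℤ.∣ f j) →
  i ℤ.∣ ∑[ ks ] f → i ℤ.∣ f k
∣Σ⇒∣term {ks = k ∷ ks} f (k∉ ∷ u) (here refl) i∣ i∣Σ =
  ℤ.∣m+n∣n⇒∣m i∣Σ (∣Σ ks (λ j j∈ → i∣ j (there j∈) (All.lookup k∉ j∈ ∘ sym)))
∣Σ⇒∣term {ks = j ∷ ks} f (j∉ ∷ u) (there k∈) i∣ i∣Σ =
  ∣Σ⇒∣term f u k∈ (λ i → i∣ i ∘ there) (ℤ.∣m+n∣m⇒∣n i∣Σ (i∣ j (here refl) (All.lookup j∉ k∈)))

functional : List ℕ → (ℕ → ℤ) → Ω → ℤ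
functional ks x ω = ∑[ ks ] (λ k → x k ℤ.* coeff k ω)

coeff-ξ-≡ : ∀ p → coeff (proj₁ p) (ξ p) ≡ 1ℤ
coeff-ξ-≡ (p , _) with p ≟ p
... | yes _  = refl
... | no p≢p = contradiction refl p≢p

coeff-ξ-≢ : ∀ {q} p → q ≢ proj₁ p → coeff q (ξ p) ≡ 0ℤ
coeff-ξ-≢ {q} (p , _) q≢p with q ≟ p
... | yes q≡p = contradiction q≡p q≢p
... | no _    = refl

functional-ξ-∈ : ∀ {ks} x p → Unique ks → proj₁ p ∈ ks → functional ks x (ξ p) ≡ x (proj₁ p)
functional-ξ-∈ {ks} x p u p∈ = begin
  functional ks x (ξ p)                   ≡⟨ Σ-single _ u p∈ (λ j _ j≢p →
                                              trans (cong (x j ℤ.*_) (coeff-ξ-≢ p j≢p)) (ℤ.*-zeroʳ (x j))) ⟩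
  x (proj₁ p) ℤ.* coeff (proj₁ p) (ξ p)  ≡⟨ cong (x (proj₁ p) ℤ.*_) (coeff-ξ-≡ p) ⟩
  x (proj₁ p) ℤ.* 1ℤ                     ≡⟨ ℤ.*-identityʳ _ ⟩
  x (proj₁ p)                            ∎
  where open ≡-Reasoning

functional-ξ-∉ : ∀ {ks} x p → proj₁ p ∉ ks → functional ks x (ξ p) ≡ 0ℤ
functional-ξ-∉ {ks} x p p∉ = Σ-zero ks λ k k∈ →
  trans (cong (x k ℤ.*_) (coeff-ξ-≢ p (λ k≡p → p∉ (subst (_∈ ks) k≡p k∈)))) (ℤ.*-zeroʳ (x k))

maximum : List ℕ → (ℕ → ℤ) → ℕ
maximum ks x = foldr (λ k s → ℤ.∣ x k ∣ ⊔ s) 0 ks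

≤maximum : ∀ {ks k} x → k ∈ ks → ℤ.∣ x k ∣ ≤ maximum ks x
≤maximum x (here refl) = m≤m⊔n _ _
≤maximum x (there k∈)  = ≤-trans (≤maximum x k∈) (m≤n⊔m _ _)

maximum≤ : ∀ {ks t} x → (∀ k → k ∈ ks → ℤ.∣ x k ∣ ≤ t) → maximum ks x ≤ t
maximum≤ {[]}     x ≤t = z≤n
maximum≤ {k ∷ ks} x ≤t = ⊔-lub (≤t k (here refl)) (maximum≤ x (λ j → ≤t j ∘ there))

functional-≤maximum : ∀ {ks} x → Unique ks → ∀ p → ℤ.∣ functional ks x (ξ p) ∣ ≤ maximum ks x
functional-≤maximum {ks} x u p with proj₁ p ∈? ks
... | yes p∈ = ≤-trans (≤-reflexive (cong ℤ.∣_∣ (functional-ξ-∈ x p u p∈))) (≤maximum x p∈)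
... | no p∉  = ≤-trans (≤-reflexive (cong ℤ.∣_∣ (functional-ξ-∉ x p p∉))) z≤n

functional-cong : ∀ {ks} x {ω ω′} → ω ≈Ω ω′ → functional ks x ω ≡ functional ks x ω′
functional-cong {ks} x ω≈ω′ = Σ-cong ks λ k _ → cong (x k ℤ.*_) (_≈Ω_.same ω≈ω′ k)

functional-+ : ∀ {ks} x ω ω′ →
  functional ks x (ω ++ ω′) ≡ functional ks x ω ℤ.+ functional ks x ω′
functional-+ {ks} x ω ω′ = trans
  (Σ-cong ks λ k _ → trans (cong (x k ℤ.*_) (coeff-++ k ω ω′)) (ℤ.*-distribˡ-+ (x k) _ _))
  (Σ-distrib-+ ks _ _)

functional-* : ∀ {ks} x i ω → functional ks x (i · ω) ≡ i ℤ.* functional ks x ω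
functional-* {ks} x i ω = trans
  (Σ-cong ks λ k _ → trans (cong (x k ℤ.*_) (coeff-· k i ω))
    (solve 3 (λ x i c → x :* (i :* c) := i :* (x :* c)) refl (x k) i (coeff k ω)))
  (Σ-distrib-* ks i _)
  where open ℤ-Solver.+-*-Solver

fromCoordinates : ∀ ks → Unique ks → (ℕ → ℤ) → 𝒯
fromCoordinates ks u x = record
  { ⟦_⟧      = functional ks x
  ; isLinear = record
    { +ᴹ-isGroupHomomorphism = record
      { isMonoidHomomorphism = record
        { isMagmaHomomorphism = record
          { isRelHomomorphism = record { cong = functional-cong {ks} x }
          ; homo              = functional-+ {ks} x
          }
        ; ε-homo = Σ-zero ks (λ k _ → ℤ.*-zeroʳ (x k))
        }
      ; ⁻¹-homo = λ ω → trans (functional-* {ks} x ℤ.-1ℤ ω) (ℤ.-1*i≡-i _)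
      }
    ; *ₗ-homo = functional-* {ks} x
    }
  ; bounded  = maximum ks x , functional-≤maximum x u
  }

-- A coordinate is a value at some generator only if its index is prime; this is what makes the
-- maximum attained, hence the least bound.
‖fromCoordinates‖ : ∀ {ks} u (primes : ∀ k → k ∈ ks → ∃[ p ] proj₁ p ≡ k) x →
  ‖ fromCoordinates ks u x ‖≡ maximum ks x
‖fromCoordinates‖ u primes x = record
  { upperBound = functional-≤maximum x u
  ; least      = λ t ≤t → maximum≤ x λ k k∈ → attained t ≤t k k∈ (primes k k∈)
  }
  where
  attained : ∀ t → _ → ∀ k → _ → ∃[ p ] proj₁ p ≡ k → ℤ.∣ x k ∣ ≤ t
  attained t ≤t k k∈ (p , refl) = subst (_≤ t) (cong ℤ.∣_∣ (functional-ξ-∈ x p u k∈)) (≤t p)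

-- Mixed-radix digits: the numbers below ∏ X k enumerate the points of the box ∏ [0 , X k), extended
-- by 0 outside `ks`.
vectors : (X : ℕ → ℕ) (ks : List ℕ) → Fin (product (map X ks)) → ℕ → ℕ
vectors X []       i q = 0
vectors X (k ∷ ks) i q with q ≟ k
... | yes _ = toℕ (proj₁ (remQuot {X k} (product (map X ks)) i))
... | no _  = vectors X ks (proj₂ (remQuot {X k} (product (map X ks)) i)) q

vectors-head : ∀ X k ks i → vectors X (k ∷ ks) i k ≡ toℕ (proj₁ (remQuot {X k} (product (map X ks)) i))
vectors-head X k ks i with k ≟ k
... | yes _  = refl
... | no k≢k = contradiction refl k≢k

vectors-tail : ∀ X k ks i {q} → q ≢ k →
  vectors X (k ∷ ks) i q ≡ vectors X ks (proj₂ (remQuot {X k} (product (map X ks)) i)) q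
vectors-tail X k ks i {q} q≢k with q ≟ k
... | yes q≡k = contradiction q≡k q≢k
... | no _    = refl

vectors-< : ∀ X ks i {q} → q ∈ ks → vectors X ks i q < X q
vectors-< X (k ∷ ks) i {q} q∈ with q ≟ k | q∈
... | yes refl | _         = Fin.toℕ<n (proj₁ (remQuot {X k} (product (map X ks)) i))
... | no q≢k   | here q≡k  = contradiction q≡k q≢k
... | no _     | there q∈′ = vectors-< X ks (proj₂ (remQuot {X k} (product (map X ks)) i)) q∈′

vectors-injective : ∀ X {ks} → Unique ks → ∀ {i j} →
  (∀ q → q ∈ ks → vectors X ks i q ≡ vectors X ks j q) → i ≡ j
vectors-injective X {[]} [] {Fin.zero} {Fin.zero} same = refl
vectors-injective X {k ∷ ks} (k∉ ∷ u) {i} {j} same = begin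
  i                            ≡⟨ Fin.combine-remQuot {X k} P i ⟨
  combine (proj₁ i′) (proj₂ i′) ≡⟨ cong₂ combine
      (Fin.toℕ-injective (trans (sym (vectors-head X k ks i)) (trans (same k (here refl)) (vectors-head X k ks j))))
      (vectors-injective X u λ q q∈ → let q≢k = All.lookup k∉ q∈ ∘ sym in
        trans (sym (vectors-tail X k ks i q≢k)) (trans (same q (there q∈)) (vectors-tail X k ks j q≢k))) ⟩
  combine (proj₁ j′) (proj₂ j′) ≡⟨ Fin.combine-remQuot {X k} P j ⟩
  j                            ∎
  where
  open ≡-Reasoning
  P = product (map X ks)
  i′ = remQuot {X k} P i
  j′ = remQuot {X k} P j

sum-map-≤ : ∀ ks {f g : ℕ → ℕ} → (∀ k → k ∈ ks → f k ≤ g k) → sum (map f ks) ≤ sum (map g ks)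
sum-map-≤ []       f≤g = z≤n
sum-map-≤ (k ∷ ks) f≤g = +-mono-≤ (f≤g k (here refl)) (sum-map-≤ ks (λ j → f≤g j ∘ there))

Σ-sum : ∀ ks f → ∑[ ks ] (λ k → + f k) ≡ + sum (map f ks)
Σ-sum []       f = refl
Σ-sum (k ∷ ks) f = cong (ℤ._+_ (+ f k)) (Σ-sum ks f)

-- The sign, except that 0 is sent to 1: multiplication by it never kills a coordinate, even one
-- whose coefficient is 0.
unit : ℤ → ℤ
unit (+ _)       = 1ℤ
unit (ℤ.-[1+ _ ]) = ℤ.-1ℤ

unit-* : ∀ i → unit i ℤ.* i ≡ + ℤ.∣ i ∣
unit-* (+ n)        = ℤ.*-identityˡ (+ n)
unit-* (ℤ.-[1+ n ]) = ℤ.-1*i≡-i ℤ.-[1+ n ]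

∣unit-*∣ : ∀ i j → ℤ.∣ unit i ℤ.* j ∣ ≡ ℤ.∣ j ∣
∣unit-*∣ (+ _)        j = cong ℤ.∣_∣ (ℤ.*-identityˡ j)
∣unit-*∣ (ℤ.-[1+ _ ]) j = trans (cong ℤ.∣_∣ (ℤ.-1*i≡-i j)) (ℤ.∣-i∣≡∣i∣ j)

-- Siegel's lemma for one equation, with a separate bound for every unknown.
siegel : ∀ (κ : ℕ → ℤ) (X : ℕ → ℕ) {ks} → Unique ks →
  suc (sum (map (λ k → ℤ.∣ κ k ∣ * (X k ∸ 1)) ks)) < product (map X ks) →
  ∃[ x ] (∃[ k ] k ∈ ks × x k ≢ 0ℤ)
       × (∀ k → k ∈ ks → ℤ.∣ x k ∣ < X k)
       × ∑[ ks ] (λ k → x k ℤ.* κ k) ≡ 0ℤ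
-- The points y of the box are sorted by ∑ ∣κ k∣ · y k. With absolute values no negative sums occur,
-- and since y k ≤ X k ∸ 1 there are at most `suc (sum …)` values, fewer than points.
siegel κ X {ks} u bound = conclude (Fin.pigeonhole bound λ i → fromℕ< (s≤s (value≤ i)))
  where
  term : Fin (product (map X ks)) → ℕ → ℕ
  term i k = ℤ.∣ κ k ∣ * vectors X ks i k
  value≤ : ∀ i → sum (map (term i) ks) ≤ sum (map (λ k → ℤ.∣ κ k ∣ * (X k ∸ 1)) ks)
  value≤ i = sum-map-≤ ks λ k k∈ → *-monoʳ-≤ ℤ.∣ κ k ∣ (<⇒≤pred (vectors-< X ks i k∈))
  conclude : ∃[ i ] ∃[ j ] (i Fin.< j × fromℕ< (s≤s (value≤ i)) ≡ fromℕ< (s≤s (value≤ j))) → _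
  conclude (i , j , i<j , same) = x , nonzero , small , solution
    where
    y : ℕ → ℤ
    y k = + vectors X ks i k ℤ.- + vectors X ks j k
    x : ℕ → ℤ
    -- The signs left out of the sorting return here; they change neither the size of a coordinate
    -- nor whether it vanishes.
    x k = unit (κ k) ℤ.* y k
    nonzero : ∃[ k ] k ∈ ks × x k ≢ 0ℤ
    nonzero with All.all? (λ k → vectors X ks i k ≟ vectors X ks j k) ks
    ... | yes all≡ = contradiction (vectors-injective X u λ _ → All.lookup all≡) (Fin.<⇒≢ i<j)
    ... | no ¬all with k , k∈ , k≢ ← find (¬All⇒Any¬ (λ k → vectors X ks i k ≟ vectors X ks j k) ks ¬all)
        = k , k∈ , λ xk≡0 → k≢ (ℤ.+-injective (ℤ.i-j≡0⇒i≡j _ _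
            (ℤ.∣i∣≡0⇒i≡0 (trans (sym (∣unit-*∣ (κ k) (y k))) (cong ℤ.∣_∣ xk≡0)))))
    small : ∀ k → k ∈ ks → ℤ.∣ x k ∣ < X k
    small k k∈ = begin-strict
      ℤ.∣ unit (κ k) ℤ.* y k ∣  ≡⟨ ∣unit-*∣ (κ k) (y k) ⟩
      ℤ.∣ y k ∣                 ≡⟨ cong ℤ.∣_∣ (ℤ.[+m]-[+n]≡m⊖n (vectors X ks i k) (vectors X ks j k)) ⟩
      ℤ.∣ vectors X ks i k ℤ.⊖ vectors X ks j k ∣
                                ≤⟨ ℤ.∣m⊝n∣≤m⊔n (vectors X ks i k) (vectors X ks j k) ⟩
      vectors X ks i k ⊔ vectors X ks j k
                                <⟨ ⊔-pres-<m (vectors-< X ks i k∈) (vectors-< X ks j k∈) ⟩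
      X k                       ∎
      where open ≤-Reasoning
    values≡ : sum (map (term i) ks) ≡ sum (map (term j) ks)
    values≡ = trans (sym (Fin.toℕ-fromℕ< (s≤s (value≤ i)))) (trans (cong toℕ same) (Fin.toℕ-fromℕ< (s≤s (value≤ j))))
    split : ∀ k → x k ℤ.* κ k ≡ + term i k ℤ.+ ℤ.-1ℤ ℤ.* + term j k
    split k = begin
      unit (κ k) ℤ.* y k ℤ.* κ k
        ≡⟨ solve 4 (λ s a b t → s :* (a :- b) :* t := (s :* t) :* a :+ con ℤ.-1ℤ :* ((s :* t) :* b)) refl
             (unit (κ k)) (+ vectors X ks i k) (+ vectors X ks j k) (κ k) ⟩
      unit (κ k) ℤ.* κ k ℤ.* + vectors X ks i k ℤ.+ ℤ.-1ℤ ℤ.* (unit (κ k) ℤ.* κ k ℤ.* + vectors X ks j k)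
        ≡⟨ cong₂ (λ a b → a ℤ.+ ℤ.-1ℤ ℤ.* b) (abs i) (abs j) ⟩
      + term i k ℤ.+ ℤ.-1ℤ ℤ.* + term j k ∎
      where
      open ≡-Reasoning
      open ℤ-Solver.+-*-Solver
      abs : ∀ i → unit (κ k) ℤ.* κ k ℤ.* + vectors X ks i k ≡ + term i k
      abs i = trans (cong (ℤ._* + vectors X ks i k) (unit-* (κ k))) (sym (ℤ.pos-* ℤ.∣ κ k ∣ _))
    solution : ∑[ ks ] (λ k → x k ℤ.* κ k) ≡ 0ℤ
    solution = begin
      ∑[ ks ] (λ k → x k ℤ.* κ k)
        ≡⟨ Σ-cong ks (λ k _ → split k) ⟩
      ∑[ ks ] (λ k → + term i k ℤ.+ ℤ.-1ℤ ℤ.* + term j k)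
        ≡⟨ Σ-distrib-+ ks _ _ ⟩
      ∑[ ks ] (λ k → + term i k) ℤ.+ ∑[ ks ] (λ k → ℤ.-1ℤ ℤ.* + term j k)
        ≡⟨ cong₂ ℤ._+_ (Σ-sum ks (term i)) (trans (Σ-distrib-* ks ℤ.-1ℤ _) (cong (ℤ.-1ℤ ℤ.*_) (Σ-sum ks (term j)))) ⟩
      + sum (map (term i) ks) ℤ.+ ℤ.-1ℤ ℤ.* + sum (map (term j) ks)
        ≡⟨ cong (λ s → + s ℤ.+ ℤ.-1ℤ ℤ.* + sum (map (term j) ks)) values≡ ⟩
      + sum (map (term j) ks) ℤ.+ ℤ.-1ℤ ℤ.* + sum (map (term j) ks)
        ≡⟨ solve 1 (λ s → s :+ con ℤ.-1ℤ :* s := con 0ℤ) refl (+ sum (map (term j) ks)) ⟩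
      0ℤ ∎
      where
      open ≡-Reasoning
      open ℤ-Solver.+-*-Solver

-- Independence

-- f p plays the role of the coefficient of ξ p in d n.
Partials : ℕ → (ℕ → ℤ) → Set
Partials n f = ∀ {p} → Prime p → p * ℤ.∣ f p ∣ ≡ n * val p n

partials-d : ∀ n .{{_ : NonZero n}} → Partials n (λ p → coeff p (d (+ n)))
partials-d n {p} pp = trans (sym (ℤ.abs-* (+ p) (coeff p (d (+ n))))) (cong ℤ.∣_∣ (coeff-d n pp))

partial-∤ : ∀ {p n f} → Partials n f → Prime p → p ∤ n → f p ≡ 0ℤ
partial-∤ {p} {n} {f} p*f pp p∤n =
  ℤ.∣i∣≡0⇒i≡0 (m*n≡0⇒m≡0 ℤ.∣ f p ∣ p {{prime⇒nonZero pp}} (begin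
    ℤ.∣ f p ∣ * p  ≡⟨ *-comm ℤ.∣ f p ∣ p ⟩
    p * ℤ.∣ f p ∣  ≡⟨ p*f pp ⟩
    n * val p n    ≡⟨ cong (n *_) (∤⇒val≡0 p∤n) ⟩
    n * 0          ≡⟨ *-zeroʳ n ⟩
    0              ∎))
  where open ≡-Reasoning

partial-∣ : ∀ {p n f} .{{_ : NonZero n}} → Partials n f → Prime p → p ∣ n → f p ≢ 0ℤ
partial-∣ {p} {n} p*f pp p∣n f≡0 = <⇒≢ (*-mono-< (>-nonZero⁻¹ n) (∣⇒0<val pp p∣n))
  (trans (sym (*-zeroʳ p)) (trans (cong (λ z → p * ℤ.∣ z ∣) (sym f≡0)) (p*f pp)))

-- Modulo p ^ (1 + v_p(n)) only the term at p survives in p · ψ(d n).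
small-coordinate≡0 : ∀ {ks p} n .{{_ : NonZero n}} (x f : ℕ → ℤ) → Partials n f → Unique ks → (∀ k → k ∈ ks → Prime k) →
  p ∈ ks → p ∣ n → val p n < p → ℤ.∣ x p ∣ < p →
  + n ℤ.∣ ∑[ ks ] (λ q → x q ℤ.* f q) → x p ≡ 0ℤ
small-coordinate≡0 {ks} {p} n x f p*f u ps p∈ p∣n k<p x<p n∣Dn = ℤ.∣i∣≡0⇒i≡0 (<p∧∣⇒≡0 x<p p∣x)
  where
  pp = ps p p∈
  k  = val p n
  instance
    _ = prime⇒nonZero pp
    _ = m^n≢0 p k
  n/pᵏ = quotient (p^val∣ p n)
  n≡ : n ≡ n/pᵏ * p ^ k
  n≡ = _∣_.equality (p^val∣ p n)
  <p∧∣⇒≡0 : ∀ {m} → m < p → p ∣ m → m ≡ 0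
  <p∧∣⇒≡0 {zero}  m<p p∣m = refl
  <p∧∣⇒≡0 {suc m} m<p p∣m = contradiction (∣⇒≤ p∣m) (<⇒≱ m<p)
  pᵏ∣coeff : ∀ j → j ∈ ks → j ≢ p → p ^ k ∣ ℤ.∣ f j ∣
  pᵏ∣coeff j j∈ j≢p = coprime-divisor
    (Coprimality.sym (coprime-^ k (primes-coprime (ps j j∈) pp j≢p)))
    (subst (p ^ k ∣_) (sym (p*f (ps j j∈))) (∣m⇒∣m*n (val j n) (p^val∣ p n)))
  pᵏ∣term : + (p ^ k) ℤ.∣ x p ℤ.* f p
  pᵏ∣term = ∣Σ⇒∣term (λ q → x q ℤ.* f q) u p∈
    (λ j j∈ j≢p → ℤ.∣n⇒∣m*n (x j) (∣ᵤ⇒∣ (pᵏ∣coeff j j∈ j≢p)))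
    (ℤ.∣-trans (∣ᵤ⇒∣ (p^val∣ p n)) n∣Dn)
  p*term : p * ℤ.∣ x p ℤ.* f p ∣ ≡ ℤ.∣ x p ∣ * (n/pᵏ * k) * p ^ k
  p*term = begin
    p * ℤ.∣ x p ℤ.* f p ∣           ≡⟨ cong (p *_) (ℤ.abs-* (x p) (f p)) ⟩
    p * (ℤ.∣ x p ∣ * ℤ.∣ f p ∣)      ≡⟨ solve 3 (λ p x c → p :* (x :* c) := x :* (p :* c)) refl p ℤ.∣ x p ∣ ℤ.∣ f p ∣ ⟩
    ℤ.∣ x p ∣ * (p * ℤ.∣ f p ∣)      ≡⟨ cong (ℤ.∣ x p ∣ *_) (p*f pp) ⟩
    ℤ.∣ x p ∣ * (n * k)                           ≡⟨ cong (λ m → ℤ.∣ x p ∣ * (m * k)) n≡ ⟩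
    ℤ.∣ x p ∣ * (n/pᵏ * p ^ k * k)                ≡⟨ solve 4 (λ x m q k → x :* (m :* q :* k) := x :* (m :* k) :* q) refl ℤ.∣ x p ∣ n/pᵏ (p ^ k) k ⟩
    ℤ.∣ x p ∣ * (n/pᵏ * k) * p ^ k                ∎
    where
    open ≡-Reasoning
    open ℕ-Solver.+-*-Solver
  -- Cancelling p^k leaves p as a divisor of ∣x p∣ · (n / p^k) · k. It does not divide n / p^k, as k
  -- is the full exponent, nor k, as 0 < k < p.
  p∣x*n*k : p ∣ ℤ.∣ x p ∣ * (n/pᵏ * k)
  p∣x*n*k = *-cancelʳ-∣ (p ^ k) (subst (p * p ^ k ∣_) p*term (*-monoʳ-∣ p (∣⇒∣ᵤ pᵏ∣term)))
  p∣x : p ∣ ℤ.∣ x p ∣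
  p∣x = [ id , [ p∤n/pᵏ , p∤k ]′ ∘ euclidsLemma n/pᵏ k pp ]′ (euclidsLemma ℤ.∣ x p ∣ (n/pᵏ * k) pp p∣x*n*k)
    where
    p∤n/pᵏ : p ∣ n/pᵏ → _
    p∤n/pᵏ p∣n/pᵏ = contradiction
      (subst (p * p ^ k ∣_) (sym n≡) (*-monoˡ-∣ (p ^ k) p∣n/pᵏ)) (p^suc[val]∤ pp)
    p∤k : p ∣ k → _
    p∤k p∣k = contradiction (<p∧∣⇒≡0 k<p p∣k) (>⇒≢ (∣⇒0<val pp p∣n))

-- Every other term vanishes through one of its factors, so the sum is `x p ℤ.* f p`, where `f p` is
-- non-zero because p ∣ n.
only-coordinate≡0 : ∀ {ks p} n .{{_ : NonZero n}} (x f : ℕ → ℤ) → Partials n f →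
  Unique ks → (∀ k → k ∈ ks → Prime k) →
  p ∈ ks → p ∣ n → (∀ j → j ∈ ks → j ≢ p → x j ≡ 0ℤ ⊎ j ∤ n) →
  ∑[ ks ] (λ q → x q ℤ.* f q) ≡ 0ℤ → x p ≡ 0ℤ
only-coordinate≡0 {ks} {p} n x f p*f u ps p∈ p∣n others Dn≡0 =
  [ id , (λ f≡0 → contradiction f≡0 (partial-∣ {f = f} p*f (ps p p∈) p∣n)) ]′
    (ℤ.i*j≡0⇒i≡0∨j≡0 (x p) (trans (sym (Σ-single (λ q → x q ℤ.* f q) u p∈ term≡0)) Dn≡0))
  where
  term≡0 : ∀ j → j ∈ ks → j ≢ p → x j ℤ.* f j ≡ 0ℤ
  term≡0 j j∈ j≢p with others j j∈ j≢p
  ... | inj₁ xj≡0 = cong (ℤ._* f j) xj≡0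
  ... | inj₂ j∤n  = trans (cong (x j ℤ.*_) (partial-∤ {f = f} p*f (ps j j∈) j∤n)) (ℤ.*-zeroʳ (x j))

-- The pigeonhole inequality for a box of volume t · t · X. The free coordinates, with coefficients
-- `A` and `B`, take at most a quarter of the volume each; the sum `S` over the restricted ones,
-- together with the 1, takes less than half.
counting : ∀ {A B S t X L} → 2 + 2 * L < t * t → 4 * A ≤ t * X → 4 * B ≤ t * X → S ≤ L → 0 < X →
  suc (A * (t ∸ 1) + (B * (t ∸ 1) + S)) < t * (t * X)
counting {A} {B} {S} {t} {X} {L} t-large A≤ B≤ S≤L 0<X = *-cancelˡ-< 4 _ _ (begin-strict
  4 * suc (A * (t ∸ 1) + (B * (t ∸ 1) + S))
    ≡⟨ solve 4 (λ a b s u → con 4 :* (con 1 :+ (a :* u :+ (b :* u :+ s)))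
                  := con 4 :* a :* u :+ con 4 :* b :* u :+ (con 4 :+ con 4 :* s)) refl A B S (t ∸ 1) ⟩
  4 * A * (t ∸ 1) + 4 * B * (t ∸ 1) + (4 + 4 * S)
    ≤⟨ +-mono-≤ (+-mono-≤ (*-mono-≤ A≤ (m∸n≤m t 1)) (*-mono-≤ B≤ (m∸n≤m t 1))) (+-monoʳ-≤ 4 (*-monoʳ-≤ 4 S≤L)) ⟩
  t * X * t + t * X * t + (4 + 4 * L)
    ≡⟨ cong (_+_ (t * X * t + t * X * t)) (solve 1 (λ l → con 4 :+ con 4 :* l := con 2 :* (con 2 :+ con 2 :* l)) refl L) ⟩
  t * X * t + t * X * t + 2 * (2 + 2 * L)
    <⟨ +-monoʳ-< (t * X * t + t * X * t) (*-monoʳ-< 2 t-large) ⟩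
  t * X * t + t * X * t + 2 * (t * t)
    ≤⟨ +-monoʳ-≤ (t * X * t + t * X * t) (*-monoʳ-≤ 2 (m≤m*n (t * t) X {{>-nonZero 0<X}})) ⟩
  t * X * t + t * X * t + 2 * (t * t * X)
    ≡⟨ solve 2 (λ t x → t :* x :* t :+ t :* x :* t :+ con 2 :* (t :* t :* x) := con 4 :* (t :* (t :* x))) refl t X ⟩
  4 * (t * (t * X)) ∎)
  where
  open ≤-Reasoning
  open ℕ-Solver.+-*-Solver

sum-map-* : ∀ m (f : ℕ → ℕ) ks → sum (map (λ k → m * f k) ks) ≡ m * sum (map f ks)
sum-map-* m f []       = sym (*-zeroʳ m)
sum-map-* m f (k ∷ ks) = trans (cong (_+_ (m * f k)) (sum-map-* m f ks)) (sym (*-distribˡ-+ m (f k) _))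

coprime⇒∤ : ∀ {p m n} → Prime p → Coprime m n → p ∣ m → p ∤ n
coprime⇒∤ pp m⊥n p∣m p∣n = ¬prime[1] (subst Prime (m⊥n (p∣m , p∣n)) pp)

-- The exponent of p in n₁n₂n₃. As a sum over the terms it needs no decision which of them p
-- divides; for pairwise coprime terms at most one summand is non-zero.
weight : ℕ → ℕ → ℕ → ℕ → ℕ
weight n₁ n₂ n₃ p = val p n₁ + val p n₂ + val p n₃

module _ {n₁ n₂ n₃ c : ℕ} .{{_ : NonZero n₁}} .{{_ : NonZero n₂}} .{{_ : NonZero n₃}}
  (n₁⊥n₂ : Coprime n₁ n₂) (n₁⊥n₃ : Coprime n₁ n₃) (n₂⊥n₃ : Coprime n₂ n₃)
  (n₁≤c : n₁ ≤ c) (n₂≤c : n₂ ≤ c) (n₃≤c : n₃ ≤ c)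
  {f₁ f₂ f₃ : ℕ → ℤ} (F₁ : Partials n₁ f₁) (F₂ : Partials n₂ f₂) (F₃ : Partials n₃ f₃)
  {s₁ s₂ s₃ : ℤ} (∣s₁∣≡1 : ℤ.∣ s₁ ∣ ≡ 1) (∣s₂∣≡1 : ℤ.∣ s₂ ∣ ≡ 1) (∣s₃∣≡1 : ℤ.∣ s₃ ∣ ≡ 1)
  where

  κ : ℕ → ℤ
  κ p = s₁ ℤ.* f₁ p ℤ.+ s₂ ℤ.* f₂ p ℤ.+ s₃ ℤ.* f₃ p

  -- Keeping the factor p on the left serves both kinds of primes: a restricted box has at most p
  -- points, so its contribution to the pigeonhole sum is at most c times the weight, while at a
  -- free prime p is a gain for the volume condition.
  p*∣κ∣≤ : ∀ {p} → Prime p → p * ℤ.∣ κ p ∣ ≤ c * weight n₁ n₂ n₃ p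
  p*∣κ∣≤ {p} pp = begin
    p * ℤ.∣ κ p ∣
      ≤⟨ *-monoʳ-≤ p (≤-trans (ℤ.∣i+j∣≤∣i∣+∣j∣ (s₁ ℤ.* f₁ p ℤ.+ s₂ ℤ.* f₂ p) (s₃ ℤ.* f₃ p))
                              (+-monoˡ-≤ ℤ.∣ s₃ ℤ.* f₃ p ∣ (ℤ.∣i+j∣≤∣i∣+∣j∣ (s₁ ℤ.* f₁ p) (s₂ ℤ.* f₂ p)))) ⟩
    p * (ℤ.∣ s₁ ℤ.* f₁ p ∣ + ℤ.∣ s₂ ℤ.* f₂ p ∣ + ℤ.∣ s₃ ℤ.* f₃ p ∣)
      ≡⟨ cong (p *_) (cong₂ _+_ (cong₂ _+_ (∣s*f∣ s₁ (f₁ p) ∣s₁∣≡1) (∣s*f∣ s₂ (f₂ p) ∣s₂∣≡1)) (∣s*f∣ s₃ (f₃ p) ∣s₃∣≡1)) ⟩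
    p * (ℤ.∣ f₁ p ∣ + ℤ.∣ f₂ p ∣ + ℤ.∣ f₃ p ∣)
      ≡⟨ trans (*-distribˡ-+ p _ ℤ.∣ f₃ p ∣) (cong (_+ p * ℤ.∣ f₃ p ∣) (*-distribˡ-+ p ℤ.∣ f₁ p ∣ _)) ⟩
    p * ℤ.∣ f₁ p ∣ + p * ℤ.∣ f₂ p ∣ + p * ℤ.∣ f₃ p ∣
      ≡⟨ cong₂ _+_ (cong₂ _+_ (F₁ pp) (F₂ pp)) (F₃ pp) ⟩
    n₁ * val p n₁ + n₂ * val p n₂ + n₃ * val p n₃
      ≤⟨ +-mono-≤ (+-mono-≤ (*-monoˡ-≤ (val p n₁) n₁≤c) (*-monoˡ-≤ (val p n₂) n₂≤c)) (*-monoˡ-≤ (val p n₃) n₃≤c) ⟩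
    c * val p n₁ + c * val p n₂ + c * val p n₃
      ≡⟨ trans (*-distribˡ-+ c _ (val p n₃)) (cong (_+ c * val p n₃) (*-distribˡ-+ c (val p n₁) _)) ⟨
    c * weight n₁ n₂ n₃ p ∎
    where
    open ≤-Reasoning
    ∣s*f∣ : ∀ s j → ℤ.∣ s ∣ ≡ 1 → ℤ.∣ s ℤ.* j ∣ ≡ ℤ.∣ j ∣
    ∣s*f∣ s j ∣s∣≡1 = trans (ℤ.abs-* s j) (trans (cong (_* ℤ.∣ j ∣) ∣s∣≡1) (*-identityˡ ℤ.∣ j ∣))

  Σκ : ∀ ks (x : ℕ → ℤ) → ∑[ ks ] (λ p → x p ℤ.* κ p) ≡
    s₁ ℤ.* ∑[ ks ] (λ p → x p ℤ.* f₁ p) ℤ.+ s₂ ℤ.* ∑[ ks ] (λ p → x p ℤ.* f₂ p) ℤ.+ s₃ ℤ.* ∑[ ks ] (λ p → x p ℤ.* f₃ p)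
  Σκ ks x = begin
    ∑[ ks ] (λ p → x p ℤ.* κ p)
      ≡⟨ Σ-cong ks {λ p → x p ℤ.* κ p} {λ p → g₁ p ℤ.+ g₂ p ℤ.+ g₃ p} (λ p _ → solve 7 (λ x s t u a b e →
           x :* (s :* a :+ t :* b :+ u :* e) := s :* (x :* a) :+ t :* (x :* b) :+ u :* (x :* e)) refl
           (x p) s₁ s₂ s₃ (f₁ p) (f₂ p) (f₃ p)) ⟩
    ∑[ ks ] (λ p → g₁ p ℤ.+ g₂ p ℤ.+ g₃ p)
      ≡⟨ trans (Σ-distrib-+ ks (λ p → g₁ p ℤ.+ g₂ p) g₃) (cong (ℤ._+ ∑[ ks ] g₃) (Σ-distrib-+ ks g₁ g₂)) ⟩
    ∑[ ks ] g₁ ℤ.+ ∑[ ks ] g₂ ℤ.+ ∑[ ks ] g₃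
      ≡⟨ cong₂ ℤ._+_ (cong₂ ℤ._+_ (Σ-distrib-* ks s₁ (λ p → x p ℤ.* f₁ p)) (Σ-distrib-* ks s₂ (λ p → x p ℤ.* f₂ p)))
                     (Σ-distrib-* ks s₃ (λ p → x p ℤ.* f₃ p)) ⟩
    s₁ ℤ.* ∑[ ks ] (λ p → x p ℤ.* f₁ p) ℤ.+ s₂ ℤ.* ∑[ ks ] (λ p → x p ℤ.* f₂ p) ℤ.+ s₃ ℤ.* ∑[ ks ] (λ p → x p ℤ.* f₃ p) ∎
    where
    open ≡-Reasoning
    open ℤ-Solver.+-*-Solver
    g₁ g₂ g₃ : ℕ → ℤ
    g₁ p = s₁ ℤ.* (x p ℤ.* f₁ p)
    g₂ p = s₂ ℤ.* (x p ℤ.* f₂ p)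
    g₃ p = s₃ ℤ.* (x p ℤ.* f₃ p)

  module _ {p₀ q₀ : ℕ} {R : List ℕ}
    (p₀-prime : Prime p₀) (p₀∣n₁ : p₀ ∣ n₁) (q₀-prime : Prime q₀) (q₀∣n₂ : q₀ ∣ n₂)
    (unique : Unique (p₀ ∷ q₀ ∷ R)) (R-primes : All Prime R)
    (R-divides : All (λ p → p ∣ n₁ ⊎ p ∣ n₂ ⊎ p ∣ n₃) R) (R-weights : All (λ p → weight n₁ n₂ n₃ p < p) R)
    where

    private
      ks : List ℕ
      ks = p₀ ∷ q₀ ∷ R
      ∑ : (ℕ → ℤ) → (ℕ → ℤ) → ℤ
      ∑ x f = ∑[ ks ] (λ p → x p ℤ.* f p)

    ks-primes : ∀ p → p ∈ ks → Prime p
    ks-primes p p∈ = All.lookup (p₀-prime ∷ q₀-prime ∷ R-primes) p∈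

    -- The two equations make the sums Dᵢ = ∑ x fᵢ proportional to the nᵢ. Coprimality turns them
    -- into nᵢ ∣ Dᵢ, and the vanishing of a single Dᵢ into the vanishing of all.
    dependent⇒zero : ∀ (x : ℕ → ℤ) → (∀ p → p ∈ R → ℤ.∣ x p ∣ < p) →
      + n₁ ℤ.* ∑ x f₂ ≡ + n₂ ℤ.* ∑ x f₁ → + n₁ ℤ.* ∑ x f₃ ≡ + n₃ ℤ.* ∑ x f₁ →
      ∀ p → p ∈ ks → x p ≡ 0ℤ
    dependent⇒zero x small e₁₂ e₁₃ = all≡0
      where
      divides-D : ∀ {m n} {D E : ℤ} → Coprime m n → + m ℤ.* E ≡ + n ℤ.* D → + m ℤ.∣ D
      divides-D {m} {n} {D} {E} m⊥n e = ∣ᵤ⇒∣ (coprime-divisor m⊥n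
        (subst (m ∣_) (ℤ.abs-* (+ n) D) (∣⇒∣ᵤ {+ m} {+ n ℤ.* D} (ℤ.divides E (trans (sym e) (ℤ.*-comm (+ m) E))))))
      n₁∣D : + n₁ ℤ.∣ ∑ x f₁
      n₁∣D = divides-D {E = ∑ x f₂} n₁⊥n₂ e₁₂
      n₂∣D : + n₂ ℤ.∣ ∑ x f₂
      n₂∣D = divides-D {E = ∑ x f₁} (Coprimality.sym n₁⊥n₂) (sym e₁₂)
      n₃∣D : + n₃ ℤ.∣ ∑ x f₃
      n₃∣D = divides-D {E = ∑ x f₁} (Coprimality.sym n₁⊥n₃) (sym e₁₃)
      R≡0 : ∀ p → p ∈ R → x p ≡ 0ℤ
      R≡0 p p∈ with All.lookup R-divides p∈ | All.lookup R-weights p∈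
      ... | inj₁ p∣n₁ | w<p = small-coordinate≡0 n₁ x f₁ F₁ unique ks-primes (there (there p∈)) p∣n₁
              (≤-<-trans (≤-trans (m≤m+n (val p n₁) (val p n₂)) (m≤m+n (val p n₁ + val p n₂) (val p n₃))) w<p) (small p p∈) n₁∣D
      ... | inj₂ (inj₁ p∣n₂) | w<p = small-coordinate≡0 n₂ x f₂ F₂ unique ks-primes (there (there p∈)) p∣n₂
              (≤-<-trans (≤-trans (m≤n+m (val p n₂) (val p n₁)) (m≤m+n (val p n₁ + val p n₂) (val p n₃))) w<p) (small p p∈) n₂∣D
      ... | inj₂ (inj₂ p∣n₃) | w<p = small-coordinate≡0 n₃ x f₃ F₃ unique ks-primes (there (there p∈)) p∣n₃
              (≤-<-trans (m≤n+m (val p n₃) (val p n₁ + val p n₂)) w<p) (small p p∈) n₃∣D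
      -- The free primes divide n₁ and n₂, so n₃ sees only coordinates from `R`, which are already
      -- 0.
      D₃≡0 : ∑ x f₃ ≡ 0ℤ
      D₃≡0 = Σ-zero ks λ
        { p (here refl)         → term p (inj₂ (coprime⇒∤ p₀-prime n₁⊥n₃ p₀∣n₁)) p₀-prime
        ; p (there (here refl)) → term p (inj₂ (coprime⇒∤ q₀-prime n₂⊥n₃ q₀∣n₂)) q₀-prime
        ; p (there (there p∈))  → term p (inj₁ (R≡0 p p∈)) (All.lookup R-primes p∈) }
        where
        term : ∀ p → x p ≡ 0ℤ ⊎ p ∤ n₃ → Prime p → x p ℤ.* f₃ p ≡ 0ℤ
        term p (inj₁ x≡0)  _  = cong (ℤ._* f₃ p) x≡0
        term p (inj₂ p∤n₃) pp = trans (cong (x p ℤ.*_) (partial-∤ {f = f₃} F₃ pp p∤n₃)) (ℤ.*-zeroʳ (x p))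
      cancel : ∀ n .{{_ : NonZero n}} {D} → + n ℤ.* D ≡ 0ℤ → D ≡ 0ℤ
      cancel n e = [ (λ n≡0 → contradiction (ℤ.+-injective n≡0) (≢-nonZero⁻¹ n)) , id ]′ (ℤ.i*j≡0⇒i≡0∨j≡0 (+ n) e)
      D₁≡0 : ∑ x f₁ ≡ 0ℤ
      D₁≡0 = cancel n₃ (trans (sym e₁₃) (trans (cong (+ n₁ ℤ.*_) D₃≡0) (ℤ.*-zeroʳ (+ n₁))))
      D₂≡0 : ∑ x f₂ ≡ 0ℤ
      D₂≡0 = cancel n₁ (trans e₁₂ (trans (cong (+ n₂ ℤ.*_) D₁≡0) (ℤ.*-zeroʳ (+ n₂))))
      all≡0 : ∀ p → p ∈ ks → x p ≡ 0ℤ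
      all≡0 p (here refl) = only-coordinate≡0 n₁ x f₁ F₁ unique ks-primes (here refl) p₀∣n₁
        (λ { j (here refl) j≢p         → contradiction refl j≢p
           ; j (there (here refl)) _   → inj₂ (coprime⇒∤ q₀-prime (Coprimality.sym n₁⊥n₂) q₀∣n₂)
           ; j (there (there j∈)) _    → inj₁ (R≡0 j j∈) }) D₁≡0
      all≡0 p (there (here refl)) = only-coordinate≡0 n₂ x f₂ F₂ unique ks-primes (there (here refl)) q₀∣n₂
        (λ { j (here refl) _           → inj₂ (coprime⇒∤ p₀-prime n₁⊥n₂ p₀∣n₁)
           ; j (there (here refl)) j≢p → contradiction refl j≢p
           ; j (there (there j∈)) _    → inj₁ (R≡0 j j∈) }) D₂≡0
      all≡0 p (there (there p∈)) = R≡0 p p∈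

    IndependentSolution : ℕ → Set
    IndependentSolution t =
      ∃[ x ] (∀ p → p ∈ ks → ℤ.∣ x p ∣ < t)
           × s₁ ℤ.* ∑ x f₁ ℤ.+ s₂ ℤ.* ∑ x f₂ ℤ.+ s₃ ℤ.* ∑ x f₃ ≡ 0ℤ
           × ¬ (+ n₁ ℤ.* ∑ x f₂ ≡ + n₂ ℤ.* ∑ x f₁ × + n₁ ℤ.* ∑ x f₃ ≡ + n₃ ℤ.* ∑ x f₁)

    independentSolution : ∀ t → let ℓ = sum (map (weight n₁ n₂ n₃) ks); X = product (map (_⊓ t) R) in
      2 + 2 * (c * ℓ) < t * t → 4 * c * ℓ ≤ t * (X * p₀) → 4 * c * ℓ ≤ t * (X * q₀) →
      IndependentSolution t
    independentSolution t t-large p₀-large q₀-large =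
      conclude (siegel κ box unique (subst (suc (sum (map term ks)) <_) (sym volume) enough))
      where
      ℓ X : ℕ
      ℓ = sum (map (weight n₁ n₂ n₃) ks)
      X = product (map (_⊓ t) R)
      box : ℕ → ℕ
      box p with p ≟ p₀ | p ≟ q₀
      ... | yes _ | _     = t
      ... | no _  | yes _ = t
      ... | no _  | no _  = p ⊓ t
      box-p₀ : box p₀ ≡ t
      box-p₀ with p₀ ≟ p₀
      ... | yes _    = refl
      ... | no p₀≢p₀ = contradiction refl p₀≢p₀
      box-q₀ : box q₀ ≡ t
      box-q₀ with q₀ ≟ p₀ | q₀ ≟ q₀
      ... | yes _ | _        = refl
      ... | no _  | yes _    = refl
      ... | no _  | no q₀≢q₀ = contradiction refl q₀≢q₀
      box-R : ∀ p → p ∈ R → box p ≡ p ⊓ t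
      box-R p p∈ with p ≟ p₀ | p ≟ q₀
      ... | yes p≡p₀ | _        = contradiction (sym p≡p₀) (All.lookup (AllPairs.head unique) (there p∈))
      ... | no _     | yes p≡q₀ = contradiction (sym p≡q₀) (All.lookup (AllPairs.head (AllPairs.tail unique)) p∈)
      ... | no _     | no _     = refl
      box≤t : ∀ p → box p ≤ t
      box≤t p with p ≟ p₀ | p ≟ q₀
      ... | yes _ | _     = ≤-refl
      ... | no _  | yes _ = ≤-refl
      ... | no _  | no _  = m⊓n≤n p t
      volume : product (map box ks) ≡ t * (t * X)
      volume = cong₂ _*_ box-p₀ (cong₂ _*_ box-q₀ (cong product (map-cong-local (All.tabulate λ {p} → box-R p))))
      term : ℕ → ℕ
      term p = ℤ.∣ κ p ∣ * (box p ∸ 1)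
      -- At a free prime ∣κ p∣ is at most c · ℓ / p, which is why p may multiply `X` in the
      -- hypotheses although its own box has size t.
      free : ∀ {p} → Prime p → weight n₁ n₂ n₃ p ≤ ℓ → 4 * c * ℓ ≤ t * (X * p) → 4 * ℤ.∣ κ p ∣ ≤ t * X
      free {p} pp w≤ℓ large = *-cancelʳ-≤ _ _ p {{prime⇒nonZero pp}} (begin
        4 * ℤ.∣ κ p ∣ * p    ≡⟨ trans (*-assoc 4 ℤ.∣ κ p ∣ p) (cong (4 *_) (*-comm ℤ.∣ κ p ∣ p)) ⟩
        4 * (p * ℤ.∣ κ p ∣)  ≤⟨ *-monoʳ-≤ 4 (≤-trans (p*∣κ∣≤ pp) (*-monoʳ-≤ c w≤ℓ)) ⟩
        4 * (c * ℓ)          ≡⟨ *-assoc 4 c ℓ ⟨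
        4 * c * ℓ            ≤⟨ large ⟩
        t * (X * p)          ≡⟨ *-assoc t X p ⟨
        t * X * p            ∎)
        where open ≤-Reasoning
      restricted : sum (map term R) ≤ c * ℓ
      restricted = begin
        sum (map term R)                    ≤⟨ sum-map-≤ R term≤ ⟩
        sum (map (λ p → c * weight n₁ n₂ n₃ p) R)    ≡⟨ sum-map-* c (weight n₁ n₂ n₃) R ⟩
        c * sum (map (weight n₁ n₂ n₃) R)              ≤⟨ *-monoʳ-≤ c (≤-trans (m≤n+m (sum (map (weight n₁ n₂ n₃) R)) (weight n₁ n₂ n₃ q₀)) (m≤n+m (weight n₁ n₂ n₃ q₀ + sum (map (weight n₁ n₂ n₃) R)) (weight n₁ n₂ n₃ p₀))) ⟩
        c * ℓ                               ∎
        where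
        open ≤-Reasoning
        term≤ : ∀ p → p ∈ R → term p ≤ c * weight n₁ n₂ n₃ p
        term≤ p p∈ = begin
          ℤ.∣ κ p ∣ * (box p ∸ 1)  ≤⟨ *-monoʳ-≤ ℤ.∣ κ p ∣ (≤-trans (m∸n≤m (box p) 1)
                                        (≤-trans (≤-reflexive (box-R p p∈)) (m⊓n≤m p t))) ⟩
          ℤ.∣ κ p ∣ * p            ≡⟨ *-comm ℤ.∣ κ p ∣ p ⟩
          p * ℤ.∣ κ p ∣            ≤⟨ p*∣κ∣≤ (All.lookup R-primes p∈) ⟩
          c * weight n₁ n₂ n₃ p             ∎
      0<t : 0 < t
      0<t = n≢0⇒n>0 λ { refl → n≮0 t-large }
      0<X : 0 < X
      0<X = product-positive R R-primes
        where
        product-positive : ∀ ps → All Prime ps → 0 < product (map (_⊓ t) ps)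
        product-positive []       []         = z<s
        product-positive (p ∷ ps) (pp ∷ pps) =
          *-mono-< (⊓-pres-m< (<-trans z<s (prime⇒1< pp)) 0<t) (product-positive ps pps)
      enough : suc (sum (map term ks)) < t * (t * X)
      enough = subst₂ (λ a b → suc (ℤ.∣ κ p₀ ∣ * (a ∸ 1) + (ℤ.∣ κ q₀ ∣ * (b ∸ 1) + sum (map term R))) < t * (t * X))
        (sym box-p₀) (sym box-q₀)
        (counting {ℤ.∣ κ p₀ ∣} {ℤ.∣ κ q₀ ∣} {t = t} {X = X} t-large
          (free p₀-prime (m≤m+n (weight n₁ n₂ n₃ p₀) (weight n₁ n₂ n₃ q₀ + sum (map (weight n₁ n₂ n₃) R))) p₀-large)
          (free q₀-prime (≤-trans (m≤m+n (weight n₁ n₂ n₃ q₀) (sum (map (weight n₁ n₂ n₃) R))) (m≤n+m (weight n₁ n₂ n₃ q₀ + sum (map (weight n₁ n₂ n₃) R)) (weight n₁ n₂ n₃ p₀))) q₀-large)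
          restricted 0<X)
      conclude : ∃[ x ] (∃[ p ] p ∈ ks × x p ≢ 0ℤ) × (∀ p → p ∈ ks → ℤ.∣ x p ∣ < box p) × ∑ x κ ≡ 0ℤ → IndependentSolution t
      conclude (x , (p , p∈ , xp≢0) , small , eq) =
        x , (λ q q∈ → <-≤-trans (small q q∈) (box≤t q)) , trans (sym (Σκ ks x)) eq ,
        λ (e₁₂ , e₁₃) → xp≢0 (dependent⇒zero x
          (λ q q∈ → <-≤-trans (small q (there (there q∈))) (≤-trans (≤-reflexive (box-R q q∈)) (m⊓n≤m q t)))
          e₁₂ e₁₃ p p∈)

-- Triples a + b = c

-- n₁, n₂, n₃ is a reordering of a, b, c, with the signs of a + b − c = 0.
record Arrangement (a b c n₁ n₂ n₃ : ℕ) : Set where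
  field
    nonZero₁ : NonZero n₁
    nonZero₂ : NonZero n₂
    nonZero₃ : NonZero n₃
    coprime₁₂ : Coprime n₁ n₂
    coprime₁₃ : Coprime n₁ n₃
    coprime₂₃ : Coprime n₂ n₃
    ≤c₁ : n₁ ≤ c
    ≤c₂ : n₂ ≤ c
    ≤c₃ : n₃ ≤ c
    product≡ : n₁ * n₂ * n₃ ≡ a * b * c
    s₁ s₂ s₃ : ℤ
    ∣s₁∣≡1 : ℤ.∣ s₁ ∣ ≡ 1
    ∣s₂∣≡1 : ℤ.∣ s₂ ∣ ≡ 1
    ∣s₃∣≡1 : ℤ.∣ s₃ ∣ ≡ 1
    additive : ∀ (D : ℕ → ℤ) → s₁ ℤ.* D n₁ ℤ.+ s₂ ℤ.* D n₂ ℤ.+ s₃ ℤ.* D n₃ ≡ 0ℤ → D c ≡ D a ℤ.+ D b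
    proportional : ∀ (D : ℕ → ℤ) → + a ℤ.* D b ≡ + b ℤ.* D a → + a ℤ.* D c ≡ + c ℤ.* D a → + b ℤ.* D c ≡ + c ℤ.* D b →
      + n₁ ℤ.* D n₂ ≡ + n₂ ℤ.* D n₁ × + n₁ ℤ.* D n₃ ≡ + n₃ ℤ.* D n₁

module _ {a b c} (abc : ABCTriple a b c) where
  open ABCTriple abc

  a⊥b : Coprime a b
  a⊥b (d∣a , d∣b) = ∣1⇒≡1 (subst (_ ∣_) coprime
    (gcd-greatest (gcd-greatest d∣a d∣b) (subst (_ ∣_) a+b≡c (∣m∣n⇒∣m+n d∣a d∣b))))

  a⊥c : Coprime a c
  a⊥c (d∣a , d∣c) = a⊥b (d∣a , ∣m+n∣m⇒∣n (subst (_ ∣_) (sym a+b≡c) d∣c) d∣a)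

  b⊥c : Coprime b c
  b⊥c (d∣b , d∣c) = a⊥b (∣m+n∣m⇒∣n (subst (_ ∣_) (trans (sym a+b≡c) (+-comm a b)) d∣c) d∣b , d∣b)

  a≤c : a ≤ c
  a≤c = subst (a ≤_) a+b≡c (m≤m+n a b)

  b≤c : b ≤ c
  b≤c = subst (b ≤_) a+b≡c (m≤n+m b a)

  private
    isolate : ∀ x y {z w} → w ≡ x ℤ.+ y ℤ.- z → w ≡ 0ℤ → z ≡ x ℤ.+ y
    isolate x y {z} w≡ w≡0 = sym (ℤ.i-j≡0⇒i≡j (x ℤ.+ y) z (trans (sym w≡) w≡0))

  arrangement-abc : Arrangement a b c a b c
  arrangement-abc = record
    { nonZero₁ = >-nonZero 0<a ; nonZero₂ = >-nonZero 0<b ; nonZero₃ = >-nonZero 0<c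
    ; coprime₁₂ = a⊥b ; coprime₁₃ = a⊥c ; coprime₂₃ = b⊥c
    ; ≤c₁ = a≤c ; ≤c₂ = b≤c ; ≤c₃ = ≤-refl
    ; product≡ = refl
    ; s₁ = 1ℤ ; s₂ = 1ℤ ; s₃ = ℤ.-1ℤ
    ; ∣s₁∣≡1 = refl ; ∣s₂∣≡1 = refl ; ∣s₃∣≡1 = refl
    ; additive = λ D → isolate (D a) (D b) (solve 3 (λ x y z →
        con 1ℤ :* x :+ con 1ℤ :* y :+ con ℤ.-1ℤ :* z := x :+ y :- z) refl (D a) (D b) (D c))
    ; proportional = λ D ab ac bc → ab , ac
    }
    where open ℤ-Solver.+-*-Solver

  arrangement-acb : Arrangement a b c a c b
  arrangement-acb = record
    { nonZero₁ = >-nonZero 0<a ; nonZero₂ = >-nonZero 0<c ; nonZero₃ = >-nonZero 0<b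
    ; coprime₁₂ = a⊥c ; coprime₁₃ = a⊥b ; coprime₂₃ = Coprimality.sym b⊥c
    ; ≤c₁ = a≤c ; ≤c₂ = ≤-refl ; ≤c₃ = b≤c
    ; product≡ = trans (*-assoc a c b) (trans (cong (a *_) (*-comm c b)) (sym (*-assoc a b c)))
    ; s₁ = 1ℤ ; s₂ = ℤ.-1ℤ ; s₃ = 1ℤ
    ; ∣s₁∣≡1 = refl ; ∣s₂∣≡1 = refl ; ∣s₃∣≡1 = refl
    ; additive = λ D → isolate (D a) (D b) (solve 3 (λ x y z →
        con 1ℤ :* x :+ con ℤ.-1ℤ :* z :+ con 1ℤ :* y := x :+ y :- z) refl (D a) (D b) (D c))
    ; proportional = λ D ab ac bc → ac , ab
    }
    where open ℤ-Solver.+-*-Solver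

  arrangement-bca : Arrangement a b c b c a
  arrangement-bca = record
    { nonZero₁ = >-nonZero 0<b ; nonZero₂ = >-nonZero 0<c ; nonZero₃ = >-nonZero 0<a
    ; coprime₁₂ = b⊥c ; coprime₁₃ = Coprimality.sym a⊥b ; coprime₂₃ = Coprimality.sym a⊥c
    ; ≤c₁ = b≤c ; ≤c₂ = ≤-refl ; ≤c₃ = a≤c
    ; product≡ = trans (*-comm (b * c) a) (sym (*-assoc a b c))
    ; s₁ = 1ℤ ; s₂ = ℤ.-1ℤ ; s₃ = 1ℤ
    ; ∣s₁∣≡1 = refl ; ∣s₂∣≡1 = refl ; ∣s₃∣≡1 = refl
    ; additive = λ D → isolate (D a) (D b) (solve 3 (λ x y z →
        con 1ℤ :* y :+ con ℤ.-1ℤ :* z :+ con 1ℤ :* x := x :+ y :- z) refl (D a) (D b) (D c))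
    ; proportional = λ D ab ac bc → bc , sym ab
    }
    where open ℤ-Solver.+-*-Solver

SmallIndependent : ℕ → ℕ → ℕ → Set
SmallIndependent a b t =
  ∃[ ψ ] ψ ∈𝒯[ a , b ] × Independent ψ (+ a) (+ b) × ∃[ s ] ‖ ψ ‖≡ s × s < t

-- The independence hypothesis is symmetric in the three terms, so that any arrangement of them can
-- supply it. Given additivity, its three proportionalities follow from the first one, which is W =
-- 0.
smallIndependent : ∀ {a b c t} → a + b ≡ c → 0 < t → ∀ {ks} → Unique ks →
  (∀ p → p ∈ ks → Prime p) → (∀ p → p ∈ ks → p ∣ a * b * c) →
  ∀ x → (∀ p → p ∈ ks → ℤ.∣ x p ∣ < t) →
  let δ = λ n → functional ks x (d (+ n)) in
  δ c ≡ δ a ℤ.+ δ b →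
  ¬ (+ a ℤ.* δ b ≡ + b ℤ.* δ a × + a ℤ.* δ c ≡ + c ℤ.* δ a × + b ℤ.* δ c ≡ + c ℤ.* δ b) →
  SmallIndependent a b t
smallIndependent {a} {b} {t = t} refl 0<t {ks} u ps ks∣abc x small δc≡ independent =
  fromCoordinates ks u x ,
  record { support = support ; additive = δc≡ } ,
  (λ W≡0 → independent (dependent (ℤ.i-j≡0⇒i≡j (+ a ℤ.* δ b) (+ b ℤ.* δ a) W≡0))) ,
  maximum ks x , ‖fromCoordinates‖ u (λ p p∈ → (p , ps p p∈) , refl) x ,
  ≤-<-trans (maximum≤ x (λ p p∈ → <⇒≤pred (small p p∈))) (≤-reflexive (suc-pred t {{>-nonZero 0<t}}))
  where
  δ : ℕ → ℤ
  δ n = functional ks x (d (+ n))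
  support : ∀ p → functional ks x (ξ p) ≢ 0ℤ → proj₁ p ∣ a * b * (a + b)
  support p ψξ≢0 with proj₁ p ∈? ks
  ... | yes p∈ = ks∣abc (proj₁ p) p∈
  ... | no p∉  = contradiction (functional-ξ-∉ x p p∉) ψξ≢0
  dependent : + a ℤ.* δ b ≡ + b ℤ.* δ a →
    + a ℤ.* δ b ≡ + b ℤ.* δ a × + a ℤ.* δ (a + b) ≡ + (a + b) ℤ.* δ a × + b ℤ.* δ (a + b) ≡ + (a + b) ℤ.* δ b
  dependent e = e ,
    (begin
      + a ℤ.* δ (a + b)                ≡⟨ cong (+ a ℤ.*_) δc≡ ⟩
      + a ℤ.* (δ a ℤ.+ δ b)            ≡⟨ ℤ.*-distribˡ-+ (+ a) (δ a) (δ b) ⟩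
      + a ℤ.* δ a ℤ.+ + a ℤ.* δ b      ≡⟨ cong (ℤ._+_ (+ a ℤ.* δ a)) e ⟩
      + a ℤ.* δ a ℤ.+ + b ℤ.* δ a      ≡⟨ ℤ.*-distribʳ-+ (δ a) (+ a) (+ b) ⟨
      (+ a ℤ.+ + b) ℤ.* δ a            ∎) ,
    (begin
      + b ℤ.* δ (a + b)                ≡⟨ cong (+ b ℤ.*_) δc≡ ⟩
      + b ℤ.* (δ a ℤ.+ δ b)            ≡⟨ ℤ.*-distribˡ-+ (+ b) (δ a) (δ b) ⟩
      + b ℤ.* δ a ℤ.+ + b ℤ.* δ b      ≡⟨ cong (ℤ._+ + b ℤ.* δ b) e ⟨
      + a ℤ.* δ b ℤ.+ + b ℤ.* δ b      ≡⟨ ℤ.*-distribʳ-+ (δ b) (+ a) (+ b) ⟨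
      (+ a ℤ.+ + b) ℤ.* δ b            ∎)
    where open ≡-Reasoning

arrangementSolution : ∀ {a b c n₁ n₂ n₃ p₀ q₀ R t} → a + b ≡ c → Arrangement a b c n₁ n₂ n₃ →
  Prime p₀ → p₀ ∣ n₁ → Prime q₀ → q₀ ∣ n₂ → Unique (p₀ ∷ q₀ ∷ R) → All Prime R →
  All (λ p → p ∣ n₁ ⊎ p ∣ n₂ ⊎ p ∣ n₃) R → All (λ p → weight n₁ n₂ n₃ p < p) R →
  let ℓ = sum (map (weight n₁ n₂ n₃) (p₀ ∷ q₀ ∷ R)); X = product (map (_⊓ t) R) in
  2 + 2 * (c * ℓ) < t * t → 4 * c * ℓ ≤ t * (X * p₀) → 4 * c * ℓ ≤ t * (X * q₀) →
  SmallIndependent a b t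
arrangementSolution {a} {b} {c} {n₁} {n₂} {n₃} {p₀} {q₀} {R} {t} a+b≡c arr pp p∣ pq q∣ u pR R∣ R< t-large p-large q-large =
  conclude (independentSolution coprime₁₂ coprime₁₃ coprime₂₃ ≤c₁ ≤c₂ ≤c₃
    {f n₁} {f n₂} {f n₃} (partials-d n₁) (partials-d n₂) (partials-d n₃) {s₁} {s₂} {s₃} ∣s₁∣≡1 ∣s₂∣≡1 ∣s₃∣≡1
    pp p∣ pq q∣ u pR R∣ R< t t-large p-large q-large)
  where
  open Arrangement arr
  instance
    n₁≢0 : NonZero n₁
    n₁≢0 = nonZero₁
    n₂≢0 : NonZero n₂
    n₂≢0 = nonZero₂
    n₃≢0 : NonZero n₃
    n₃≢0 = nonZero₃
  f : ℕ → ℕ → ℤ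
  f n p = coeff p (d (+ n))
  ks : List ℕ
  ks = p₀ ∷ q₀ ∷ R
  0<t : 0 < t
  0<t = n≢0⇒n>0 λ { refl → n≮0 t-large }
  all-divide : All (λ p → p ∣ n₁ ⊎ p ∣ n₂ ⊎ p ∣ n₃) ks
  all-divide = inj₁ p∣ ∷ inj₂ (inj₁ q∣) ∷ R∣
  divides-abc : ∀ p → p ∈ ks → p ∣ a * b * c
  divides-abc p p∈ = subst (p ∣_) product≡
    ([ ∣m⇒∣m*n n₃ ∘ ∣m⇒∣m*n n₂ , [ ∣m⇒∣m*n n₃ ∘ ∣n⇒∣m*n n₁ , ∣n⇒∣m*n (n₁ * n₂) ]′ ]′ (All.lookup all-divide p∈))
  conclude : _ → SmallIndependent a b t
  conclude (x , small , eq , independent) =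
    smallIndependent a+b≡c 0<t u (λ p → All.lookup (pp ∷ pq ∷ pR)) divides-abc x small
      (additive (λ n → functional ks x (d (+ n))) eq)
      (λ (ab , ac , bc) → independent (proportional (λ n → functional ks x (d (+ n))) ab ac bc))

-- Prime divisors up to the square root, and products over sets of primes

primeDivisor : ∀ n → 1 < n → ∃[ p ] Prime p × p ∣ n
primeDivisor n 1<n = first (factorise n {{>-nonZero (<-trans z<s 1<n)}})
  where
  first : PrimeFactorisation n → ∃[ p ] Prime p × p ∣ n
  first record { factors = [] ; isFactorisation = n≡1 } = contradiction n≡1 (>⇒≢ 1<n)
  first record { factors = p ∷ ps ; isFactorisation = refl ; factorsPrime = pp ∷ _ } = p , pp , m∣m*n (product ps)

-- A composite n is a product of two factors > 1, and a prime divisor of the smaller one is at most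
-- √n.
smallPrimeDivisor : ∀ n → 1 < n → ¬ Prime n → ∃[ p ] Prime p × p ∣ n × p * p ≤ n
smallPrimeDivisor n 1<n ¬pn = fromDivisor (¬prime⇒composite {{n>1⇒nonTrivial 1<n}} ¬pn)
  where
  instance
    n≢0 : NonZero n
    n≢0 = >-nonZero (<-trans z<s 1<n)
  half : ∀ {d e} → 1 < d → d ≤ e → n ≡ e * d → ∃[ p ] Prime p × p ∣ n × p * p ≤ n
  half {d} {e} 1<d d≤e refl with p , pp , p∣d ← primeDivisor d 1<d =
    p , pp , ∣n⇒∣m*n e p∣d , *-mono-≤ (≤-trans p≤d d≤e) p≤d
    where p≤d = ∣⇒≤ {{>-nonZero (<-trans z<s 1<d)}} p∣d
  fromDivisor : Composite n → ∃[ p ] Prime p × p ∣ n × p * p ≤ n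
  fromDivisor (hasNonTrivialDivisor {divisor = d} d<n d∣n) with ≤-total d (quotient d∣n)
  ... | inj₁ d≤e = half (nonTrivial⇒n>1 d) d≤e (_∣_.equality d∣n)
  ... | inj₂ e≤d = half (quotient>1 d∣n d<n) e≤d (trans (_∣_.equality d∣n) (*-comm _ d))

product-filter : ∀ {P : ℕ → Set} (P? : Decidable P) ns →
  product ns ≡ product (filter P? ns) * product (filter (¬? ∘ P?) ns)
product-filter P? []       = refl
product-filter P? (n ∷ ns) with P? n
... | yes _ = trans (cong (n *_) (product-filter P? ns)) (sym (*-assoc n _ _))
... | no _  = trans (cong (n *_) (product-filter P? ns))
                    (solve 3 (λ n p q → n :* (p :* q) := p :* (n :* q)) refl
                      n (product (filter P? ns)) (product (filter (¬? ∘ P?) ns)))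
  where open ℕ-Solver.+-*-Solver

product-map-≤ : ∀ {f g : ℕ → ℕ} ns → All (λ n → f n ≤ g n) ns → product (map f ns) ≤ product (map g ns)
product-map-≤ []       []          = ≤-refl
product-map-≤ (n ∷ ns) (f≤g ∷ f≤gs) = *-mono-≤ f≤g (product-map-≤ ns f≤gs)

product-^ : ∀ ns k → product ns ^ k ≡ product (map (_^ k) ns)
product-^ []       k = ^-zeroˡ k
product-^ (n ∷ ns) k = trans (*-^-distrib n (product ns) k) (cong (n ^ k *_) (product-^ ns k))

product-2^ : ∀ (f : ℕ → ℕ) ns → product (map (λ n → 2 ^ f n) ns) ≡ 2 ^ sum (map f ns)
product-2^ f []       = refl
product-2^ f (n ∷ ns) = trans (cong (2 ^ f n *_) (product-2^ f ns)) (sym (^-distribˡ-+-* 2 (f n) _))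

p^weight∣ : ∀ n₁ n₂ n₃ p → p ^ weight n₁ n₂ n₃ p ∣ n₁ * n₂ * n₃
p^weight∣ n₁ n₂ n₃ p = subst (_∣ n₁ * n₂ * n₃) (sym split)
  (*-pres-∣ (*-pres-∣ (p^val∣ p n₁) (p^val∣ p n₂)) (p^val∣ p n₃))
  where
  split : p ^ weight n₁ n₂ n₃ p ≡ p ^ val p n₁ * p ^ val p n₂ * p ^ val p n₃
  split = trans (^-distribˡ-+-* p (val p n₁ + val p n₂) (val p n₃))
                (cong (_* p ^ val p n₃) (^-distribˡ-+-* p (val p n₁) (val p n₂)))

module _ {c n₁ n₂ n₃} .{{_ : NonZero (n₁ * n₂ * n₃)}} (n₁n₂n₃≤c³ : n₁ * n₂ * n₃ ≤ c ^ 3) where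

  private
    w = weight n₁ n₂ n₃

  product-p^weight≤ : ∀ {ps} → Unique ps → All Prime ps → product (map (λ p → p ^ w p) ps) ≤ c ^ 3
  product-p^weight≤ u pps = ≤-trans
    (∣⇒≤ (product-primePowers-∣ w u pps (All.tabulate λ {p} _ → p^weight∣ n₁ n₂ n₃ p))) n₁n₂n₃≤c³

  -- The sum ℓ of the weights is logarithmic in c: 2^ℓ ≤ ∏ p^(w p) ≤ c³. The K-th power form is what
  -- the comparison of powers consumes.
  sum-weight^K≤ : ∀ K .{{_ : NonZero K}} {ps} → Unique ps → All Prime ps →
    sum (map w ps) ^ K ≤ K ^ K * c ^ 3
  sum-weight^K≤ K {ps} u pps = begin
    sum (map w ps) ^ K                          ≤⟨ n^k≤k^k*2^n K (sum (map w ps)) ⟩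
    K ^ K * 2 ^ sum (map w ps)                  ≡⟨ cong (K ^ K *_) (product-2^ w ps) ⟨
    K ^ K * product (map (λ p → 2 ^ w p) ps)    ≤⟨ *-monoʳ-≤ (K ^ K) (product-map-≤ ps
                                                      (All.map (λ {p} pp → ^-monoˡ-≤ (w p) (prime⇒1< pp)) pps)) ⟩
    K ^ K * product (map (λ p → p ^ w p) ps)    ≤⟨ *-monoʳ-≤ (K ^ K) (product-p^weight≤ u pps) ⟩
    K ^ K * c ^ 3                               ∎
    where open ≤-Reasoning

  -- Primes of exponent at least K multiply to at most c^(3/K), so leaving them out of the system
  -- costs a negligible part of the radical.
  product-heavy^K≤ : ∀ K {ps} → Unique ps → All Prime ps → All (λ p → K ≤ w p) ps → product ps ^ K ≤ c ^ 3
  product-heavy^K≤ K {ps} u pps heavy = begin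
    product ps ^ K                    ≡⟨ product-^ ps K ⟩
    product (map (_^ K) ps)           ≤⟨ product-map-≤ ps (All.zipWith
                                           (λ {p} (pp , K≤) → ^-monoʳ-≤ p {{prime⇒nonZero pp}} K≤) (pps , heavy)) ⟩
    product (map (λ p → p ^ w p) ps)  ≤⟨ product-p^weight≤ u pps ⟩
    c ^ 3                             ∎
    where open ≤-Reasoning

  -- Every prime outside R is one of the finitely many dividing E, or occurs
  -- in n₁n₂n₃ to a power ≥ K.
  module _ (E K : ℕ) .{{_ : NonZero E}} where

    restricted : List ℕ → List ℕ
    restricted ps = filter (λ p → w p <? K) (filter (λ p → ¬? (p ∣? E)) ps)

    product≤restricted : ∀ {ps} → Unique ps → All Prime ps →
      ∃[ Q ] Q ^ K ≤ c ^ 3 × product ps ≤ product (restricted ps) * Q * E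
    product≤restricted {ps} u pps = product heavy ,
      product-heavy^K≤ K (unique-filter⁺ (¬? ∘ light?) (unique-filter⁺ (¬? ∘ (_∣? E)) u))
        (All.filter⁺ (¬? ∘ light?) (All.filter⁺ (¬? ∘ (_∣? E)) pps))
        (All.map ≮⇒≥ (all-filter (¬? ∘ light?) rest)) ,
      (begin
        product ps                                      ≡⟨ product-filter (¬? ∘ (_∣? E)) ps ⟩
        product rest * product small                    ≡⟨ cong (_* product small) (product-filter light? rest) ⟩
        product (restricted ps) * product heavy * product small
                                                        ≤⟨ *-monoʳ-≤ (product (restricted ps) * product heavy) small≤ ⟩
        product (restricted ps) * product heavy * E     ∎)
      where
      open ≤-Reasoning
      light? : Decidable (λ p → w p < K)
      light? p = w p <? K
      rest small heavy : List ℕ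
      rest  = filter (¬? ∘ (_∣? E)) ps
      small = filter (¬? ∘ ¬? ∘ (_∣? E)) ps
      heavy = filter (¬? ∘ light?) rest
      small≤ : product small ≤ E
      small≤ = ∣⇒≤ (product-primes-∣ (unique-filter⁺ (¬? ∘ ¬? ∘ (_∣? E)) u) (All.filter⁺ (¬? ∘ ¬? ∘ (_∣? E)) pps)
        (All.map (λ {p} → decidable-stable (p ∣? E)) (all-filter (¬? ∘ ¬? ∘ (_∣? E)) ps)))

-- Counting

-- t is the strict bound for ‖ ψ ‖.
module Bounds {α β K c t : ℕ} (β<α : β < α) (α<2β : α < 2 * β) (24αβ<K : 24 * α * β < K)
  (large : (4 * K * K !) ^ (4 * α * β * K) ≤ c) (large′ : (4 * K) ^ K ≤ c) (1<c : 1 < c)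
  (c≤t : c ^ (2 * β + α) ≤ t ^ (4 * β)) where

  open ≤-Reasoning

  private
    0<β : 0 < β
    0<β = n≢0⇒n>0 λ { refl → n≮0 α<2β }
    0<α : 0 < α
    0<α = <-trans 0<β β<α
    16≤K : 16 ≤ K
    16≤K = begin
      16          ≤⟨ m≤n+m 16 8 ⟩
      24          ≤⟨ *-mono-≤ (m≤m*n 24 α {{>-nonZero 0<α}}) 0<β ⟩
      24 * α * β  ≤⟨ <⇒≤ 24αβ<K ⟩
      K           ∎
    instance
      K≢0 : NonZero K
      K≢0 = >-nonZero (≤-<-trans z≤n 24αβ<K)
      c≢0 : NonZero c
      c≢0 = >-nonZero (<-trans z<s 1<c)
      K!≢0 : NonZero (K !)
      K!≢0 = K !≢0

  -- The exponent 1/2 + α/(4β) of c is more than 3/4 because β < α.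
  c³≤t⁴ : c ^ 3 ≤ t ^ 4
  c³≤t⁴ = ^-cancelˡ-≤ β {{>-nonZero 0<β}} (begin
    (c ^ 3) ^ β        ≡⟨ ^-*-assoc c 3 β ⟩
    c ^ (3 * β)        ≤⟨ ^-monoʳ-≤ c 3β≤2β+α ⟩
    c ^ (2 * β + α)    ≤⟨ c≤t ⟩
    t ^ (4 * β)        ≡⟨ ^-*-assoc t 4 β ⟨
    (t ^ 4) ^ β        ∎)
    where
    3β≤2β+α : 3 * β ≤ 2 * β + α
    3β≤2β+α = begin
      3 * β      ≡⟨ *-distribʳ-+ β 2 1 ⟩
      2 * β + 1 * β  ≤⟨ +-monoʳ-≤ (2 * β) (≤-trans (≤-reflexive (*-identityˡ β)) (<⇒≤ β<α)) ⟩
      2 * β + α  ∎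

  c≤t*t : c ≤ t * t
  c≤t*t = ^-cancelˡ-≤ 2 (begin
    c ^ 2          ≤⟨ ^-monoʳ-≤ c (n≤1+n 2) ⟩
    c ^ 3          ≤⟨ c³≤t⁴ ⟩
    t ^ 4          ≡⟨ solve 1 (λ t → t :^ 4 := (t :* t) :^ 2) refl t ⟩
    (t * t) ^ 2    ∎)
    where open ℕ-Solver.+-*-Solver

  -- From t ≥ c^(3/4) and X ≥ √c the product t · X is at least c · c^(1/4), while 4ℓ ≤ c^(4/K);
  -- hence the need for K ≥ 16.
  large-box : ∀ {ℓ X} → ℓ ^ K ≤ K ^ K * c ^ 3 → c ≤ X * X → 4 * c * ℓ ≤ t * X
  large-box {ℓ} {X} ℓ≤ c≤X² = ^-cancelˡ-≤ 4 (begin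
    (4 * c * ℓ) ^ 4          ≡⟨ solve 2 (λ c l → (con 4 :* c :* l) :^ 4 := c :^ 4 :* (con 4 :* l) :^ 4) refl c ℓ ⟩
    c ^ 4 * (4 * ℓ) ^ 4      ≤⟨ *-monoʳ-≤ (c ^ 4) 4ℓ≤ ⟩
    c ^ 4 * c                ≡⟨ solve 1 (λ c → c :^ 4 :* c := c :^ 3 :* (c :* c)) refl c ⟩
    c ^ 3 * (c * c)          ≤⟨ *-mono-≤ c³≤t⁴ (*-mono-≤ c≤X² c≤X²) ⟩
    t ^ 4 * (X * X * (X * X)) ≡⟨ solve 2 (λ t x → t :^ 4 :* (x :* x :* (x :* x)) := (t :* x) :^ 4) refl t X ⟩
    (t * X) ^ 4              ∎)
    where
    open ℕ-Solver.+-*-Solver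
    4ℓ≤ : (4 * ℓ) ^ 4 ≤ c
    4ℓ≤ = ^-cancelˡ-≤ K (begin
      ((4 * ℓ) ^ 4) ^ K              ≡⟨ ^-swap (4 * ℓ) 4 K ⟩
      ((4 * ℓ) ^ K) ^ 4              ≡⟨ cong (_^ 4) (*-^-distrib 4 ℓ K) ⟩
      (4 ^ K * ℓ ^ K) ^ 4            ≤⟨ ^-monoˡ-≤ 4 (*-monoʳ-≤ (4 ^ K) ℓ≤) ⟩
      (4 ^ K * (K ^ K * c ^ 3)) ^ 4  ≡⟨ cong (_^ 4) (trans (sym (*-assoc (4 ^ K) (K ^ K) (c ^ 3)))
                                          (cong (_* c ^ 3) (sym (*-^-distrib 4 K K)))) ⟩
      ((4 * K) ^ K * c ^ 3) ^ 4      ≤⟨ ^-monoˡ-≤ 4 (*-monoˡ-≤ (c ^ 3) large′) ⟩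
      (c ^ 4) ^ 4                    ≡⟨ ^-*-assoc c 4 4 ⟩
      c ^ 16                         ≤⟨ ^-monoʳ-≤ c 16≤K ⟩
      c ^ K                          ∎)

  -- `large-box` with t in the place of X, as t² ≥ c. The constant 2 is absorbed because c · ℓ ≥ 2.
  large-t : ∀ {ℓ} → ℓ ^ K ≤ K ^ K * c ^ 3 → 0 < ℓ → 2 + 2 * (c * ℓ) < t * t
  large-t {ℓ} ℓ≤ 0<ℓ = begin-strict
    2 + 2 * (c * ℓ)          ≤⟨ +-monoˡ-≤ (2 * (c * ℓ)) (*-mono-≤ 1<c 0<ℓ) ⟩
    c * ℓ + 2 * (c * ℓ)      <⟨ m<n+m _ (*-mono-< (<-trans z<s 1<c) 0<ℓ) ⟩
    c * ℓ + (c * ℓ + 2 * (c * ℓ))  ≡⟨ solve 2 (λ c l → c :* l :+ (c :* l :+ con 2 :* (c :* l)) := con 4 :* c :* l) refl c ℓ ⟩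
    4 * c * ℓ                ≤⟨ large-box ℓ≤ c≤t*t ⟩
    t * t                    ∎
    where open ℕ-Solver.+-*-Solver

  module _ {a b n₁ n₂ n₃ p₀ q₀ : ℕ} (a+b≡c : a + b ≡ c) (arr : Arrangement a b c n₁ n₂ n₃)
    (p₀-prime : Prime p₀) (p₀∣n₁ : p₀ ∣ n₁) (q₀-prime : Prime q₀) (q₀∣n₂ : q₀ ∣ n₂) where

    open Arrangement arr

    private
      instance
        n₁≢0 : NonZero n₁
        n₁≢0 = nonZero₁
        n₂≢0 : NonZero n₂
        n₂≢0 = nonZero₂
        n₃≢0 : NonZero n₃
        n₃≢0 = nonZero₃
        n₁n₂≢0 : NonZero (n₁ * n₂)
        n₁n₂≢0 = m*n≢0 n₁ n₂
        n₁n₂n₃≢0 : NonZero (n₁ * n₂ * n₃)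
        n₁n₂n₃≢0 = m*n≢0 (n₁ * n₂) n₃
      w : ℕ → ℕ
      w = weight n₁ n₂ n₃
      n₁n₂n₃≤c³ : n₁ * n₂ * n₃ ≤ c ^ 3
      n₁n₂n₃≤c³ = begin
        n₁ * n₂ * n₃  ≤⟨ *-mono-≤ (*-mono-≤ ≤c₁ ≤c₂) ≤c₃ ⟩
        c * c * c     ≡⟨ solve 1 (λ c → c :* c :* c := c :^ 3) refl c ⟩
        c ^ 3         ∎
        where open ℕ-Solver.+-*-Solver

    p₀≢q₀ : p₀ ≢ q₀
    p₀≢q₀ refl = coprime⇒∤ p₀-prime coprime₁₂ p₀∣n₁ q₀∣n₂

    module _ {R : List ℕ} (unique : Unique (p₀ ∷ q₀ ∷ R)) (R-primes : All Prime R)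
      (R-divides : All (λ p → p ∣ n₁ ⊎ p ∣ n₂ ⊎ p ∣ n₃) R) (R-weights : All (λ p → w p < p) R) where

      ℓ^K≤ : sum (map w (p₀ ∷ q₀ ∷ R)) ^ K ≤ K ^ K * c ^ 3
      ℓ^K≤ = sum-weight^K≤ {c} {n₁} {n₂} {n₃} n₁n₂n₃≤c³ K unique (p₀-prime ∷ q₀-prime ∷ R-primes)

      solveWith : let ℓ = sum (map w (p₀ ∷ q₀ ∷ R)); X = product (map (_⊓ t) R) in
        4 * c * ℓ ≤ t * (X * p₀) → 4 * c * ℓ ≤ t * (X * q₀) → SmallIndependent a b t
      solveWith = arrangementSolution a+b≡c arr p₀-prime p₀∣n₁ q₀-prime q₀∣n₂ unique R-primes R-divides R-weights
        (large-t ℓ^K≤ 0<ℓ)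
        where
        0<ℓ : 0 < sum (map w (p₀ ∷ q₀ ∷ R))
        0<ℓ = begin-strict
          0        <⟨ ∣⇒0<val p₀-prime p₀∣n₁ ⟩
          val p₀ n₁  ≤⟨ ≤-trans (m≤m+n (val p₀ n₁) (val p₀ n₂)) (m≤m+n (val p₀ n₁ + val p₀ n₂) (val p₀ n₃)) ⟩
          w p₀     ≤⟨ m≤m+n (w p₀) (sum (map w (q₀ ∷ R))) ⟩
          w p₀ + sum (map w (q₀ ∷ R)) ∎

      solveWithLargeBox : c ≤ product (map (_⊓ t) R) * product (map (_⊓ t) R) → SmallIndependent a b t
      solveWithLargeBox c≤X² = solveWith (weaken p₀-prime) (weaken q₀-prime)
        where
        X = product (map (_⊓ t) R)
        weaken : ∀ {p} → Prime p → 4 * c * sum (map w (p₀ ∷ q₀ ∷ R)) ≤ t * (X * p)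
        weaken {p} pp = ≤-trans (large-box ℓ^K≤ c≤X²) (*-monoʳ-≤ t (m≤m*n X p {{prime⇒nonZero pp}}))

    -- One box is enough, since p and t are both at least √c. From p² > c ≥ n₃ the weight of p is at
    -- most 1, hence below p.
    fromLargePrime : ∀ {p} → Prime p → p ∣ n₃ → c < p * p → SmallIndependent a b t
    fromLargePrime {p} pp p∣n₃ c<p² = solveWithLargeBox
      ((p₀≢q₀ ∷ p₀≢p ∷ []) ∷ (q₀≢p ∷ []) ∷ [] ∷ []) (pp ∷ []) (inj₂ (inj₂ p∣n₃) ∷ []) (w<p ∷ [])
      (≤-trans c≤X² (≤-reflexive (sym (cong₂ _*_ (*-identityʳ (p ⊓ t)) (*-identityʳ (p ⊓ t))))))
      where
      p₀≢p : p₀ ≢ p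
      p₀≢p refl = coprime⇒∤ p₀-prime coprime₁₃ p₀∣n₁ p∣n₃
      q₀≢p : q₀ ≢ p
      q₀≢p refl = coprime⇒∤ q₀-prime coprime₂₃ q₀∣n₂ p∣n₃
      c≤X² : c ≤ (p ⊓ t) * (p ⊓ t)
      c≤X² with ⊓-sel p t
      ... | inj₁ ≡p = ≤-trans (<⇒≤ c<p²) (≤-reflexive (sym (cong₂ _*_ ≡p ≡p)))
      ... | inj₂ ≡t = ≤-trans c≤t*t (≤-reflexive (sym (cong₂ _*_ ≡t ≡t)))
      val≤1 : val p n₃ ≤ 1
      val≤1 = ≮⇒≥ λ 1<val → <⇒≱ c<p² (begin
        p * p            ≡⟨ cong (p *_) (*-identityʳ p) ⟨
        p ^ 2            ≤⟨ ^-monoʳ-≤ p {{prime⇒nonZero pp}} 1<val ⟩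
        p ^ val p n₃     ≤⟨ ∣⇒≤ (p^val∣ p n₃) ⟩
        n₃               ≤⟨ ≤c₃ ⟩
        c                ∎)
      w<p : w p < p
      w<p = begin-strict
        val p n₁ + val p n₂ + val p n₃  ≡⟨ cong₂ (λ i j → i + j + val p n₃)
                                             (∤⇒val≡0 (coprime⇒∤ pp (Coprimality.sym coprime₁₃) p∣n₃))
                                             (∤⇒val≡0 (coprime⇒∤ pp (Coprimality.sym coprime₂₃) p∣n₃)) ⟩
        val p n₃                        ≤⟨ val≤1 ⟩
        1                               <⟨ prime⇒1< pp ⟩
        p                               ∎

    fromSmallPrimes : p₀ * p₀ ≤ c → q₀ * q₀ ≤ c → c ^ β ≤ rad (a * b * c) ^ α → SmallIndependent a b t
    -- Truncating the boxes at t could lose part of the radical. But if some p in `R` exceeds t,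
    -- then X ≥ t ≥ √c and `large-box` applies; otherwise nothing is truncated and X is the product
    -- of `R`.
    fromSmallPrimes p₀²≤c q₀²≤c c≤rad = conclude (any? (t <?_) R)
      where
      instance
        p₀≢0 : NonZero p₀
        p₀≢0 = prime⇒nonZero p₀-prime
        q₀≢0 : NonZero q₀
        q₀≢0 = prime⇒nonZero q₀-prime
        E≢0 : NonZero (K ! * p₀ * q₀)
        E≢0 = m*n≢0 (K ! * p₀) q₀ {{m*n≢0 (K !) p₀}}
      m E : ℕ
      m = a * b * c
      -- The factor K ! removes all primes up to K, so that the survivors satisfy w p < K < p; the
      -- factors p₀ and q₀ keep `R` disjoint from the free primes.
      E = K ! * p₀ * q₀
      ps R : List ℕ
      ps = primes m
      R  = restricted {c} {n₁} {n₂} {n₃} n₁n₂n₃≤c³ E K ps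
      ps-prime : All Prime ps
      ps-prime = All.tabulate λ p∈ → proj₁ (∈-primes⁻ m p∈)
      ∈R⁻ : ∀ {p} → p ∈ R → p ∈ ps × p ∤ E × w p < K
      ∈R⁻ {p} p∈ =
        let p∈′ , w<K = ∈-filter⁻ (λ p → w p <? K) {v = p} {xs = filter (λ p → ¬? (p ∣? E)) ps} p∈
            p∈ps , p∤E = ∈-filter⁻ (λ p → ¬? (p ∣? E)) {v = p} {xs = ps} p∈′
        in p∈ps , p∤E , w<K
      R-prime : ∀ {p} → p ∈ R → Prime p
      R-prime p∈ = All.lookup ps-prime (proj₁ (∈R⁻ p∈))
      R-primes : All Prime R
      R-primes = All.tabulate R-prime
      unique : Unique (p₀ ∷ q₀ ∷ R)
      unique =
        (p₀≢q₀ ∷ All.tabulate λ { p∈ refl → proj₁ (proj₂ (∈R⁻ p∈)) (∣m⇒∣m*n q₀ (n∣m*n (K !))) }) ∷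
        All.tabulate (λ { p∈ refl → proj₁ (proj₂ (∈R⁻ p∈)) (n∣m*n (K ! * p₀)) }) ∷
        unique-filter⁺ (λ p → w p <? K) (unique-filter⁺ (λ p → ¬? (p ∣? E)) (primes-unique m))
      R-divides : All (λ p → p ∣ n₁ ⊎ p ∣ n₂ ⊎ p ∣ n₃) R
      R-divides = All.tabulate λ {p} p∈ → divides-one (R-prime p∈)
        (subst (p ∣_) (sym product≡) (proj₂ (∈-primes⁻ m (proj₁ (∈R⁻ p∈)))))
        where
        divides-one : ∀ {p} → Prime p → p ∣ n₁ * n₂ * n₃ → p ∣ n₁ ⊎ p ∣ n₂ ⊎ p ∣ n₃
        divides-one pp p∣ with euclidsLemma (n₁ * n₂) n₃ pp p∣
        ... | inj₂ p∣n₃ = inj₂ (inj₂ p∣n₃)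
        ... | inj₁ p∣n₁n₂ with euclidsLemma n₁ n₂ pp p∣n₁n₂
        ...   | inj₁ p∣n₁ = inj₁ p∣n₁
        ...   | inj₂ p∣n₂ = inj₂ (inj₁ p∣n₂)
      K<p : ∀ {p} → Prime p → p ∤ E → K < p
      K<p {zero}  pp p∤E = contradiction pp ¬prime[0]
      K<p {suc p} pp p∤E = ≰⇒> λ p≤K → p∤E (∣m⇒∣m*n q₀ (∣m⇒∣m*n p₀ (∣-trans (m∣m*n (p !)) (m≤n⇒m!∣n! p≤K))))
      R-weights : All (λ p → w p < p) R
      R-weights = All.tabulate λ p∈ →
        let _ , p∤E , w<K = ∈R⁻ p∈ in <-trans w<K (K<p (R-prime p∈) p∤E)
      conclude : Dec (Any (t <_) R) → SmallIndependent a b t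
      conclude (yes t<R) = solveWithLargeBox unique R-primes R-divides R-weights
        (≤-trans c≤t*t (*-mono-≤ t≤X t≤X))
        where
        0<t : 0 < t
        0<t = n≢0⇒n>0 λ { refl → contradiction c≤t*t (<⇒≱ (<-trans z<s 1<c)) }
        t≤X : t ≤ product (map (_⊓ t) R)
        t≤X with p , p∈ , t<p ← find t<R = subst (_≤ product (map (_⊓ t) R)) (m≥n⇒m⊓n≡n (<⇒≤ t<p))
          (∈⇒≤product (All.map⁺ (All.map (λ {p} pp → >-nonZero (⊓-pres-m< (<-trans z<s (prime⇒1< pp)) 0<t)) R-primes))
                      (∈-map⁺ (_⊓ t) p∈))
      conclude (no t≮R) with Q , Q≤ , rad≤ ← product≤restricted {c} {n₁} {n₂} {n₃} n₁n₂n₃≤c³ E K (primes-unique m) ps-prime =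
        solveWith unique R-primes R-divides R-weights
          (counted (≤-trans rad≤ (≤-reflexive
            (solve 5 (λ x q k p₀ q₀ → x :* q :* (k :* p₀ :* q₀) := (x :* p₀) :* k :* q :* q₀) refl
               (product R) Q (K !) p₀ q₀))) q₀²≤c)
          (counted (≤-trans rad≤ (≤-reflexive
            (solve 5 (λ x q k p₀ q₀ → x :* q :* (k :* p₀ :* q₀) := (x :* q₀) :* k :* q :* p₀) refl
               (product R) Q (K !) p₀ q₀))) p₀²≤c)
        where
        open ℕ-Solver.+-*-Solver
        X≡ : product (map (_⊓ t) R) ≡ product R
        X≡ = cong product (map-id-local (All.map (λ t≮p → m≤n⇒m⊓n≡m (≮⇒≥ t≮p)) (¬Any⇒All¬ R t≮R)))
        -- Here p is the free prime that counts in the volume and q the one that is lost, at a cost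
        -- of at most √c. The two conditions are this one with the roles exchanged.
        counted : ∀ {p q} → rad m ≤ product R * p * K ! * Q * q → q * q ≤ c →
          4 * c * sum (map w (p₀ ∷ q₀ ∷ R)) ≤ t * (product (map (_⊓ t) R) * p)
        counted {p} {q} rad≤ q²≤c = subst (λ X → 4 * c * sum (map w (p₀ ∷ q₀ ∷ R)) ≤ t * (X * p)) (sym X≡)
          (powerComparison {α} {β} {K} {K !} {c} {sum (map w (p₀ ∷ q₀ ∷ R))} {rad m} {t} {product R * p} {Q}
            β<α α<2β 24αβ<K large (ℓ^K≤ unique R-primes R-divides R-weights) c≤rad (begin
              rad m ^ 2                                ≤⟨ ^-monoˡ-≤ 2 rad≤ ⟩
              (product R * p * K ! * Q * q) ^ 2        ≡⟨ *-^-distrib (product R * p * K ! * Q) q 2 ⟩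
              (product R * p * K ! * Q) ^ 2 * q ^ 2    ≤⟨ *-monoʳ-≤ ((product R * p * K ! * Q) ^ 2) (≤-trans (≤-reflexive (cong (q *_) (*-identityʳ q))) q²≤c) ⟩
              (product R * p * K ! * Q) ^ 2 * c        ∎)
            Q≤ c≤t)

module _ {α β K c t : ℕ} (β<α : β < α) (α<2β : α < 2 * β) (24αβ<K : 24 * α * β < K)
  (large : (4 * K * K !) ^ (4 * α * β * K) ≤ c) (large′ : (4 * K) ^ K ≤ c) (2<c : 2 < c)
  (c≤t : c ^ (2 * β + α) ≤ t ^ (4 * β)) where

  open Bounds β<α α<2β 24αβ<K large large′ (<-trans (s≤s z<s) 2<c) c≤t

  boundedSolution : ∀ {a b} → ABCTriple a b c → ¬ OneNPrime a b c →
    c ^ β ≤ rad (a * b * c) ^ α → SmallIndependent a b t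
  boundedSolution {a} {b} abc ¬1Nq c≤rad = byCases (<-cmp 1 a) (<-cmp 1 b)
    where
    open ABCTriple abc
    1<c : 1 < c
    1<c = <-trans (s≤s z<s) 2<c
    byCases : Tri (1 < a) (1 ≡ a) (a < 1) → Tri (1 < b) (1 ≡ b) (b < 1) → SmallIndependent a b t
    byCases (tri> _ _ a<1) _ = contradiction 0<a (<⇒≱ a<1)
    byCases _ (tri> _ _ b<1) = contradiction 0<b (<⇒≱ b<1)
    byCases (tri≈ _ refl _) (tri≈ _ refl _) = contradiction a+b≡c (<⇒≢ 2<c)
    byCases (tri≈ _ refl _) (tri< 1<b _ _)
      with p , pp , p∣b , p²≤b ← smallPrimeDivisor b 1<b (λ b-prime → ¬1Nq (c , b , 0<c , b-prime , prep 1 (swap b c ↭-refl)))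
         | q , pq , q∣c , q²≤c ← smallPrimeDivisor c 1<c (λ c-prime → ¬1Nq (b , c , 0<b , c-prime , ↭-refl))
      = fromSmallPrimes a+b≡c (arrangement-bca abc) pp p∣b pq q∣c (≤-trans p²≤b (b≤c abc)) q²≤c c≤rad
    byCases (tri< 1<a _ _) (tri≈ _ refl _)
      with p , pp , p∣a , p²≤a ← smallPrimeDivisor a 1<a (λ a-prime → ¬1Nq (c , a , 0<c , a-prime ,
                                   ↭-trans (swap a 1 ↭-refl) (prep 1 (swap a c ↭-refl))))
         | q , pq , q∣c , q²≤c ← smallPrimeDivisor c 1<c (λ c-prime → ¬1Nq (a , c , 0<a , c-prime , swap a 1 ↭-refl))
      = fromSmallPrimes a+b≡c (arrangement-acb abc) pp p∣a pq q∣c (≤-trans p²≤a (a≤c abc)) q²≤c c≤rad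
    byCases (tri< 1<a _ _) (tri< 1<b _ _)
      with p , pp , p∣a ← primeDivisor a 1<a | q , pq , q∣b ← primeDivisor b 1<b | r , pr , r∣c ← primeDivisor c 1<c
      -- Only the primes of a and b are tested: a large one becomes the restricted prime, and
      -- `fromLargePrime` puts no bound on the free primes, so `r` may have any size.
      with p * p ≤? c | q * q ≤? c
    ... | no p²≰c  | _        = fromLargePrime a+b≡c (arrangement-bca abc) pq q∣b pr r∣c pp p∣a (≰⇒> p²≰c)
    ... | yes _    | no q²≰c  = fromLargePrime a+b≡c (arrangement-acb abc) pp p∣a pr r∣c pq q∣b (≰⇒> q²≰c)
    ... | yes p²≤c | yes q²≤c = fromSmallPrimes a+b≡c (arrangement-abc abc) pp p∣a pq q∣b p²≤c q²≤c c≤rad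

-- Here α / β is a rational exponent in the abc-hypothesis; the exponent
-- (2β + α) / 4β of c is 1/2 + (α/β)/4.
rationalTheorem : ∀ {α β} → β < α → α < 2 * β →
  (∀ a b c → ABCTriple a b c → c ^ β ≤ rad (a * b * c) ^ α) →
  ∃[ c₀ ] ∀ a b c → ABCTriple a b c → ¬ OneNPrime a b c → c₀ ≤ c →
    ∃[ ψ ] ψ ∈𝒯[ a , b ] × Independent ψ (+ a) (+ b)
         × ∃[ s ] ‖ ψ ‖≡ s × s ^ (4 * β) < c ^ (2 * β + α)
-- `c₁` absorbs the constants of `powerComparison` and `c₂` those of `large-box`; the 3 excludes 1 +
-- 1 = 2.
rationalTheorem {α} {β} β<α α<2β c≤rad = c₁ ⊔ (c₂ ⊔ 3) , solve
  where
  K c₁ c₂ : ℕ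
  K  = suc (24 * α * β)
  c₁ = (4 * K * K !) ^ (4 * α * β * K)
  c₂ = (4 * K) ^ K
  instance
    4β≢0 : NonZero (4 * β)
    4β≢0 = m*n≢0 4 β {{_}} {{>-nonZero (n≢0⇒n>0 λ { refl → n≮0 α<2β })}}
  solve : ∀ a b c → ABCTriple a b c → ¬ OneNPrime a b c → c₁ ⊔ (c₂ ⊔ 3) ≤ c →
    ∃[ ψ ] ψ ∈𝒯[ a , b ] × Independent ψ (+ a) (+ b)
         × ∃[ s ] ‖ ψ ‖≡ s × s ^ (4 * β) < c ^ (2 * β + α)
  solve a b c abc ¬1Nq c₀≤c
    -- The boxes are bounded by `suc t`, whose 4β-th power reaches c^(2β + α) as the counting
    -- requires. The norm is then at most t, whose power is strictly smaller.
    with t , t<c , c≤t ← integerRoot (4 * β) (c ^ (2 * β + α)) (m^n>0 c {{>-nonZero (ABCTriple.0<c abc)}} (2 * β + α))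
    with ψ , ψ∈ , independent , s , ‖ψ‖≡s , s<suc-t ← boundedSolution β<α α<2β ≤-refl
           (m⊔n≤o⇒m≤o c₁ (c₂ ⊔ 3) c₀≤c)
           (m⊔n≤o⇒m≤o c₂ 3 (m⊔n≤o⇒n≤o c₁ (c₂ ⊔ 3) c₀≤c))
           (m⊔n≤o⇒n≤o c₂ 3 (m⊔n≤o⇒n≤o c₁ (c₂ ⊔ 3) c₀≤c))
           c≤t abc ¬1Nq (c≤rad a b c abc)
    = ψ , ψ∈ , independent , s , ‖ψ‖≡s , ≤-<-trans (^-monoˡ-≤ (4 * β) (≤-pred s<suc-t)) t<c

-- From real to rational exponents

toℚᵘ-/ : ∀ i n → ℚ.toℚᵘ (i ℚ./ suc n) ℚᵘ.≃ ℚᵘ.mkℚᵘ i n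
toℚᵘ-/ i n = ℚ.toℚᵘ-fromℚᵘ (ℚᵘ.mkℚᵘ i n)

/-cancel-≤ : ∀ {i j m n} → + i ℚ./ suc m ℚ.≤ + j ℚ./ suc n → i * suc n ≤ j * suc m
/-cancel-≤ {i} {j} {m} {n} i/m≤j/n = ℤ.drop‿+≤+ (subst₂ ℤ._≤_ (sym (ℤ.pos-* i (suc n))) (sym (ℤ.pos-* j (suc m)))
  (ℚᵘ.drop-*≤* (ℚᵘ.≤-respˡ-≃ (toℚᵘ-/ (+ i) m) (ℚᵘ.≤-respʳ-≃ (toℚᵘ-/ (+ j) n) (ℚ.toℚᵘ-mono-≤ i/m≤j/n)))))

/-cancel-< : ∀ {i j m n} → + i ℚ./ suc m ℚ.< + j ℚ./ suc n → i * suc n < j * suc m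
/-cancel-< {i} {j} {m} {n} i/m<j/n = ℤ.drop‿+<+ (subst₂ ℤ._<_ (sym (ℤ.pos-* i (suc n))) (sym (ℤ.pos-* j (suc m)))
  (ℚᵘ.drop-*<* (ℚᵘ.<-respˡ-≃ (toℚᵘ-/ (+ i) m) (ℚᵘ.<-respʳ-≃ (toℚᵘ-/ (+ j) n) (ℚ.toℚᵘ-mono-< i/m<j/n)))))

¼ : ℚ
¼ = + 1 ℚ./ 4

exponent : ∀ α b → + (2 * suc b + α) ℚ./ (4 * suc b) ≡ ½ ℚ.+ ¼ ℚ.* (+ α ℚ./ suc b)
exponent α b = ℚ.toℚᵘ-injective (begin
  ℚ.toℚᵘ (+ (2 * suc b + α) ℚ./ (4 * suc b))
    ≈⟨ toℚᵘ-/ (+ (2 * suc b + α)) _ ⟩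
  ℚᵘ.mkℚᵘ (+ (2 * suc b + α)) _
    ≈⟨ ℚᵘ.*≡* crossProduct ⟩
  ℚᵘ.mkℚᵘ (+ 1) 1 ℚᵘ.+ ℚᵘ.mkℚᵘ (+ 1) 3 ℚᵘ.* ℚᵘ.mkℚᵘ (+ α) b
    ≈⟨ ℚᵘ.+-congʳ (ℚᵘ.mkℚᵘ (+ 1) 1) (ℚᵘ.*-congˡ {ℚᵘ.mkℚᵘ (+ 1) 3} (toℚᵘ-/ (+ α) b)) ⟨
  ℚ.toℚᵘ ½ ℚᵘ.+ ℚ.toℚᵘ ¼ ℚᵘ.* ℚ.toℚᵘ (+ α ℚ./ suc b)
    ≈⟨ ℚᵘ.+-congʳ (ℚ.toℚᵘ ½) (ℚ.toℚᵘ-homo-* ¼ (+ α ℚ./ suc b)) ⟨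
  ℚ.toℚᵘ ½ ℚᵘ.+ ℚ.toℚᵘ (¼ ℚ.* (+ α ℚ./ suc b))
    ≈⟨ ℚ.toℚᵘ-homo-+ ½ (¼ ℚ.* (+ α ℚ./ suc b)) ⟨
  ℚ.toℚᵘ (½ ℚ.+ ¼ ℚ.* (+ α ℚ./ suc b)) ∎)
  where
  open ℚᵘ.≃-Reasoning
  crossProduct : + (2 * suc b + α) ℤ.* + (2 * (4 * suc b)) ≡
    (+ 1 ℤ.* + (4 * suc b) ℤ.+ + 1 ℤ.* + α ℤ.* + 2) ℤ.* + (4 * suc b)
  crossProduct = E.begin
    + (2 * suc b + α) ℤ.* + (2 * (4 * suc b))
      E.≡⟨ ℤ.pos-* (2 * suc b + α) (2 * (4 * suc b)) ⟨
    + ((2 * suc b + α) * (2 * (4 * suc b)))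
      E.≡⟨ cong +_ (solve 2 (λ b a → (con 2 :* b :+ a) :* (con 2 :* (con 4 :* b))
             := (con 1 :* (con 4 :* b) :+ con 1 :* a :* con 2) :* (con 4 :* b)) refl (suc b) α) ⟩
    + ((1 * (4 * suc b) + 1 * α * 2) * (4 * suc b))
      E.≡⟨ ℤ.pos-* (1 * (4 * suc b) + 1 * α * 2) (4 * suc b) ⟩
    + (1 * (4 * suc b) + 1 * α * 2) ℤ.* + (4 * suc b)
      E.≡⟨ cong (ℤ._* + (4 * suc b)) (cong₂ ℤ._+_ (ℤ.pos-* 1 (4 * suc b))
             (trans (ℤ.pos-* (1 * α) 2) (cong (ℤ._* + 2) (ℤ.pos-* 1 α)))) ⟩
    (+ 1 ℤ.* + (4 * suc b) ℤ.+ + 1 ℤ.* + α ℤ.* + 2) ℤ.* + (4 * suc b) E.∎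
    where
    module E = ≡-Reasoning
    open ℕ-Solver.+-*-Solver

-- For x ≥ 1 the reciprocal of 4x is at most 1/4, which makes the threshold
-- 1 − (2 − x)/(4x) at least 1/2 + x/4 on [1 , 2].
linearLowerBound : ∀ {x} → 1ℚ ℚ.≤ x → x ℚ.≤ + 2 ℚ./ 1 →
  ½ ℚ.+ ¼ ℚ.* x ℚ.≤ 1ℚ ℚ.- (+ 2 ℚ./ 1 ℚ.- x) ℚ.* recip (+ 4 ℚ./ 1 ℚ.* x)
linearLowerBound {x} 1≤x x≤2 = begin
  ½ ℚ.+ ¼ ℚ.* x
    ≡⟨ solve 1 (λ x → con ½ :+ con ¼ :* x := con 1ℚ :- (con two :- x) :* con ¼) refl x ⟩
  1ℚ ℚ.- (two ℚ.- x) ℚ.* ¼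
    ≤⟨ ℚ.+-monoʳ-≤ 1ℚ (ℚ.neg-antimono-≤ (ℚ.*-monoˡ-≤-nonNeg (two ℚ.- x) {{ℚ.nonNegative 0≤2-x}} r≤¼)) ⟩
  1ℚ ℚ.- (two ℚ.- x) ℚ.* r ∎
  where
  open ℚ.≤-Reasoning
  open ℚ-Solver.+-*-Solver
  two four r : ℚ
  two  = + 2 ℚ./ 1
  four = + 4 ℚ./ 1
  r = recip (four ℚ.* x)
  0≤2-x : 0ℚ ℚ.≤ two ℚ.- x
  0≤2-x = subst (ℚ._≤ two ℚ.- x) (ℚ.+-inverseʳ x) (ℚ.+-monoˡ-≤ (ℚ.- x) x≤2)
  0<1 : 0ℚ ℚ.< 1ℚ
  0<1 = ℚ.positive⁻¹ 1ℚ
  0<4x : 0ℚ ℚ.< four ℚ.* x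
  0<4x = 0<*0< (ℚ.positive⁻¹ four) (ℚ.<-≤-trans 0<1 1≤x)
  r≤¼ : r ℚ.≤ ¼
  r≤¼ = begin
    r                          ≡⟨ ℚ.*-identityʳ r ⟨
    r ℚ.* 1ℚ                   ≤⟨ ℚ.*-monoˡ-≤-nonNeg r {{ℚ.nonNegative (ℚ.<⇒≤ (0<recip (four ℚ.* x) 0<4x))}} 1≤x ⟩
    r ℚ.* x                    ≡⟨ solve 2 (λ r x → r :* x := r :* (con four :* x) :* con ¼) refl r x ⟩
    r ℚ.* (four ℚ.* x) ℚ.* ¼   ≡⟨ cong (ℚ._* ¼) (recip-inverse (four ℚ.* x) 0<4x) ⟩
    1ℚ ℚ.* ¼                   ≡⟨ ℚ.*-identityˡ ¼ ⟩
    ¼                          ∎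

p-q<r⇒p≤q+r : ∀ {p q r} → ℚ.∣ p ℚ.- q ∣ ℚ.< r → p ℚ.≤ q ℚ.+ r
p-q<r⇒p≤q+r {p} {q} {r} ∣p-q∣<r = begin
  p                   ≡⟨ solve 2 (λ p q → p := q :+ (p :- q)) refl p q ⟩
  q ℚ.+ (p ℚ.- q)     ≤⟨ ℚ.+-monoʳ-≤ q (≤∣∣ (p ℚ.- q)) ⟩
  q ℚ.+ ℚ.∣ p ℚ.- q ∣  ≤⟨ ℚ.+-monoʳ-≤ q (ℚ.<⇒≤ ∣p-q∣<r) ⟩
  q ℚ.+ r             ∎
  where
  open ℚ.≤-Reasoning
  open ℚ-Solver.+-*-Solver
  ≤∣∣ : ∀ p → p ℚ.≤ ℚ.∣ p ∣
  ≤∣∣ p with ℚ.≤-total 0ℚ p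
  ... | inj₁ 0≤p = ℚ.≤-reflexive (sym (ℚ.0≤p⇒∣p∣≡p 0≤p))
  ... | inj₂ p≤0 = ℚ.≤-trans p≤0 (ℚ.0≤∣p∣ p)

p<p+q : ∀ p {q} → 0ℚ ℚ.< q → p ℚ.< p ℚ.+ q
p<p+q p {q} 0<q = subst (ℚ._< p ℚ.+ q) (ℚ.+-identityʳ p) (ℚ.+-monoʳ-< p 0<q)

-- The abc-hypothesis only weakens when its exponent grows, so M may be rounded up to a rational μ.
-- It must stay below 2, and within ε of M because η can be arbitrarily close to the threshold.
rationalUpperBound : ∀ M → fromℕ 1 <ᴿ M → M <ᴿ fromℕ 2 → ∀ ε → 0ℚ ℚ.< ε →
  ∃[ μ ] ∃[ N ] 1ℚ ℚ.< μ × μ ℚ.< + 2 ℚ./ 1 ×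
    (∀ n → N ≤ n → seq M n ℚ.≤ μ × μ ℚ.≤ seq M n ℚ.+ ε × 1ℚ ℚ.≤ seq M n × seq M n ℚ.≤ + 2 ℚ./ 1)
rationalUpperBound M (ε₁ , 0<ε₁ , N₁ , 1+ε₁≤) (ε₂ , 0<ε₂ , N₂ , +ε₂≤2) ε 0<ε = μ , N ,
  ℚ.≤-<-trans (1≤ N ≤-refl) (p<p+q (seq M N) 0<δ) ,
  ℚ.<-≤-trans (ℚ.+-monoʳ-< (seq M N) (ℚ.<-≤-trans (p<p+q δ 0<δ) δ+δ≤ε₂)) (+ε₂≤2 N (N₂≤ ≤-refl)) ,
  λ n N≤n →
    p-q<r⇒p≤q+r (proj₂ cauchyδ n N (N₃≤ N≤n) (N₃≤ ≤-refl)) ,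
    (begin
      seq M N ℚ.+ δ            ≤⟨ ℚ.+-monoˡ-≤ δ (p-q<r⇒p≤q+r {seq M N} {seq M n} (proj₂ cauchyδ N n (N₃≤ ≤-refl) (N₃≤ N≤n))) ⟩
      seq M n ℚ.+ δ ℚ.+ δ      ≡⟨ ℚ.+-assoc (seq M n) δ δ ⟩
      seq M n ℚ.+ (δ ℚ.+ δ)    ≤⟨ ℚ.+-monoʳ-≤ (seq M n) δ+δ≤ε ⟩
      seq M n ℚ.+ ε            ∎) ,
    1≤ n N≤n ,
    ℚ.≤-trans (ℚ.<⇒≤ (p<p+q (seq M n) 0<ε₂)) (+ε₂≤2 n (N₂≤ N≤n))
  where
  open ℚ.≤-Reasoning
  δ : ℚ
  -- δ is both the Cauchy error and the shift that lifts μ above M. Twice δ is at most ε, which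
  -- keeps μ near M, and at most the gap `ε₂` between M and 2, which keeps μ below 2.
  δ = ½ ℚ.* (ε ℚ.⊓ ε₂)
  0<δ : 0ℚ ℚ.< δ
  0<δ = 0<*0< 0<½ (0<⊓ (ℚ.⊓-sel ε ε₂))
    where
    0<⊓ : _ → 0ℚ ℚ.< ε ℚ.⊓ ε₂
    0<⊓ (inj₁ ≡ε)  = subst (0ℚ ℚ.<_) (sym ≡ε) 0<ε
    0<⊓ (inj₂ ≡ε₂) = subst (0ℚ ℚ.<_) (sym ≡ε₂) 0<ε₂
  δ+δ≤ε : δ ℚ.+ δ ℚ.≤ ε
  δ+δ≤ε = ℚ.≤-trans (ℚ.≤-reflexive (halves (ε ℚ.⊓ ε₂))) (ℚ.p⊓q≤p ε ε₂)
  δ+δ≤ε₂ : δ ℚ.+ δ ℚ.≤ ε₂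
  δ+δ≤ε₂ = ℚ.≤-trans (ℚ.≤-reflexive (halves (ε ℚ.⊓ ε₂))) (ℚ.p⊓q≤q ε ε₂)
  cauchyδ = cauchy M δ 0<δ
  N₃ N : ℕ
  N₃ = proj₁ cauchyδ
  N  = N₁ ⊔ (N₂ ⊔ N₃)
  N₁≤ : ∀ {n} → N ≤ n → N₁ ≤ n
  N₁≤ = m⊔n≤o⇒m≤o N₁ (N₂ ⊔ N₃)
  N₂≤ : ∀ {n} → N ≤ n → N₂ ≤ n
  N₂≤ N≤n = m⊔n≤o⇒m≤o N₂ N₃ (m⊔n≤o⇒n≤o N₁ (N₂ ⊔ N₃) N≤n)
  N₃≤ : ∀ {n} → N ≤ n → N₃ ≤ n
  N₃≤ N≤n = m⊔n≤o⇒n≤o N₂ N₃ (m⊔n≤o⇒n≤o N₁ (N₂ ⊔ N₃) N≤n)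
  μ : ℚ
  μ = seq M N ℚ.+ δ
  1≤ : ∀ n → N ≤ n → 1ℚ ℚ.≤ seq M n
  1≤ n N≤n = ℚ.≤-trans (ℚ.<⇒≤ (p<p+q 1ℚ 0<ε₁)) (1+ε₁≤ n (N₁≤ N≤n))

fraction : ∀ μ → 1ℚ ℚ.< μ → ∃[ α ] ∃[ b ] μ ≡ + α ℚ./ suc b
fraction (ℚ.mkℚ (+ α)        b _) _         = α , b , sym (ℚ.↥p/↧p≡p _)
fraction (ℚ.mkℚ (ℤ.-[1+ _ ]) b _) (ℚ.*<* ())

primes-prime : ∀ n → All Prime (primes n)
primes-prime n = All.tabulate λ p∈ → proj₁ (∈-primes⁻ n p∈)

-- The witness u / (1 + k) lies below M, hence below α / (1 + b). The inequalities are compared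
-- after raising to the power 1 + k, and r ≥ 1 makes powers of r monotone in the exponent.
<[^]⇒^≤^ : ∀ {M μ N c r α b} .{{_ : NonZero r}} → (∀ n → N ≤ n → seq M n ℚ.≤ μ) → μ ≡ + α ℚ./ suc b →
  c <[ r ^ M ] → c ^ suc b ≤ r ^ α
<[^]⇒^≤^ {M} {μ} {N} {c} {r} {α} {b} M≤μ refl (u , k , (ε , 0<ε , N′ , u/k+ε≤) , cᵏ<rᵘ) =
  ^-cancelˡ-≤ (suc k) (begin
    (c ^ suc b) ^ suc k    ≡⟨ ^-swap c (suc b) (suc k) ⟩
    (c ^ suc k) ^ suc b    ≤⟨ ^-monoˡ-≤ (suc b) (<⇒≤ cᵏ<rᵘ) ⟩
    (r ^ u) ^ suc b        ≡⟨ ^-*-assoc r u (suc b) ⟩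
    r ^ (u * suc b)        ≤⟨ ^-monoʳ-≤ r (/-cancel-≤ {u} {α} {k} {b} u/k≤μ) ⟩
    r ^ (α * suc k)        ≡⟨ ^-*-assoc r α (suc k) ⟨
    (r ^ α) ^ suc k        ∎)
  where
  open ≤-Reasoning
  n = N ⊔ N′
  u/k≤μ : + u ℚ./ suc k ℚ.≤ + α ℚ./ suc b
  u/k≤μ = ℚ.≤-trans (ℚ.<⇒≤ (p<p+q (+ u ℚ./ suc k) 0<ε))
    (ℚ.≤-trans (u/k+ε≤ n (m≤n⊔m N N′)) (M≤μ n (m≤m⊔n N N′)))

theorem4p5 : (M : ℝ) (1<M : fromℕ 1 <ᴿ M) → M <ᴿ fromℕ 2 →
    (∀ a b c → ABCTriple a b c → c <[ rad (a * b * c) ^ M ]) →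
    (η : ℝ) →
    fromℕ 1 -ᴿ (fromℕ 2 -ᴿ M) ÷ᴿ (fromℕ 4 *ᴿ M) [ 0<4* {M} 1<M ] <ᴿ η →
    Σ[ exceptions ∈ List (ℕ × ℕ × ℕ) ]
    (∀ a b c → ABCTriple a b c → ¬ OneNPrime a b c → (a , b , c) ∉ exceptions →
    ∃[ ψ ] ψ ∈𝒯[ a , b ]
    × Independent ψ (+ a) (+ b)
    × ∃[ s ] ‖ ψ ‖≡ s × s <[ c ^ η ])
theorem4p5 M 1<M M<2 abcBound η (ε , 0<ε , N₀ , threshold≤) = fromFraction
  (rationalUpperBound M 1<M M<2 ε 0<ε)
  where
  ¾ : ℚ
  ¾ = + 3 ℚ./ 4
  fromFraction : _ → _
  fromFraction (μ , N , 1<μ , μ<2 , bounds) with α , b , refl ← fraction μ 1<μ =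
    -- Both a and b are at most c, so the triples with c < c₀ all lie in this cube.
    cartesianProduct (upTo c₀) (cartesianProduct (upTo c₀) (upTo c₀)) , solution
    where
    β<α : suc b < α
    β<α = subst₂ _<_ (*-identityˡ (suc b)) (*-identityʳ α) (/-cancel-< {1} {α} {0} {b} 1<μ)
    α<2β : α < 2 * suc b
    α<2β = subst (_< 2 * suc b) (*-identityʳ α) (/-cancel-< {α} {2} {b} {0} μ<2)
    rational = rationalTheorem β<α α<2β λ a b′ c abc →
      <[^]⇒^≤^ {M} {c = c} {rad (a * b′ * c)} {α} {b} {{productOfPrimes≢0 (primes-prime (a * b′ * c))}}
        (λ n N≤n → proj₁ (bounds n N≤n)) refl (abcBound a b′ c abc)
    c₀ : ℕ
    c₀ = proj₁ rational
    exponent<η : fromℚ (+ (2 * suc b + α) ℚ./ (4 * suc b)) <ᴿ η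
    -- Rounding M up by at most ε raises 1/2 + M/4 by at most ε/4; the other three quarters of ε are
    -- the gap left below η.
    exponent<η = ¾ ℚ.* ε , 0<*0< (ℚ.positive⁻¹ ¾) 0<ε , N₀ ⊔ N , λ n N≤n →
      let _ , μ≤ , 1≤Mₙ , Mₙ≤2 = bounds n (m⊔n≤o⇒n≤o N₀ N N≤n) in begin
        + (2 * suc b + α) ℚ./ (4 * suc b) ℚ.+ ¾ ℚ.* ε
          ≡⟨ cong (ℚ._+ ¾ ℚ.* ε) (exponent α b) ⟩
        ½ ℚ.+ ¼ ℚ.* μ ℚ.+ ¾ ℚ.* ε
          ≤⟨ ℚ.+-monoˡ-≤ (¾ ℚ.* ε) (ℚ.+-monoʳ-≤ ½ (ℚ.*-monoˡ-≤-nonNeg ¼ μ≤)) ⟩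
        ½ ℚ.+ ¼ ℚ.* (seq M n ℚ.+ ε) ℚ.+ ¾ ℚ.* ε
          ≡⟨ solve 2 (λ x e → con ½ :+ con ¼ :* (x :+ e) :+ con ¾ :* e := con ½ :+ con ¼ :* x :+ e) refl (seq M n) ε ⟩
        ½ ℚ.+ ¼ ℚ.* seq M n ℚ.+ ε
          ≤⟨ ℚ.+-monoˡ-≤ ε (linearLowerBound 1≤Mₙ Mₙ≤2) ⟩
        1ℚ ℚ.- (+ 2 ℚ./ 1 ℚ.- seq M n) ℚ.* recip (+ 4 ℚ./ 1 ℚ.* seq M n) ℚ.+ ε
          ≤⟨ threshold≤ n (m⊔n≤o⇒m≤o N₀ N N≤n) ⟩
        seq η n ∎
      where
      open ℚ.≤-Reasoning
      open ℚ-Solver.+-*-Solver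
    solution : ∀ a b c → ABCTriple a b c → ¬ OneNPrime a b c →
      (a , b , c) ∉ cartesianProduct (upTo c₀) (cartesianProduct (upTo c₀) (upTo c₀)) →
      ∃[ ψ ] ψ ∈𝒯[ a , b ] × Independent ψ (+ a) (+ b) × ∃[ s ] ‖ ψ ‖≡ s × s <[ c ^ η ]
    solution a b′ c abc ¬1Nq ∉exceptions =
      let ψ , ψ∈ , independent , s , ‖ψ‖≡s , s< = proj₂ rational a b′ c abc ¬1Nq c₀≤c in
      ψ , ψ∈ , independent , s , ‖ψ‖≡s , 2 * suc b + α , _ , exponent<η , s<
      where
      c₀≤c : c₀ ≤ c
      c₀≤c = ≮⇒≥ λ c<c₀ → ∉exceptions (∈-cartesianProduct⁺ (∈-upTo⁺ (≤-<-trans (a≤c abc) c<c₀))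
        (∈-cartesianProduct⁺ (∈-upTo⁺ (≤-<-trans (b≤c abc) c<c₀)) (∈-upTo⁺ c<c₀)))
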